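{- Let $P^\ast(n)$ be defined by $\sum_{n\ge 0}P^\ast(n)q^n=f_1^4f_5^4$. Then for all integers $k\geq 0$ and $n\geq -1$, \begin{align*} P^\ast(2^{4k}n+2^{4k+1}-1)&\equiv 0\pmod{2^{6k}},\\ P^\ast(2^{4k+1}n+2^{4k+2}-1)&\equiv 0\pmod{2^{6k+2}},\\ P^\ast(2^{4k+2}n+2^{4k+3}-1)&\equiv 0\pmod{2^{6k+3}},\\ P^\ast(2^{4k+3}n+2^{4k+4}-1)&\equiv 0\pmod{2^{6k+6}},\\ P^\ast(2^{4k+4}n+3\cdot 2^{4k+3}-1)&=0. \end{align*}
   Context: For a positive integer $m$, $f_m:=\prod_{n=1}^\infty(1-q^{mn})$, regarded as a formal power series in $q$ (or for $|q|<1$). -}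

module Defs where

open import Data.Nat using (ℕ; zero; suc; _≤?_; _∸_; _*_)
open import Data.Integer using (ℤ; +_; -[1+_]; _-_)
open import Relation.Nullary using (yes; no)

Series : Set
Series = ℕ → ℤ

one : Series
one zero    = + 1
one (suc _) = + 0

mulOneMinusQ : ℕ → Series → Series
mulOneMinusQ m f i with m ≤? i
... | yes _ = f i - f (i ∸ m)
... | no  _ = f i

mul4 : ℕ → Series → Series
mul4 m f = mulOneMinusQ m (mulOneMinusQ m (mulOneMinusQ m (mulOneMinusQ m f)))

partialProd : ℕ → Series
partialProd zero    = one
partialProd (suc N) = mul4 (suc N) (mul4 (5 * suc N) (partialProd N))

-- Coefficients of f_1^4 f_5^4 = ∏_{n≥1} (1-q^n)^4 (1-q^{5n})^4.
-- The coefficient of q^N only depends on the factors with n ≤ N.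
PstarN : ℕ → ℤ
PstarN N = partialProd N N

Pstar : ℤ → ℤ
Pstar (+ N)    = PstarN N
Pstar -[1+ _ ] = + 0

{-# OPTIONS --safe #-}
module Submission where

-- Write f_s = ∏ (1 − q^{s n}), φ_s = Σ q^{s k²}, φ₋_s = Σ (−1)^k q^{s k²}, Ψ_s = Σ q^{s k (k + 1) / 2},
-- the sums running over k ∈ ℤ.  The Jacobi triple product gives Euler's pentagonal number theorem,
-- f_s² = f_{2s} φ₋_s and f_s Ψ_s = 2 f_{2s}².  Cutting ℤ² into cosets of sublattices gives
-- φ₋_s² = φ_{2s}² − q^s Ψ_{4s}², Ψ_s² = 2 φ_s Ψ_{2s} and 2 f_s f_{5s} = Ψ_{2s} φ_{5s} − q^s φ_s Ψ_{10s};
-- in the last one, multiplication by 1 + √−5 matches the exponents (x² + 5 y²) / 24 of f_s f_{5s}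
-- with the exponents (u² + 5 v²) / 4 of the right-hand side, since 1 + √−5 has norm 6.
-- For F_s = f_s⁴ f_{5s}⁴ these yield F_1 = f_2² f_10² φ₋_1² φ₋_5² = (a series in q²) − 4 q F_2 − 8 q³ F_4,
-- so a(n) = P*(n − 1) satisfies a(2n) = −4 a(n) − 8 a(n/2).  Hence a(4r) = −4 a(2r) − 8 a(r),
-- a(16n) = −64 a(n), and a(8n) = 0 for odd n.

open import Defs
open import Algebra.Bundles using (CommutativeRing)
import Algebra.Solver.Ring
open import Algebra.Solver.Ring.AlmostCommutativeRing using (fromCommutativeRing; _-Raw-AlmostCommutative⟶_)
open import Data.Bool using (Bool; true; false)
open import Data.Empty using (⊥; ⊥-elim)
open import Data.Fin using (Fin)
open import Data.Fin.Patterns using (0F; 1F; 2F)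
open import Data.Integer using (ℤ; +_; -[1+_]; _⊖_; ∣_∣; 0ℤ; 1ℤ; NonZero)
import Data.Integer as ℤ
import Data.Integer.DivMod as ℤ
open import Data.Integer.Divisibility using (_∣_)
import Data.Integer.Divisibility.Signed as Signed
import Data.Integer.Properties as ℤ
open import Data.Integer.Tactic.RingSolver using (solve-∀) renaming (solve to ring-ℤ)
open import Data.List using (List; []; _∷_; cartesianProduct; map; _++_)
open import Data.List.Membership.Propositional using (_∈_)
open import Data.List.Membership.Propositional.Properties using (∈-cartesianProduct⁺)
import Data.List.Relation.Unary.All as All
open import Data.List.Relation.Unary.AllPairs using ([]; _∷_)
open import Data.List.Relation.Unary.Any using (here; there)
open import Data.List.Relation.Unary.Unique.Propositional using (Unique)
import Data.List.Relation.Unary.Unique.Propositional.Properties as Unique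
open import Data.Maybe using (Maybe; just; nothing)
open import Data.Nat using (ℕ; zero; suc; z≤n; s≤s)
import Data.Nat as ℕ
import Data.Nat.Properties as ℕ
import Data.Nat.Tactic.RingSolver as ℕ-Solver
open import Data.Product using (_×_; _,_; ∃-syntax; proj₁; proj₂; uncurry)
open import Data.Product.Properties using (≡-dec)
open import Data.Sum using (_⊎_; inj₁; inj₂)
open import Function using (_∘_)
open import Function.Definitions using (Injective)
open import Level using (0ℓ)
open import Relation.Binary.Definitions using (DecidableEquality)
open import Relation.Binary.PropositionalEquality as ≡ using (_≡_; _≢_; _≗_)
open import Relation.Nullary using (Dec; yes; no)

-- All identities are proved modulo q^(N + 1), where N is the index of the coefficient that is
-- finally read. Products and theta series become finite there, but a finite box of ℤ² is not stable
-- under a change of lattice basis. Each regrouped double sum therefore comes with a proof that its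
-- terms vanish outside the box, both in the old and in the new coordinates; the growth of the
-- exponents, in the form |k| ≤ 1 + E k, supplies it. The identities for φ₋, Ψ and f_s f_{5s} are
-- the ones that the odd part of F_1 asks for. Up to sign, expanding φ₋_1² φ₋_5² leaves q f_2² f_10²
-- (Ψ_4² φ_10² + q⁴ φ_2² Ψ_20²) there. The bracket is the square of Ψ_4 φ_10 - q² φ_2 Ψ_20 = 2 f_2
-- f_10 plus 2 q² (φ_2 Ψ_4) (φ_10 Ψ_20), and the last two products are Ψ_2² / 2 and Ψ_10² / 2.
-- Identities stay doubled wherever a division by two would be required.

module PowerSeries where
  open Data.Nat using (_≤_; _<_)
  open Data.Integer using (_+_; _*_; _-_; -_)
  open ≡ using (refl; sym; trans; cong; cong₂)

  -- Integer power series and their truncations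

  conv : Series → Series → Series
  conv f g zero    = f 0 * g 0
  conv f g (suc n) = f 0 * g (suc n) + conv (f ∘ suc) g n

  conv-cong : ∀ n {f f′ g g′ : Series} → (∀ i → i ≤ n → f i ≡ f′ i) →
              (∀ i → i ≤ n → g i ≡ g′ i) → conv f g n ≡ conv f′ g′ n
  conv-cong zero    p q = cong₂ _*_ (p 0 z≤n) (q 0 z≤n)
  conv-cong (suc n) p q = cong₂ _+_
    (cong₂ _*_ (p 0 z≤n) (q (suc n) ℕ.≤-refl))
    (conv-cong n (λ i i≤n → p (suc i) (s≤s i≤n)) (λ i i≤n → q i (ℕ.m≤n⇒m≤1+n i≤n)))

  conv-zeroˡ : ∀ g n → conv (λ _ → 0ℤ) g n ≡ 0ℤ
  conv-zeroˡ g zero    = refl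
  conv-zeroˡ g (suc n) = trans (ℤ.+-identityˡ _) (conv-zeroˡ g n)

  conv-distribʳ : ∀ f g h n → conv (λ i → f i + g i) h n ≡ conv f h n + conv g h n
  conv-distribʳ f g h zero    = ℤ.*-distribʳ-+ (h 0) (f 0) (g 0)
  conv-distribʳ f g h (suc n) = trans
    (cong (_+_ ((f 0 + g 0) * h (suc n))) (conv-distribʳ (f ∘ suc) (g ∘ suc) h n))
    (lemma (f 0) (g 0) (h (suc n)) _ _)
    where
    lemma : ∀ a b c x y → (a + b) * c + (x + y) ≡ (a * c + x) + (b * c + y)
    lemma = solve-∀

  conv-scaleˡ : ∀ c f g n → conv (λ i → c * f i) g n ≡ c * conv f g n
  conv-scaleˡ c f g zero    = ℤ.*-assoc c (f 0) (g 0)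
  conv-scaleˡ c f g (suc n) = trans
    (cong (_+_ (c * f 0 * g (suc n))) (conv-scaleˡ c (f ∘ suc) g n))
    (lemma c (f 0) (g (suc n)) _)
    where
    lemma : ∀ c a b x → c * a * b + c * x ≡ c * (a * b + x)
    lemma = solve-∀

  -- `conv` consumes its left argument from the front, so commutativity by induction also needs the
  -- recursion that splits off the last term.
  conv-sucʳ : ∀ f g n → conv f g (suc n) ≡ conv f (g ∘ suc) n + f (suc n) * g 0
  conv-sucʳ f g zero    = refl
  conv-sucʳ f g (suc n) = trans
    (cong (_+_ (f 0 * g (suc (suc n)))) (conv-sucʳ (f ∘ suc) g n))
    (sym (ℤ.+-assoc (f 0 * g (suc (suc n))) _ _))

  conv-comm : ∀ f g n → conv f g n ≡ conv g f n
  conv-comm f g zero    = ℤ.*-comm (f 0) (g 0)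
  conv-comm f g (suc n) = trans
    (cong₂ _+_ (ℤ.*-comm (f 0) (g (suc n))) (conv-comm (f ∘ suc) g n))
    (trans (ℤ.+-comm (g (suc n) * f 0) _) (sym (conv-sucʳ g f n)))

  conv-assoc : ∀ f g h n → conv (conv f g) h n ≡ conv f (conv g h) n
  conv-assoc f g h zero    = ℤ.*-assoc (f 0) (g 0) (h 0)
  conv-assoc f g h (suc n) = trans
    (cong (_+_ (f 0 * g 0 * h (suc n)))
      (trans (conv-distribʳ (λ i → f 0 * g (suc i)) (conv (f ∘ suc) g) h n)
             (cong₂ _+_ (conv-scaleˡ (f 0) (g ∘ suc) h n) (conv-assoc (f ∘ suc) g h n))))
    (lemma (f 0) (g 0) (h (suc n)) _ _)
    where
    lemma : ∀ a b c x y → a * b * c + (a * x + y) ≡ a * (b * c + x) + y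
    lemma = solve-∀

  constant : ℤ → Series
  constant c zero    = c
  constant c (suc _) = 0ℤ

  conv-constantˡ : ∀ c g n → conv (constant c) g n ≡ c * g n
  conv-constantˡ c g zero    = refl
  conv-constantˡ c g (suc n) = trans (cong (_+_ (c * g (suc n))) (conv-zeroˡ g n)) (ℤ.+-identityʳ _)

  one≗constant : ∀ n → one n ≡ constant 1ℤ n
  one≗constant zero    = refl
  one≗constant (suc _) = refl

  conv-identityˡ : ∀ g n → conv one g n ≡ g n
  conv-identityˡ g n = trans
    (conv-cong n (λ i _ → one≗constant i) (λ _ _ → refl))
    (trans (conv-constantˡ 1ℤ g n) (ℤ.*-identityˡ (g n)))

  mono : ℕ → Series
  mono zero    i       = one i
  mono (suc m) zero    = 0ℤ
  mono (suc m) (suc i) = mono m i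

  conv-mono-suc : ∀ m g i → conv (mono (suc m)) g (suc i) ≡ conv (mono m) g i
  conv-mono-suc m g i = ℤ.+-identityˡ _

  conv-mono : ∀ m n i → conv (mono m) (mono n) i ≡ mono (m ℕ.+ n) i
  conv-mono zero    n i       = conv-identityˡ (mono n) i
  conv-mono (suc m) n zero    = refl
  conv-mono (suc m) n (suc i) = trans (conv-mono-suc m (mono n) i) (conv-mono m n i)

  mono-< : ∀ m i → i < m → mono m i ≡ 0ℤ
  mono-< (suc m) zero    _         = refl
  mono-< (suc m) (suc i) (s≤s i<m) = mono-< m i i<m

  -- ℤ[[q]] / (q^{N+1})
  truncated : ℕ → CommutativeRing 0ℓ 0ℓ
  truncated N = record
    { Carrier = Series
    ; _≈_ = λ f g → ∀ i → i ≤ N → f i ≡ g i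
    ; _+_ = λ f g i → f i + g i
    ; _*_ = conv
    ; -_ = λ f i → - f i
    ; 0# = λ _ → 0ℤ
    ; 1# = one
    ; isCommutativeRing = record
      { isRing = record
        { +-isAbelianGroup = record
          { isGroup = record
            { isMonoid = record
              { isSemigroup = record
                { isMagma = record
                  { isEquivalence = record
                    { refl = λ _ _ → refl
                    ; sym = λ p i i≤N → sym (p i i≤N)
                    ; trans = λ p q i i≤N → trans (p i i≤N) (q i i≤N)
                    }
                  ; ∙-cong = λ p q i i≤N → cong₂ _+_ (p i i≤N) (q i i≤N)
                  }
                ; assoc = λ f g h i _ → ℤ.+-assoc (f i) (g i) (h i)
                }
              ; identity = (λ f i _ → ℤ.+-identityˡ (f i)) , (λ f i _ → ℤ.+-identityʳ (f i))
              }
            ; inverse = (λ f i _ → ℤ.+-inverseˡ (f i)) , (λ f i _ → ℤ.+-inverseʳ (f i))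
            ; ⁻¹-cong = λ p i i≤N → cong -_ (p i i≤N)
            }
          ; comm = λ f g i _ → ℤ.+-comm (f i) (g i)
          }
        ; *-cong = λ p q i i≤N → conv-cong i
            (λ j j≤i → p j (ℕ.≤-trans j≤i i≤N)) (λ j j≤i → q j (ℕ.≤-trans j≤i i≤N))
        ; *-assoc = λ f g h i _ → conv-assoc f g h i
        ; *-identity = (λ f i _ → conv-identityˡ f i)
                     , (λ f i _ → trans (conv-comm f one i) (conv-identityˡ f i))
        ; distrib = (λ f g h i _ → trans (conv-comm f _ i)
                        (trans (conv-distribʳ g h f i) (cong₂ _+_ (conv-comm g f i) (conv-comm h f i))))
                  , (λ f g h i _ → conv-distribʳ g h f i)
        }
      ; *-comm = λ f g i _ → conv-comm f g i
      }
    }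

  -- Lets the ring solver treat integer coefficients as constant series.
  constants : ∀ N → CommutativeRing.rawRing ℤ.+-*-commutativeRing
                      -Raw-AlmostCommutative⟶ fromCommutativeRing (truncated N)
  constants N = record
    { ⟦_⟧ = constant
    ; +-homo = λ { a b zero _ → refl ; a b (suc _) _ → refl }
    ; *-homo = λ { a b zero _ → refl
                 ; a b (suc i) _ → sym (trans (conv-constantˡ a (constant b) (suc i)) (ℤ.*-zeroʳ a)) }
    ; -‿homo = λ { a zero _ → refl ; a (suc _) _ → refl }
    ; 0-homo = λ { zero _ → refl ; (suc _) _ → refl }
    ; 1-homo = λ i _ → sym (one≗constant i)
    }

-- Integer arithmetic of the exponents

module Arith where
  open Data.Nat using (_≤_; _<_)
  open Data.Integer using (_+_; _*_; _-_; -_)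

  -- Serves the injectivity of affine lattice maps: `p ≡ q` compares linear combinations of
  -- coordinates, and the last hypothesis is a polynomial identity left to the solver.
  linear-cancel : ∀ k .{{_ : NonZero k}} {p q} x y → p ≡ q → p - q ≡ k * (x - y) → x ≡ y
  linear-cancel k {p} x y ≡.refl e = ℤ.i-j≡0⇒i≡j x y (ℤ.*-cancelˡ-≡ k (x - y) 0ℤ
    (≡.trans (≡.sym e) (≡.trans (ℤ.+-inverseʳ p) (≡.sym (ℤ.*-zeroʳ k)))))

  -- Serves the disjointness of cosets: a common point would make k divide 1.
  linear-absurd : ∀ k {p q} z → ∣ k ∣ ≢ 1 → p ≡ q → p - q ≡ k * z + 1ℤ → ⊥
  linear-absurd k {p} z ∣k∣≢1 ≡.refl e = ∣k∣≢1 (ℕ.m*n≡1⇒m≡1 ∣ k ∣ ∣ - z ∣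
    (≡.trans (≡.sym (ℤ.abs-* k (- z))) (≡.cong ∣_∣ kz)))
    where
    lemma : ∀ k z → k * - z ≡ 1ℤ - (k * z + 1ℤ)
    lemma = solve-∀
    kz : k * - z ≡ 1ℤ
    kz = ≡.trans (lemma k z) (≡.cong (λ x → 1ℤ - x) (≡.trans (≡.sym e) (ℤ.+-inverseʳ p)))

  halve : ∀ {x y} → x + x ≡ y + y → x ≡ y
  halve {x} {y} e = linear-cancel (+ 2) x y e (lemma x y)
    where
    lemma : ∀ x y → x + x - (y + y) ≡ + 2 * (x - y)
    lemma = solve-∀

  parity : ∀ z → ∃[ n ] (z ≡ n + n ⊎ z ≡ n + n + 1ℤ)
  parity z with z ℤ.%ℕ 2 | ℤ.n%ℕd<d z 2 | ℤ.a≡a%ℕn+[a/ℕn]*n z 2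
  ... | 0 | _ | e = n , inj₁ (≡.trans e (lemma n))
    where
    n = z ℤ./ℕ 2
    lemma : ∀ n → + 0 + n * + 2 ≡ n + n
    lemma = solve-∀
  ... | 1 | _ | e = n , inj₂ (≡.trans e (lemma n))
    where
    n = z ℤ./ℕ 2
    lemma : ∀ n → + 1 + n * + 2 ≡ n + n + 1ℤ
    lemma = solve-∀
  ... | suc (suc _) | s≤s (s≤s ()) | _

  residue₃ : ∀ z → ∃[ n ] (z ≡ + 3 * n ⊎ z ≡ + 3 * n + 1ℤ ⊎ z ≡ + 3 * n - 1ℤ)
  residue₃ z with z ℤ.%ℕ 3 | ℤ.n%ℕd<d z 3 | ℤ.a≡a%ℕn+[a/ℕn]*n z 3
  ... | 0 | _ | e = n , inj₁ (≡.trans e (lemma n))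
    where
    n = z ℤ./ℕ 3
    lemma : ∀ n → + 0 + n * + 3 ≡ + 3 * n
    lemma = solve-∀
  ... | 1 | _ | e = n , inj₂ (inj₁ (≡.trans e (lemma n)))
    where
    n = z ℤ./ℕ 3
    lemma : ∀ n → + 1 + n * + 3 ≡ + 3 * n + 1ℤ
    lemma = solve-∀
  ... | 2 | _ | e = n + 1ℤ , inj₂ (inj₂ (≡.trans e (lemma n)))
    where
    n = z ℤ./ℕ 3
    lemma : ∀ n → + 2 + n * + 3 ≡ + 3 * (n + 1ℤ) - 1ℤ
    lemma = solve-∀
  ... | suc (suc (suc _)) | s≤s (s≤s (s≤s ())) | _

  sq : ℤ → ℕ
  sq k = ∣ k ∣ ℕ.* ∣ k ∣

  triangular : ℕ → ℕ
  triangular zero    = 0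
  triangular (suc n) = suc n ℕ.+ triangular n

  -- k (k + 1) / 2
  tri : ℤ → ℕ
  tri (+ n)    = triangular n
  tri -[1+ n ] = triangular n

  -- k (3 k − 1) / 2
  pent : ℤ → ℕ
  pent k = tri (- k) ℕ.+ sq k

  pos-sq : ∀ k → + sq k ≡ k * k
  pos-sq (+ n)    = ℤ.pos-* n n
  pos-sq -[1+ n ] = ≡.refl

  -- Doubled so as to stay polynomial over ℤ; later identities between triangular numbers are
  -- checked in doubled form and divided by `halve`.
  pos-tri : ∀ k → + tri k + + tri k ≡ k * (k + 1ℤ)
  pos-tri = λ { (+ n) → nonneg n ; -[1+ n ] → ≡.trans (nonneg n) (lemma (+ n)) }
    where
    lemma : ∀ n → n * (n + 1ℤ) ≡ - (1ℤ + n) * (- (1ℤ + n) + 1ℤ)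
    lemma = solve-∀
    step : ∀ n t → 1ℤ + n + t + (1ℤ + n + t) ≡ + 2 * (1ℤ + n) + (t + t)
    step = solve-∀
    step′ : ∀ n → + 2 * (1ℤ + n) + n * (n + 1ℤ) ≡ (1ℤ + n) * (1ℤ + n + 1ℤ)
    step′ = solve-∀
    nonneg : ∀ n → + triangular n + + triangular n ≡ + n * (+ n + 1ℤ)
    nonneg zero    = ≡.refl
    nonneg (suc n) = ≡.trans (step (+ n) (+ triangular n))
      (≡.trans (≡.cong (λ x → + 2 * (1ℤ + + n) + x) (nonneg n)) (step′ (+ n)))

  pos-pent : ∀ k → + pent k + + pent k ≡ k * (+ 3 * k - 1ℤ)
  pos-pent k = ≡.trans (step (+ tri (- k)) (+ sq k))
    (≡.trans (≡.cong₂ (λ t s → t + (s + s)) (pos-tri (- k)) (pos-sq k)) (lemma k))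
    where
    step : ∀ t s → t + s + (t + s) ≡ t + t + (s + s)
    step = solve-∀
    lemma : ∀ k → - k * (- k + 1ℤ) + (k * k + k * k) ≡ k * (+ 3 * k - 1ℤ)
    lemma = solve-∀

  n≤1+n² : ∀ n → n ≤ suc (n ℕ.* n)
  n≤1+n² zero    = z≤n
  n≤1+n² (suc n) = ℕ.m≤n⇒m≤1+n (ℕ.m≤m*n (suc n) (suc n))

  n≤triangular : ∀ n → n ≤ triangular n
  n≤triangular zero    = z≤n
  n≤triangular (suc n) = ℕ.m≤m+n (suc n) _

  sq-coercive : ∀ k → ∣ k ∣ ≤ suc (sq k)
  sq-coercive k = n≤1+n² ∣ k ∣

  -- The slack of one is forced by k = -1, where `tri` is 0. The other exponents are bounded in the
  -- same shape, so that one box serves all theta series.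
  tri-coercive : ∀ k → ∣ k ∣ ≤ suc (tri k)
  tri-coercive (+ n)    = ℕ.m≤n⇒m≤1+n (n≤triangular n)
  tri-coercive -[1+ n ] = s≤s (n≤triangular n)

  pent-coercive : ∀ k → ∣ k ∣ ≤ suc (pent k)
  pent-coercive k = ℕ.≤-trans (sq-coercive k) (s≤s (ℕ.m≤n+m (sq k) (tri (- k))))

  scale-coercive : ∀ s {E : ℤ → ℕ} → 0 < s → (∀ k → ∣ k ∣ ≤ suc (E k)) → ∀ k → ∣ k ∣ ≤ suc (s ℕ.* E k)
  scale-coercive s {E} 0<s c k = ℕ.≤-trans (c k) (s≤s (ℕ.m≤n*m (E k) s {{ℕ.>-nonZero 0<s}}))

  sq-suc : ∀ k → + sq (k + 1ℤ) ≡ + sq k + (+ 2 * k + 1ℤ)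
  sq-suc k = ≡.trans (pos-sq (k + 1ℤ)) (≡.trans (lemma k) (≡.cong (_+ (+ 2 * k + 1ℤ)) (≡.sym (pos-sq k))))
    where
    lemma : ∀ k → (k + 1ℤ) * (k + 1ℤ) ≡ k * k + (+ 2 * k + 1ℤ)
    lemma = solve-∀

  tri-suc : ∀ k → + tri (k + 1ℤ) ≡ + tri k + (k + 1ℤ)
  tri-suc k = halve (≡.trans (pos-tri (k + 1ℤ)) (≡.trans (lemma k)
    (≡.trans (≡.cong (_+ (k + 1ℤ + (k + 1ℤ))) (≡.sym (pos-tri k))) (step (+ tri k) k))))
    where
    lemma : ∀ k → (k + 1ℤ) * (k + 1ℤ + 1ℤ) ≡ k * (k + 1ℤ) + (k + 1ℤ + (k + 1ℤ))
    lemma = solve-∀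
    step : ∀ t k → t + t + (k + 1ℤ + (k + 1ℤ)) ≡ t + (k + 1ℤ) + (t + (k + 1ℤ))
    step = solve-∀

  pent-suc : ∀ k → + pent (k + 1ℤ) ≡ + pent k + (+ 3 * k + 1ℤ)
  pent-suc k = halve (≡.trans (pos-pent (k + 1ℤ)) (≡.trans (lemma k)
    (≡.trans (≡.cong (_+ (+ 3 * k + 1ℤ + (+ 3 * k + 1ℤ))) (≡.sym (pos-pent k))) (step (+ pent k) k))))
    where
    lemma : ∀ k → (k + 1ℤ) * (+ 3 * (k + 1ℤ) - 1ℤ) ≡ k * (+ 3 * k - 1ℤ) + (+ 3 * k + 1ℤ + (+ 3 * k + 1ℤ))
    lemma = solve-∀
    step : ∀ t k → t + t + (+ 3 * k + 1ℤ + (+ 3 * k + 1ℤ)) ≡ t + (+ 3 * k + 1ℤ) + (t + (+ 3 * k + 1ℤ))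
    step = solve-∀

  -- An affine increment is all that the triple product needs to know of an exponent. Scaling by s
  -- turns its slope into s a, the step of the product, and its value at k = 0 into s, the residue
  -- of one of the factors.
  scale-suc : ∀ s a (E : ℤ → ℕ) → (∀ k → + E (k + 1ℤ) ≡ + E k + (+ a * k + 1ℤ)) →
              ∀ k → + (s ℕ.* E (k + 1ℤ)) ≡ + (s ℕ.* E k) + (+ (s ℕ.* a) * k + + s)
  scale-suc s a E E-suc k = begin
    + (s ℕ.* E (k + 1ℤ))                    ≡⟨ ℤ.pos-* s _ ⟩
    + s * + E (k + 1ℤ)                      ≡⟨ ≡.cong (λ x → + s * x) (E-suc k) ⟩
    + s * (+ E k + (+ a * k + 1ℤ))          ≡⟨ lemma (+ s) (+ E k) (+ a) k ⟩
    + s * + E k + (+ s * + a * k + + s)     ≡⟨ ≡.cong₂ (λ x y → x + (y * k + + s)) (ℤ.pos-* s _) (ℤ.pos-* s a) ⟨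
    + (s ℕ.* E k) + (+ (s ℕ.* a) * k + + s) ∎
    where
    open ≡.≡-Reasoning
    lemma : ∀ s e a k → s * (e + (a * k + 1ℤ)) ≡ s * e + (s * a * k + s)
    lemma = solve-∀

  sq-diagonals : ∀ a b → sq (a + b) ℕ.+ sq (a - b) ≡ 2 ℕ.* sq a ℕ.+ 2 ℕ.* sq b
  sq-diagonals a b = ℤ.+-injective (begin
    + sq (a + b) + + sq (a - b)            ≡⟨ ≡.cong₂ _+_ (pos-sq (a + b)) (pos-sq (a - b)) ⟩
    (a + b) * (a + b) + (a - b) * (a - b)  ≡⟨ ring-ℤ (a ∷ b ∷ []) ⟩
    + 2 * (a * a) + + 2 * (b * b)          ≡⟨ ≡.cong₂ (λ x y → + 2 * x + + 2 * y) (pos-sq a) (pos-sq b) ⟨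
    + 2 * + sq a + + 2 * + sq b            ≡⟨ ≡.cong₂ _+_ (ℤ.pos-* 2 (sq a)) (ℤ.pos-* 2 (sq b)) ⟨
    + (2 ℕ.* sq a ℕ.+ 2 ℕ.* sq b)          ∎)
    where open ≡.≡-Reasoning

  sq-diagonals-odd : ∀ m n → sq (m + n + 1ℤ) ℕ.+ sq (m - n) ≡ 1 ℕ.+ (4 ℕ.* tri m ℕ.+ 4 ℕ.* tri n)
  sq-diagonals-odd m n = ℤ.+-injective (begin
    + sq (m + n + 1ℤ) + + sq (m - n)
      ≡⟨ ≡.cong₂ _+_ (pos-sq (m + n + 1ℤ)) (pos-sq (m - n)) ⟩
    (m + n + 1ℤ) * (m + n + 1ℤ) + (m - n) * (m - n)              ≡⟨ ring-ℤ (m ∷ n ∷ []) ⟩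
    1ℤ + (+ 2 * (m * (m + 1ℤ)) + + 2 * (n * (n + 1ℤ)))
      ≡⟨ ≡.cong₂ (λ x y → 1ℤ + (+ 2 * x + + 2 * y)) (pos-tri m) (pos-tri n) ⟨
    1ℤ + (+ 2 * (+ tri m + + tri m) + + 2 * (+ tri n + + tri n)) ≡⟨ lemma (+ tri m) (+ tri n) ⟩
    1ℤ + (+ 4 * + tri m + + 4 * + tri n)
      ≡⟨ ≡.cong₂ (λ x y → 1ℤ + (x + y)) (ℤ.pos-* 4 (tri m)) (ℤ.pos-* 4 (tri n)) ⟨
    + (1 ℕ.+ (4 ℕ.* tri m ℕ.+ 4 ℕ.* tri n))                      ∎)
    where
    open ≡.≡-Reasoning
    lemma : ∀ x y → 1ℤ + (+ 2 * (x + x) + + 2 * (y + y)) ≡ 1ℤ + (+ 4 * x + + 4 * y)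
    lemma = solve-∀

  tri-diagonals : ∀ x y u v → x * (x + 1ℤ) + y * (y + 1ℤ) ≡ + 2 * (u * u) + + 2 * (v * (v + 1ℤ)) →
                  tri x ℕ.+ tri y ≡ sq u ℕ.+ 2 ℕ.* tri v
  tri-diagonals x y u v e = ℤ.+-injective (halve (begin
    + tri x + + tri y + (+ tri x + + tri y)         ≡⟨ lemma (+ tri x) (+ tri y) ⟩
    + tri x + + tri x + (+ tri y + + tri y)         ≡⟨ ≡.cong₂ _+_ (pos-tri x) (pos-tri y) ⟩
    x * (x + 1ℤ) + y * (y + 1ℤ)                     ≡⟨ e ⟩
    + 2 * (u * u) + + 2 * (v * (v + 1ℤ))            ≡⟨ ≡.cong₂ (λ a b → + 2 * a + + 2 * b) (pos-sq u) (pos-tri v) ⟨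
    + 2 * + sq u + + 2 * (+ tri v + + tri v)        ≡⟨ lemma′ (+ sq u) (+ tri v) ⟩
    + sq u + + 2 * + tri v + (+ sq u + + 2 * + tri v)
      ≡⟨ ≡.cong (λ a → + sq u + a + (+ sq u + a)) (ℤ.pos-* 2 (tri v)) ⟨
    + (sq u ℕ.+ 2 ℕ.* tri v) + + (sq u ℕ.+ 2 ℕ.* tri v) ∎))
    where
    open ≡.≡-Reasoning
    lemma : ∀ x y → x + y + (x + y) ≡ x + x + (y + y)
    lemma = solve-∀
    lemma′ : ∀ a b → + 2 * a + + 2 * (b + b) ≡ a + + 2 * b + (a + + 2 * b)
    lemma′ = solve-∀

  -- With u = 2 c + 1 − v this is (u² + 5 v² − 1) / 4.
  form : ℤ → ℤ → ℤ
  form c v = c * c + c - c * v + v * v + + tri (- v)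

  form-double : ∀ c v → form c v + form c v ≡ + 2 * (c * c + c - c * v + v * v) + - v * (- v + 1ℤ)
  form-double c v = ≡.trans (lemma (c * c + c - c * v + v * v) (+ tri (- v)))
    (≡.cong (λ x → + 2 * (c * c + c - c * v + v * v) + x) (pos-tri (- v)))
    where
    lemma : ∀ x t → x + t + (x + t) ≡ + 2 * x + (t + t)
    lemma = solve-∀

  form-even : ∀ m n → form (m + n) (n + n) ≡ + (2 ℕ.* tri m ℕ.+ 5 ℕ.* sq n)
  form-even m n = halve (begin
    form (m + n) (n + n) + form (m + n) (n + n)               ≡⟨ form-double (m + n) (n + n) ⟩
    _                                                         ≡⟨ lemma m n ⟩
    + 2 * (m * (m + 1ℤ)) + + 10 * (n * n)
      ≡⟨ ≡.cong₂ (λ x y → + 2 * x + + 10 * y) (pos-tri m) (pos-sq n) ⟨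
    + 2 * (+ tri m + + tri m) + + 10 * + sq n                 ≡⟨ lemma′ (+ tri m) (+ sq n) ⟩
    + 2 * + tri m + + 5 * + sq n + (+ 2 * + tri m + + 5 * + sq n)
      ≡⟨ ≡.cong₂ (λ x y → x + y + (x + y)) (ℤ.pos-* 2 (tri m)) (ℤ.pos-* 5 (sq n)) ⟨
    + (2 ℕ.* tri m ℕ.+ 5 ℕ.* sq n) + + (2 ℕ.* tri m ℕ.+ 5 ℕ.* sq n) ∎)
    where
    open ≡.≡-Reasoning
    lemma : ∀ m n → + 2 * ((m + n) * (m + n) + (m + n) - (m + n) * (n + n) + (n + n) * (n + n))
                      + - (n + n) * (- (n + n) + 1ℤ)
                    ≡ + 2 * (m * (m + 1ℤ)) + + 10 * (n * n)
    lemma = solve-∀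
    lemma′ : ∀ x y → + 2 * (x + x) + + 10 * y ≡ + 2 * x + + 5 * y + (+ 2 * x + + 5 * y)
    lemma′ = solve-∀

  form-odd : ∀ u m → form (u + m) (m + m + 1ℤ) ≡ + (1 ℕ.+ (sq u ℕ.+ 10 ℕ.* tri m))
  form-odd u m = halve (begin
    form (u + m) (m + m + 1ℤ) + form (u + m) (m + m + 1ℤ)     ≡⟨ form-double (u + m) (m + m + 1ℤ) ⟩
    _                                                         ≡⟨ lemma u m ⟩
    + 2 + (+ 2 * (u * u) + + 10 * (m * (m + 1ℤ)))
      ≡⟨ ≡.cong₂ (λ x y → + 2 + (+ 2 * x + + 10 * y)) (pos-sq u) (pos-tri m) ⟨
    + 2 + (+ 2 * + sq u + + 10 * (+ tri m + + tri m))         ≡⟨ lemma′ (+ sq u) (+ tri m) ⟩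
    1ℤ + (+ sq u + + 10 * + tri m) + (1ℤ + (+ sq u + + 10 * + tri m))
      ≡⟨ ≡.cong (λ y → 1ℤ + (+ sq u + y) + (1ℤ + (+ sq u + y))) (ℤ.pos-* 10 (tri m)) ⟨
    + (1 ℕ.+ (sq u ℕ.+ 10 ℕ.* tri m)) + + (1 ℕ.+ (sq u ℕ.+ 10 ℕ.* tri m)) ∎)
    where
    open ≡.≡-Reasoning
    lemma : ∀ u m → + 2 * ((u + m) * (u + m) + (u + m) - (u + m) * (m + m + 1ℤ) + (m + m + 1ℤ) * (m + m + 1ℤ))
                      + - (m + m + 1ℤ) * (- (m + m + 1ℤ) + 1ℤ)
                    ≡ + 2 + (+ 2 * (u * u) + + 10 * (m * (m + 1ℤ)))
    lemma = solve-∀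
    lemma′ : ∀ x y → + 2 + (+ 2 * x + + 10 * (y + y)) ≡ 1ℤ + (x + + 10 * y) + (1ℤ + (x + + 10 * y))
    lemma′ = solve-∀

  form-pent : ∀ c v a b →
              + 2 * (c * c + c - c * v + v * v) + - v * (- v + 1ℤ) ≡ a * (+ 3 * a - 1ℤ) + + 5 * (b * (+ 3 * b - 1ℤ)) →
              form c v ≡ + (pent a ℕ.+ 5 ℕ.* pent b)
  form-pent c v a b e = halve (begin
    form c v + form c v                                      ≡⟨ form-double c v ⟩
    _                                                        ≡⟨ e ⟩
    a * (+ 3 * a - 1ℤ) + + 5 * (b * (+ 3 * b - 1ℤ))
      ≡⟨ ≡.cong₂ (λ x y → x + + 5 * y) (pos-pent a) (pos-pent b) ⟨
    + pent a + + pent a + + 5 * (+ pent b + + pent b)        ≡⟨ lemma (+ pent a) (+ pent b) ⟩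
    + pent a + + 5 * + pent b + (+ pent a + + 5 * + pent b)
      ≡⟨ ≡.cong (λ y → + pent a + y + (+ pent a + y)) (ℤ.pos-* 5 (pent b)) ⟨
    + (pent a ℕ.+ 5 ℕ.* pent b) + + (pent a ℕ.+ 5 ℕ.* pent b) ∎)
    where
    open ≡.≡-Reasoning
    lemma : ∀ x y → x + x + + 5 * (y + y) ≡ x + + 5 * y + (x + + 5 * y)
    lemma = solve-∀

  -- With x = 6 a - 1 and y = 6 b - 1, the arguments encode (u, v) = (a + 5 b - 1, b - a), the
  -- quotient of x + y √-5 by 1 + √-5. Its norm is (x² + 5 y²) / 6, so (u² + 5 v² - 1) / 4 equals
  -- (x² - 1) / 24 + 5 (y² - 1) / 24, and (x² - 1) / 24 is `pent a`.
  form-pent₁ : ∀ a b → form (+ 3 * b - 1ℤ) (b - a) ≡ + (pent a ℕ.+ 5 ℕ.* pent b)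
  form-pent₁ a b = form-pent (+ 3 * b - 1ℤ) (b - a) a b (lemma a b)
    where
    lemma : ∀ a b → + 2 * ((+ 3 * b - 1ℤ) * (+ 3 * b - 1ℤ) + (+ 3 * b - 1ℤ) - (+ 3 * b - 1ℤ) * (b - a) + (b - a) * (b - a))
                      + - (b - a) * (- (b - a) + 1ℤ) ≡ a * (+ 3 * a - 1ℤ) + + 5 * (b * (+ 3 * b - 1ℤ))
    lemma = solve-∀

  -- The same value, taken at (-u, -v). Negation replaces c by -c - 1, hence the residue 2 modulo 3
  -- by the residue 0.
  form-pent₂ : ∀ a b → form (+ 3 * - b) (a - b) ≡ + (pent a ℕ.+ 5 ℕ.* pent b)
  form-pent₂ a b = form-pent (+ 3 * - b) (a - b) a b (lemma a b)
    where
    lemma : ∀ a b → + 2 * ((+ 3 * - b) * (+ 3 * - b) + (+ 3 * - b) - (+ 3 * - b) * (a - b) + (a - b) * (a - b))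
                      + - (a - b) * (- (a - b) + 1ℤ) ≡ a * (+ 3 * a - 1ℤ) + + 5 * (b * (+ 3 * b - 1ℤ))
    lemma = solve-∀

  -- For fixed c, `form` is quadratic in v with axis v = (2 c + 1) / 6, so it is invariant under v ↦
  -- (2 c + 1) / 3 - v. This map preserves ℤ exactly when c = 3 d + 1, and the sum of v and its
  -- image is then the odd number 2 d + 1.
  form-reflect : ∀ d v → form (+ 3 * d + 1ℤ) (d + d + 1ℤ - v) ≡ form (+ 3 * d + 1ℤ) v
  form-reflect d v = halve (≡.trans (form-double (+ 3 * d + 1ℤ) (d + d + 1ℤ - v))
    (≡.trans (lemma d v) (≡.sym (form-double (+ 3 * d + 1ℤ) v))))
    where
    lemma : ∀ d v → + 2 * ((+ 3 * d + 1ℤ) * (+ 3 * d + 1ℤ) + (+ 3 * d + 1ℤ) - (+ 3 * d + 1ℤ) * (d + d + 1ℤ - v)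
                        + (d + d + 1ℤ - v) * (d + d + 1ℤ - v)) + - (d + d + 1ℤ - v) * (- (d + d + 1ℤ - v) + 1ℤ)
                    ≡ + 2 * ((+ 3 * d + 1ℤ) * (+ 3 * d + 1ℤ) + (+ 3 * d + 1ℤ) - (+ 3 * d + 1ℤ) * v + v * v) + - v * (- v + 1ℤ)
    lemma = solve-∀

-- Abstract truncated series rings and integer boxes

open Arith

-- The properties of ℤ[[q]] / (q^(N + 1)) on which all identities up to the dissection of F_1 rest,
-- with `X n` for q^n. The last field excludes 2-torsion, which makes a sum that equals its own
-- negative vanish.
record TruncatedSeriesRing : Set₁ where
  open Data.Nat using (_<_)
  field
    order           : ℕ
    commutativeRing : CommutativeRing 0ℓ 0ℓ
  open CommutativeRing commutativeRing public hiding (zero)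
  field
    scalars : CommutativeRing.rawRing ℤ.+-*-commutativeRing
                -Raw-AlmostCommutative⟶ fromCommutativeRing commutativeRing
    X         : ℕ → Carrier
    X-0       : X 0 ≈ 1#
    X-+       : ∀ m n → X (m ℕ.+ n) ≈ X m * X n
    X->       : ∀ n → order < n → X n ≈ 0#
    x+x≈0⇒x≈0 : ∀ x → x + x ≈ 0# → x ≈ 0#

module Boxes where
  open Data.Nat using (_≤_; _<_)

  box : ℕ → List ℤ
  box zero    = 0ℤ ∷ []
  box (suc n) = + suc n ∷ -[1+ n ] ∷ box n

  ∈-box⁺ : ∀ n x → ∣ x ∣ ≤ n → x ∈ box n
  ∈-box⁺ zero    (+ zero) _ = here ≡.refl
  ∈-box⁺ (suc n) x ∣x∣≤1+n with ℕ.m≤n⇒m<n∨m≡n ∣x∣≤1+n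
  ∈-box⁺ (suc n) x         _ | inj₁ ∣x∣<1+n = there (there (∈-box⁺ n x (ℕ.≤-pred ∣x∣<1+n)))
  ∈-box⁺ (suc n) (+ _)     _ | inj₂ ≡.refl  = here ≡.refl
  ∈-box⁺ (suc n) -[1+ _ ]  _ | inj₂ ≡.refl  = there (here ≡.refl)

  ∈-box⁻ : ∀ n {x} → x ∈ box n → ∣ x ∣ ≤ n
  ∈-box⁻ zero    (here ≡.refl)         = z≤n
  ∈-box⁻ (suc n) (here ≡.refl)         = ℕ.≤-refl
  ∈-box⁻ (suc n) (there (here ≡.refl)) = ℕ.≤-refl
  ∈-box⁻ (suc n) (there (there x∈))    = ℕ.m≤n⇒m≤1+n (∈-box⁻ n x∈)

  box-unique : ∀ n → Unique (box n)
  box-unique zero    = All.[] ∷ []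
  box-unique (suc n) =
    ((λ ()) All.∷ All.tabulate λ { x∈ ≡.refl → ℕ.<-irrefl ≡.refl (∈-box⁻ n x∈) })
    ∷ All.tabulate (λ { x∈ ≡.refl → ℕ.<-irrefl ≡.refl (∈-box⁻ n x∈) })
    ∷ box-unique n

open Boxes

-- Finite sums and their reindexing along lattice cosets

module Sums (S : TruncatedSeriesRing) where
  open Data.Nat using (_≤_; _<_)
  open TruncatedSeriesRing S
  open import Relation.Binary.Reasoning.Setoid setoid

  scalar-≟ : ∀ a b → Maybe (_-Raw-AlmostCommutative⟶_.⟦_⟧ scalars a ≈ _-Raw-AlmostCommutative⟶_.⟦_⟧ scalars b)
  scalar-≟ a b with a ℤ.≟ b
  ... | yes ≡.refl = just refl
  ... | no  _      = nothing

  open Algebra.Solver.Ring (CommutativeRing.rawRing ℤ.+-*-commutativeRing)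
    (fromCommutativeRing commutativeRing) scalars scalar-≟ public
    using (solve; _:=_; _:+_; _:*_; :-_; _:-_; con)

  open import Algebra.Properties.CommutativeSemigroup *-commutativeSemigroup public
    using () renaming (interchange to *-interchange)
  open import Algebra.Properties.CommutativeSemigroup +-commutativeSemigroup public
    using () renaming (interchange to +-interchange)

  sum : {A : Set} → List A → (A → Carrier) → Carrier
  sum []       t = 0#
  sum (x ∷ xs) t = t x + sum xs t

  sum-cong : {A : Set} (xs : List A) {t u : A → Carrier} →
             (∀ x → x ∈ xs → t x ≈ u x) → sum xs t ≈ sum xs u
  sum-cong []       p = refl
  sum-cong (x ∷ xs) p = +-cong (p x (here ≡.refl)) (sum-cong xs (λ y y∈ → p y (there y∈)))

  sum-zero : {A : Set} (xs : List A) {t : A → Carrier} → (∀ x → x ∈ xs → t x ≈ 0#) → sum xs t ≈ 0#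
  sum-zero []       p = refl
  sum-zero (x ∷ xs) p = trans (+-cong (p x (here ≡.refl)) (sum-zero xs (λ y y∈ → p y (there y∈))))
                              (+-identityˡ 0#)

  sum-+ : {A : Set} (xs : List A) (t u : A → Carrier) →
          sum xs (λ x → t x + u x) ≈ sum xs t + sum xs u
  sum-+ []       t u = sym (+-identityˡ 0#)
  sum-+ (x ∷ xs) t u = trans (+-congˡ (sum-+ xs t u))
    (+-interchange _ _ _ _)

  sum-*ˡ : {A : Set} (xs : List A) (c : Carrier) (t : A → Carrier) →
           sum xs (λ x → c * t x) ≈ c * sum xs t
  sum-*ˡ []       c t = sym (zeroʳ c)
  sum-*ˡ (x ∷ xs) c t = trans (+-congˡ (sum-*ˡ xs c t)) (sym (distribˡ c _ _))

  sum-comm : {A B : Set} (xs : List A) (ys : List B) (t : A → B → Carrier) →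
             sum xs (λ x → sum ys (t x)) ≈ sum ys (λ y → sum xs (λ x → t x y))
  sum-comm []       ys t = sym (sum-zero ys (λ _ _ → refl))
  sum-comm (x ∷ xs) ys t = trans (+-congˡ (sum-comm xs ys t)) (sym (sum-+ ys (t x) _))

  sum-++ : {A : Set} (xs ys : List A) (t : A → Carrier) → sum (xs ++ ys) t ≈ sum xs t + sum ys t
  sum-++ []       ys t = sym (+-identityˡ _)
  sum-++ (x ∷ xs) ys t = trans (+-congˡ (sum-++ xs ys t)) (sym (+-assoc (t x) _ _))

  sum-map : {A B : Set} (g : A → B) (xs : List A) (t : B → Carrier) → sum (map g xs) t ≈ sum xs (t ∘ g)
  sum-map g []       t = refl
  sum-map g (x ∷ xs) t = +-congˡ (sum-map g xs t)

  sum-× : {A B : Set} (xs : List A) (ys : List B) (t : A × B → Carrier) →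
          sum (cartesianProduct xs ys) t ≈ sum xs (λ x → sum ys (λ y → t (x , y)))
  sum-× []       ys t = refl
  sum-× (x ∷ xs) ys t = trans (sum-++ (map (x ,_) ys) (cartesianProduct xs ys) t)
    (+-cong (sum-map (x ,_) ys t) (sum-× xs ys t))

  sum-*-sum : {A B : Set} (xs : List A) (ys : List B) (t : A → Carrier) (u : B → Carrier) →
              sum xs t * sum ys u ≈ sum (cartesianProduct xs ys) (λ (x , y) → t x * u y)
  sum-*-sum xs ys t u = begin
    sum xs t * sum ys u                                   ≈⟨ *-comm _ _ ⟩
    sum ys u * sum xs t                                   ≈⟨ sum-*ˡ xs (sum ys u) t ⟨
    sum xs (λ x → sum ys u * t x)                         ≈⟨ sum-cong xs (λ x _ →
                                                               trans (*-comm _ _) (sym (sum-*ˡ ys (t x) u))) ⟩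
    sum xs (λ x → sum ys (λ y → t x * u y))               ≈⟨ sum-× xs ys (λ (x , y) → t x * u y) ⟨
    sum (cartesianProduct xs ys) (λ (x , y) → t x * u y)  ∎

  sum-single : {A : Set} {xs : List A} {t : A → Carrier} {a : A} → Unique xs → a ∈ xs →
               (∀ x → x ≢ a → t x ≈ 0#) → sum xs t ≈ t a
  sum-single {xs = x ∷ xs} {t} (x∉ ∷ _) (here ≡.refl) p =
    trans (+-congˡ (sum-zero xs (λ y y∈ → p y (λ { ≡.refl → All.lookup x∉ y∈ ≡.refl })))) (+-identityʳ (t x))
  sum-single {xs = x ∷ xs} (x∉ ∷ u) (there a∈) p =
    trans (+-cong (p x (λ { ≡.refl → All.lookup x∉ a∈ ≡.refl })) (sum-single u a∈ p)) (+-identityˡ _)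

  when : {P : Set} → Dec P → Carrier → Carrier
  when (yes _) r = r
  when (no  _) r = 0#

  when-yes : {P : Set} (d : Dec P) {r : Carrier} → P → when d r ≈ r
  when-yes (yes _) _ = refl
  when-yes (no ¬p) p = ⊥-elim (¬p p)

  when-no : {P : Set} (d : Dec P) {r : Carrier} → (P → r ≈ 0#) → when d r ≈ 0#
  when-no (yes p) f = f p
  when-no (no _)  _ = refl

  -- Both sides equal the double sum of [ G a = y ] t y over xs and ys.
  sum-reindex : {A B : Set} → DecidableEquality B → {xs : List A} {ys : List B} →
                Unique xs → Unique ys → (G : A → B) → Injective _≡_ _≡_ G → (t : B → Carrier) →
                (∀ a → t (G a) ≈ 0# ⊎ G a ∈ ys) →
                (∀ y → t y ≈ 0# ⊎ (∃[ a ] a ∈ xs × G a ≡ y)) →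
                sum xs (t ∘ G) ≈ sum ys t
  sum-reindex _≟_ {xs} {ys} xs! ys! G inj t into onto = begin
    sum xs (t ∘ G)                                        ≈⟨ sum-cong xs (λ a _ → left a (into a)) ⟩
    sum xs (λ a → sum ys (λ y → when (G a ≟ y) (t y)))    ≈⟨ sum-comm xs ys _ ⟩
    sum ys (λ y → sum xs (λ a → when (G a ≟ y) (t y)))    ≈⟨ sum-cong ys (λ y _ → right y (onto y)) ⟩
    sum ys t                                              ∎
    where
    left : ∀ a → t (G a) ≈ 0# ⊎ G a ∈ ys → t (G a) ≈ sum ys (λ y → when (G a ≟ y) (t y))
    left a (inj₁ z) = trans z (sym (sum-zero ys (λ y _ → when-no (G a ≟ y) (λ { ≡.refl → z }))))
    left a (inj₂ m) = sym (trans
      (sum-single ys! m (λ y y≢ → when-no (G a ≟ y) (λ e → ⊥-elim (y≢ (≡.sym e)))))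
      (when-yes (G a ≟ G a) ≡.refl))
    right : ∀ y → t y ≈ 0# ⊎ (∃[ a ] a ∈ xs × G a ≡ y) → sum xs (λ a → when (G a ≟ y) (t y)) ≈ t y
    right y (inj₁ z) = trans (sum-zero xs (λ a _ → when-no (G a ≟ y) (λ _ → z))) (sym z)
    right _ (inj₂ (a , m , ≡.refl)) = trans
      (sum-single xs! m (λ a′ a′≢a → when-no (G a′ ≟ G a) (λ e → ⊥-elim (a′≢a (inj e)))))
      (when-yes (G a ≟ G a) ≡.refl)

  -- The terms of order at most N of every theta series have index at most N + 1 in absolute value; the factor
  -- of two leaves room for the changes of lattice basis and for the Gaussian binomials to become stationary.
  D : ℕ
  D = suc order ℕ.+ (2 ℕ.+ order)

  plane : List (ℤ × ℤ)
  plane = cartesianProduct (box D) (box D)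

  plane-unique : Unique plane
  plane-unique = Unique.cartesianProduct⁺ (box-unique D) (box-unique D)

  ∈-plane : ∀ {x y} → ∣ x ∣ ≤ D → ∣ y ∣ ≤ D → (x , y) ∈ plane
  ∈-plane p q = ∈-cartesianProduct⁺ (∈-box⁺ D _ p) (∈-box⁺ D _ q)

  Supported : (ℤ × ℤ → Carrier) → Set
  Supported t = ∀ p → t p ≈ 0# ⊎ p ∈ plane

  -- The maps `G (i , _)` run through the cosets of a partition of ℤ². The support of t keeps images
  -- of points inside the plane, and the support of each pullback keeps preimages inside; together
  -- they make the finite sums behave like sums over all of ℤ².
  sum-partition : {I : Set} → (is : List I) → Unique is → (∀ i → i ∈ is) →
                  (G : I × ℤ × ℤ → ℤ × ℤ) → Injective _≡_ _≡_ G → (∀ y → ∃[ a ] G a ≡ y) →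
                  (t : ℤ × ℤ → Carrier) → Supported t → (∀ i → Supported (λ p → t (G (i , p)))) →
                  sum is (λ i → sum plane (λ p → t (G (i , p)))) ≈ sum plane t
  sum-partition is is! full G inj surj t supp suppG = trans (sym (sum-× is plane (t ∘ G)))
    (sum-reindex (≡-dec ℤ._≟_ ℤ._≟_) (Unique.cartesianProduct⁺ is! plane-unique) plane-unique
      G inj t (λ a → supp (G a)) onto)
    where
    onto : ∀ y → t y ≈ 0# ⊎ (∃[ a ] a ∈ cartesianProduct is plane × G a ≡ y)
    onto y with surj y
    ... | (i , p) , ≡.refl with suppG i p
    ...   | inj₁ z = inj₁ z
    ...   | inj₂ m = inj₂ ((i , p) , ∈-cartesianProduct⁺ (full i) m , ≡.refl)

-- The Jacobi triple product

module TripleProductExponents where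
  open Data.Nat using (_≤_; _<_)

  -- A term of the finite triple product that survives truncation has small j - n; this forces both
  -- indices of its Gaussian binomial to be large.
  near-middle : ∀ n {i j d} → i ℕ.+ j ≡ n ℕ.+ n → ∣ j ⊖ n ∣ ≤ d → n ≤ i ℕ.+ d × n ≤ j ℕ.+ d
  near-middle n {i} {j} {d} e p with ℕ.≤-total j n
  ... | inj₁ j≤n = ℕ.≤-trans (ℕ.+-cancelʳ-≤ n n i
                     (ℕ.≤-trans (ℕ.≤-reflexive (≡.sym e)) (ℕ.+-monoʳ-≤ i j≤n))) (ℕ.m≤m+n i d)
                 , ℕ.≤-trans (ℕ.m≤n+m∸n n j) (ℕ.+-monoʳ-≤ j (≡.subst (_≤ d) (ℤ.∣⊖∣-≤ j≤n) p))
  ... | inj₂ n≤j = ℕ.+-cancelʳ-≤ n n (i ℕ.+ d) (ℕ.≤-trans (ℕ.≤-reflexive (≡.sym e))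
                     (ℕ.≤-trans (ℕ.+-monoʳ-≤ i (ℕ.≤-trans (ℕ.m≤n+m∸n j n)
                       (ℕ.+-monoʳ-≤ n (≡.subst (_≤ d) (≡.trans (ℤ.∣m⊖n∣≡∣n⊖m∣ j n) (ℤ.∣⊖∣-≤ n≤j)) p))))
                       (ℕ.≤-reflexive (lemma i n d))))
                 , ℕ.≤-trans n≤j (ℕ.m≤m+n j d)
    where
    lemma : ∀ i n d → i ℕ.+ (n ℕ.+ d) ≡ i ℕ.+ d ℕ.+ n
    lemma = ℕ-Solver.solve-∀

  suc-⊖ : ∀ j m → suc j ⊖ m ≡ (j ⊖ m) ℤ.+ 1ℤ
  suc-⊖ j m = ≡.trans (≡.cong (_⊖ m) (ℕ.+-comm 1 j)) (≡.sym (ℤ.distribˡ-⊖-+-pos 1 j m))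

  antidiagonal-index : ∀ {i j n m} → i ℕ.+ j ≡ n ℕ.+ m → + i ℤ.+ (j ⊖ m) ≡ + n
  antidiagonal-index {i} {j} {n} {m} p = begin
    + i ℤ.+ (j ⊖ m)            ≡⟨ ≡.cong (ℤ._+_ (+ i)) (ℤ.m-n≡m⊖n j m) ⟨
    + i ℤ.+ (+ j ℤ.- + m)      ≡⟨ ℤ.+-assoc (+ i) (+ j) (ℤ.- + m) ⟨
    + (i ℕ.+ j) ℤ.- + m        ≡⟨ ≡.cong (λ z → + z ℤ.- + m) p ⟩
    + n ℤ.+ + m ℤ.- + m        ≡⟨ lemma (+ n) (+ m) ⟩
    + n                        ∎
    where
    open ≡.≡-Reasoning
    lemma : ∀ x y → x ℤ.+ y ℤ.- y ≡ x
    lemma = solve-∀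

  pos-affine : ∀ x y z → + (x ℕ.* y ℕ.+ z) ≡ + x ℤ.* + y ℤ.+ + z
  pos-affine x y z = ≡.cong (ℤ._+ + z) (ℤ.pos-* x y)

  -- The increment makes E k equal to a k (k - 1) / 2 + b k up to a constant. Under k ↦ -k the roles
  -- of b and c = a - b are exchanged.
  module Exponents (a b c : ℕ) (b+c≡a : b ℕ.+ c ≡ a) (E : ℤ → ℕ)
    (E-suc : ∀ k → + E (k ℤ.+ 1ℤ) ≡ + E k ℤ.+ (+ a ℤ.* k ℤ.+ + b)) where

    exponentⁿ : ∀ {i j n m} → i ℕ.+ j ≡ n ℕ.+ m → a ℕ.* i ℕ.+ E (suc j ⊖ m) ≡ (a ℕ.* n ℕ.+ b) ℕ.+ E (j ⊖ m)
    exponentⁿ {i} {j} {n} {m} p = ℤ.+-injective (begin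
      + (a ℕ.* i ℕ.+ E (suc j ⊖ m))                              ≡⟨ pos-affine a i _ ⟩
      + a ℤ.* + i ℤ.+ + E (suc j ⊖ m)                            ≡⟨ ≡.cong (λ z → + a ℤ.* + i ℤ.+ + E z) (suc-⊖ j m) ⟩
      + a ℤ.* + i ℤ.+ + E ((j ⊖ m) ℤ.+ 1ℤ)                       ≡⟨ ≡.cong (ℤ._+_ (+ a ℤ.* + i)) (E-suc (j ⊖ m)) ⟩
      + a ℤ.* + i ℤ.+ (+ E (j ⊖ m) ℤ.+ (+ a ℤ.* (j ⊖ m) ℤ.+ + b)) ≡⟨ lemma (+ a) (+ i) (j ⊖ m) (+ b) (+ E (j ⊖ m)) ⟩
      + a ℤ.* (+ i ℤ.+ (j ⊖ m)) ℤ.+ + b ℤ.+ + E (j ⊖ m)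
        ≡⟨ ≡.cong (λ z → + a ℤ.* z ℤ.+ + b ℤ.+ + E (j ⊖ m)) (antidiagonal-index p) ⟩
      + a ℤ.* + n ℤ.+ + b ℤ.+ + E (j ⊖ m)                        ≡⟨ ≡.cong (ℤ._+ + E (j ⊖ m)) (pos-affine a n b) ⟨
      + ((a ℕ.* n ℕ.+ b) ℕ.+ E (j ⊖ m))                          ∎)
      where
      open ≡.≡-Reasoning
      lemma : ∀ a i k b x → a ℤ.* i ℤ.+ (x ℤ.+ (a ℤ.* k ℤ.+ b)) ≡ a ℤ.* (i ℤ.+ k) ℤ.+ b ℤ.+ x
      lemma = solve-∀

    exponentᵐ : ∀ j m → a ℕ.* j ℕ.+ E (j ⊖ suc m) ≡ (a ℕ.* m ℕ.+ c) ℕ.+ E (j ⊖ m)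
    exponentᵐ j m = ℤ.+-injective (begin
      + (a ℕ.* j ℕ.+ E k)                                             ≡⟨ pos-affine a j _ ⟩
      + a ℤ.* + j ℤ.+ + E k                                           ≡⟨ ≡.cong (λ z → + a ℤ.* z ℤ.+ + E k) j≡ ⟩
      + a ℤ.* (k ℤ.+ 1ℤ ℤ.+ + m) ℤ.+ + E k
        ≡⟨ ≡.cong (λ z → z ℤ.* (k ℤ.+ 1ℤ ℤ.+ + m) ℤ.+ + E k) (≡.cong +_ (≡.sym b+c≡a)) ⟩
      (+ b ℤ.+ + c) ℤ.* (k ℤ.+ 1ℤ ℤ.+ + m) ℤ.+ + E k                  ≡⟨ lemma (+ b) (+ c) k (+ m) (+ E k) ⟩
      (+ b ℤ.+ + c) ℤ.* + m ℤ.+ + c ℤ.+ (+ E k ℤ.+ ((+ b ℤ.+ + c) ℤ.* k ℤ.+ + b))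
                                                                      ≡⟨ ≡.cong (λ z → z ℤ.* + m ℤ.+ + c ℤ.+ (+ E k ℤ.+ (z ℤ.* k ℤ.+ + b))) (≡.cong +_ b+c≡a) ⟩
      + a ℤ.* + m ℤ.+ + c ℤ.+ (+ E k ℤ.+ (+ a ℤ.* k ℤ.+ + b))         ≡⟨ ≡.cong₂ ℤ._+_ (pos-affine a m c) (E-suc k) ⟨
      + (a ℕ.* m ℕ.+ c) ℤ.+ + E (k ℤ.+ 1ℤ)
        ≡⟨ ≡.cong (λ z → + (a ℕ.* m ℕ.+ c) ℤ.+ + E z) k+1 ⟩
      + ((a ℕ.* m ℕ.+ c) ℕ.+ E (j ⊖ m))                               ∎)
      where
      open ≡.≡-Reasoning
      k = j ⊖ suc m
      k+1 : k ℤ.+ 1ℤ ≡ j ⊖ m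
      k+1 = ≡.trans (≡.sym (suc-⊖ j (suc m))) (ℤ.[1+m]⊖[1+n]≡m⊖n j m)
      cancel : ∀ x y → x ≡ x ℤ.- y ℤ.+ y
      cancel = solve-∀
      j≡ : + j ≡ k ℤ.+ 1ℤ ℤ.+ + m
      j≡ = ≡.trans (cancel (+ j) (+ m)) (≡.cong (ℤ._+ + m) (≡.trans (ℤ.m-n≡m⊖n j m) (≡.sym k+1)))
      lemma : ∀ b c k m x → (b ℤ.+ c) ℤ.* (k ℤ.+ 1ℤ ℤ.+ m) ℤ.+ x
                          ≡ (b ℤ.+ c) ℤ.* m ℤ.+ c ℤ.+ (x ℤ.+ ((b ℤ.+ c) ℤ.* k ℤ.+ b))
      lemma = solve-∀

module JacobiTripleProduct (S : TruncatedSeriesRing) where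
  open Data.Nat using (_≤_; _<_)
  open TruncatedSeriesRing S
  open Sums S
  open TripleProductExponents
  open import Algebra.Properties.Ring ring using (-0#≈0#)
  open import Relation.Binary.Reasoning.Setoid setoid

  prod : (ℕ → Carrier) → ℕ → Carrier
  prod g zero    = 1#
  prod g (suc n) = prod g n * g n

  prod-cong : {g h : ℕ → Carrier} → (∀ i → g i ≈ h i) → ∀ n → prod g n ≈ prod h n
  prod-cong p zero    = refl
  prod-cong p (suc n) = *-cong (prod-cong p n) (p n)

  prod-* : ∀ (g h : ℕ → Carrier) n → prod (λ i → g i * h i) n ≈ prod g n * prod h n
  prod-* g h zero    = sym (*-identityˡ 1#)
  prod-* g h (suc n) = trans (*-congʳ (prod-* g h n))
    (*-interchange _ _ _ _)

  prod-stable : {g : ℕ → Carrier} {m : ℕ} → (∀ i → m ≤ i → g i ≈ 1#) → ∀ {n} → m ≤ n → prod g n ≈ prod g m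
  prod-stable {g} {m} p m≤n = go (ℕ.≤⇒≤′ m≤n)
    where
    go : ∀ {n} → m ℕ.≤′ n → prod g n ≈ prod g m
    go (ℕ.≤′-reflexive ≡.refl) = refl
    go (ℕ.≤′-step m≤′n)        = trans (*-cong (go m≤′n) (p _ (ℕ.≤′⇒≤ m≤′n))) (*-identityʳ _)

  -- Keeping both indices of i + j = n lets the Gaussian binomials be written without subtraction
  -- and treats the two Pascal rules alike.
  antidiagonal : (ℕ → ℕ → Carrier) → ℕ → Carrier
  antidiagonal f zero    = f 0 0
  antidiagonal f (suc n) = f (suc n) 0 + antidiagonal (λ i j → f i (suc j)) n

  antidiagonal-cong : ∀ n {f g : ℕ → ℕ → Carrier} → (∀ i j → i ℕ.+ j ≡ n → f i j ≈ g i j) →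
                      antidiagonal f n ≈ antidiagonal g n
  antidiagonal-cong zero    p = p 0 0 ≡.refl
  antidiagonal-cong (suc n) p = +-cong (p (suc n) 0 (ℕ.+-identityʳ (suc n)))
    (antidiagonal-cong n (λ i j e → p i (suc j) (≡.trans (ℕ.+-suc i j) (≡.cong suc e))))

  antidiagonal-*ˡ : ∀ n c (f : ℕ → ℕ → Carrier) → antidiagonal (λ i j → c * f i j) n ≈ c * antidiagonal f n
  antidiagonal-*ˡ zero    c f = refl
  antidiagonal-*ˡ (suc n) c f = trans (+-congˡ (antidiagonal-*ˡ n c _)) (sym (distribˡ c _ _))

  antidiagonal-sucʳ : ∀ n (f : ℕ → ℕ → Carrier) →
                      antidiagonal f (suc n) ≈ antidiagonal (λ i j → f (suc i) j) n + f 0 (suc n)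
  antidiagonal-sucʳ zero    f = refl
  antidiagonal-sucʳ (suc n) f = trans (+-congˡ (antidiagonal-sucʳ n (λ i j → f i (suc j)))) (sym (+-assoc _ _ _))

  antidiagonal-split₀ : ∀ n (f g h : ℕ → ℕ → Carrier) → (∀ i j → h (suc i) j ≈ f i j + g (suc i) j) →
                        (∀ j → h 0 j ≈ g 0 j) → antidiagonal h (suc n) ≈ antidiagonal f n + antidiagonal g (suc n)
  antidiagonal-split₀ zero    f g h p q = trans (+-cong (p 0 0) (q 1)) (+-assoc _ _ _)
  antidiagonal-split₀ (suc n) f g h p q = trans
    (+-cong (p (suc n) 0) (antidiagonal-split₀ n (λ i j → f i (suc j)) (λ i j → g i (suc j)) (λ i j → h i (suc j))
              (λ i j → p i (suc j)) (λ j → q (suc j))))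
    (+-interchange _ _ _ _)

  -- The shape of a Pascal rule summed over an antidiagonal: inner entries have two parents, the two
  -- end entries only one.
  antidiagonal-split : ∀ n (f g h : ℕ → ℕ → Carrier) → (∀ i j → h (suc i) (suc j) ≈ f i (suc j) + g (suc i) j) →
                       (∀ i → h (suc i) 0 ≈ f i 0) → (∀ j → h 0 (suc j) ≈ g 0 j) →
                       antidiagonal h (suc n) ≈ antidiagonal f n + antidiagonal g n
  antidiagonal-split zero    f g h p q r = +-cong (q 0) (r 0)
  antidiagonal-split (suc n) f g h p q r = trans
    (+-cong (q (suc n)) (antidiagonal-split₀ n (λ i j → f i (suc j)) g (λ i j → h i (suc j)) p r))
    (sym (+-assoc _ _ _))

  antidiagonal-box : ∀ n (g : ℤ → Carrier) → antidiagonal (λ i j → g (j ⊖ n)) (n ℕ.+ n) ≈ sum (box n) g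
  antidiagonal-box zero    g = sym (+-identityʳ (g 0ℤ))
  antidiagonal-box (suc n) g rewrite ℕ.+-suc n n = begin
    g -[1+ n ] + antidiagonal (λ i j → g (suc j ⊖ suc n)) (suc (n ℕ.+ n))
      ≈⟨ +-congˡ (antidiagonal-sucʳ (n ℕ.+ n) (λ i j → g (suc j ⊖ suc n))) ⟩
    g -[1+ n ] + (antidiagonal (λ i j → g (suc j ⊖ suc n)) (n ℕ.+ n) + g (suc (suc (n ℕ.+ n)) ⊖ suc n))
      ≈⟨ +-congˡ (+-cong (trans (antidiagonal-cong (n ℕ.+ n) (λ i j _ → reflexive (≡.cong g (ℤ.[1+m]⊖[1+n]≡m⊖n j n))))
                                (antidiagonal-box n g))
                         (reflexive (≡.cong g top))) ⟩
    g -[1+ n ] + (sum (box n) g + g (+ suc n))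
      ≈⟨ solve 3 (λ a b c → a :+ (b :+ c) := c :+ (a :+ b)) refl _ _ _ ⟩
    g (+ suc n) + (g -[1+ n ] + sum (box n) g) ∎
    where
    top : suc (suc (n ℕ.+ n)) ⊖ suc n ≡ + suc n
    top = ≡.trans (ℤ.⊖-≥ (s≤s (ℕ.m≤n⇒m≤1+n (ℕ.m≤m+n n n))))
                  (≡.cong +_ (≡.trans (≡.cong (ℕ._∸ n) (≡.sym (ℕ.+-suc n n))) (ℕ.m+n∸m≡n n (suc n))))

  module QBinomial (a : ℕ) where

    Q : ℕ → Carrier
    Q n = X (a ℕ.* n)

    Q-0 : Q 0 ≈ 1#
    Q-0 = trans (reflexive (≡.cong X (ℕ.*-zeroʳ a))) X-0

    Q-suc : ∀ n → Q (suc n) ≈ X a * Q n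
    Q-suc n = trans (reflexive (≡.cong X (ℕ.*-suc a n))) (X-+ a (a ℕ.* n))

    -- The Gaussian binomial coefficient of i + j over j, in base q^a.
    binomial : ℕ → ℕ → Carrier
    binomial zero    j       = 1#
    binomial (suc i) zero    = 1#
    binomial (suc i) (suc j) = binomial (suc i) j + Q (suc j) * binomial i (suc j)

    binomial-0ʳ : ∀ i → binomial i 0 ≈ 1#
    binomial-0ʳ zero    = refl
    binomial-0ʳ (suc i) = refl

    -- The Pascal rule with the weight on the other term. Both rules are needed: the defining one
    -- lets the second product of the triple product grow, this one the first.
    binomial-pascal : ∀ i j → binomial (suc i) (suc j) ≈ Q (suc i) * binomial (suc i) j + binomial i (suc j)
    binomial-pascal zero zero = +-comm _ _
    binomial-pascal zero (suc j) = begin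
      binomial 1 (suc j) + Q (suc (suc j)) * 1#
        ≈⟨ +-cong (binomial-pascal zero j) (*-congʳ (Q-suc (suc j))) ⟩
      Q 1 * binomial 1 j + 1# + X a * Q (suc j) * 1#
        ≈⟨ +-cong (+-congʳ (*-congʳ Q-1)) refl ⟩
      X a * binomial 1 j + 1# + X a * Q (suc j) * 1#
        ≈⟨ solve 4 (λ x b r o → x :* b :+ o :+ x :* r :* o := x :* (b :+ r :* o) :+ o) refl _ _ _ _ ⟩
      X a * (binomial 1 j + Q (suc j) * 1#) + 1#
        ≈⟨ +-congʳ (*-congʳ Q-1) ⟨
      Q 1 * binomial 1 (suc j) + 1# ∎
      where
      Q-1 : Q 1 ≈ X a
      Q-1 = trans (Q-suc 0) (trans (*-congˡ Q-0) (*-identityʳ (X a)))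
    binomial-pascal (suc i) zero = begin
      1# + Q 1 * binomial (suc i) 1
        ≈⟨ +-cong refl (*-cong (trans (Q-suc 0) (*-congˡ Q-0)) (binomial-pascal i zero)) ⟩
      1# + X a * 1# * (Q (suc i) * 1# + binomial i 1)
        ≈⟨ solve 4 (λ x b r o → o :+ x :* o :* (r :* o :+ b) := x :* r :* (o :* o) :+ (o :+ x :* o :* b)) refl _ _ _ _ ⟩
      X a * Q (suc i) * (1# * 1#) + (1# + X a * 1# * binomial i 1)
        ≈⟨ +-cong (*-cong (Q-suc (suc i)) (sym (*-identityʳ 1#))) (+-cong refl (*-congʳ (trans (Q-suc 0) (*-congˡ Q-0)))) ⟨
      Q (suc (suc i)) * 1# + (1# + Q 1 * binomial i 1) ∎
    binomial-pascal (suc i) (suc j) = begin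
      binomial (suc (suc i)) (suc j) + Q (suc (suc j)) * binomial (suc i) (suc (suc j))
        ≈⟨ +-cong (binomial-pascal (suc i) j) (*-cong (Q-suc (suc j)) (binomial-pascal i (suc j))) ⟩
      Q (suc (suc i)) * b₁ + b₂ + X a * Q (suc j) * (Q (suc i) * b₂ + b₃)
        ≈⟨ +-cong (+-congʳ (*-congʳ (Q-suc (suc i)))) refl ⟩
      X a * Q (suc i) * b₁ + b₂ + X a * Q (suc j) * (Q (suc i) * b₂ + b₃)
        ≈⟨ solve 6 (λ x q r b₁ b₂ b₃ → x :* q :* b₁ :+ b₂ :+ x :* r :* (q :* b₂ :+ b₃)
                       := x :* q :* (b₁ :+ r :* b₂) :+ (b₂ :+ x :* r :* b₃)) refl _ _ _ _ _ _ ⟩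
      X a * Q (suc i) * (b₁ + Q (suc j) * b₂) + (b₂ + X a * Q (suc j) * b₃)
        ≈⟨ +-cong (*-congʳ (Q-suc (suc i))) (+-congˡ (*-congʳ (Q-suc (suc j)))) ⟨
      Q (suc (suc i)) * binomial (suc (suc i)) (suc j) + binomial (suc i) (suc (suc j)) ∎
      where
      b₁ = binomial (suc (suc i)) j
      b₂ = binomial (suc i) (suc j)
      b₃ = binomial i (suc (suc j))

    factorial : ℕ → Carrier
    factorial = prod (λ i → 1# - Q (suc i))

    module _ (0<a : 0 < a) where

      Q-> : ∀ n → order < n → Q n ≈ 0#
      Q-> n N<n = X-> _ (ℕ.<-≤-trans N<n (ℕ.m≤n*m n a {{ℕ.>-nonZero 0<a}}))

      factorial-stable : ∀ {n} → order ≤ n → factorial n ≈ factorial order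
      factorial-stable = prod-stable λ i N≤i → trans (+-congˡ (-‿cong (Q-> (suc i) (s≤s N≤i))))
        (trans (+-congˡ -0#≈0#) (+-identityʳ 1#))

      -- As i grows, the Gaussian binomial tends to the inverse of the factorial of j. Modulo
      -- q^(order + 1) the limit is attained once i exceeds `order`, because `Q i` vanishes there
      -- and the second Pascal rule makes the binomial independent of i.
      factorial*binomial : ∀ i j → order < i → factorial j * binomial i j ≈ 1#
      factorial*binomial i       zero    N<i = trans (*-identityˡ _) (binomial-0ʳ i)
      factorial*binomial (suc i) (suc j) N<i = begin
        factorial j * (1# - Q (suc j)) * binomial (suc i) (suc j)
          ≈⟨ solve 4 (λ f o q b → f :* (o :- q) :* b := f :* (o :* b :- q :* b)) refl _ _ _ _ ⟩
        factorial j * (1# * binomial (suc i) (suc j) - Q (suc j) * binomial (suc i) (suc j))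
          ≈⟨ *-congˡ (+-cong (*-identityˡ _) (-‿cong (*-congˡ stable))) ⟩
        factorial j * (binomial (suc i) j + Q (suc j) * binomial i (suc j) - Q (suc j) * binomial i (suc j))
          ≈⟨ *-congˡ (solve 2 (λ x y → x :+ y :- y := x) refl _ _) ⟩
        factorial j * binomial (suc i) j
          ≈⟨ factorial*binomial (suc i) j N<i ⟩
        1# ∎
        where
        stable : binomial (suc i) (suc j) ≈ binomial i (suc j)
        stable = trans (binomial-pascal i j)
          (trans (+-congʳ (trans (*-congʳ (Q-> (suc i) N<i)) (zeroˡ _))) (+-identityˡ _))

  -- The variable of the triple product is specialised to a sign ε times a power of q. Since ε is
  -- its own inverse, both products carry the same ε, and the forward recursion also fixes σ k = ε^k
  -- for negative k.
  module TripleProduct (a b c : ℕ) (b+c≡a : b ℕ.+ c ≡ a) (0<a : 0 < a)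
           (ε : Carrier) (ε² : ε * ε ≈ 1#)
           (E : ℤ → ℕ) (E-0 : E 0ℤ ≡ 0) (E-suc : ∀ k → + E (k ℤ.+ 1ℤ) ≡ + E k ℤ.+ (+ a ℤ.* k ℤ.+ + b))
           (E-coercive : ∀ k → ∣ k ∣ ≤ suc (E k))
           (σ : ℤ → Carrier) (σ-0 : σ 0ℤ ≈ 1#) (σ-suc : ∀ k → σ (k ℤ.+ 1ℤ) ≈ ε * σ k)
           where
    open QBinomial a
    open Exponents a b c b+c≡a E E-suc

    α β : ℕ → Carrier
    α n = ε * X (a ℕ.* n ℕ.+ b)
    β n = ε * X (a ℕ.* n ℕ.+ c)

    e : ℤ → Carrier
    e k = σ k * X (E k)

    private
      stepⁿ : ∀ {i j n m} → i ℕ.+ j ≡ n ℕ.+ m → Q i * e (suc j ⊖ m) ≈ α n * e (j ⊖ m)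
      stepⁿ {i} {j} {n} {m} p = begin
        Q i * (σ (suc j ⊖ m) * X (E (suc j ⊖ m)))
          ≈⟨ *-congˡ (*-congʳ (trans (reflexive (≡.cong σ (suc-⊖ j m))) (σ-suc (j ⊖ m)))) ⟩
        Q i * (ε * σ (j ⊖ m) * X (E (suc j ⊖ m)))
          ≈⟨ solve 4 (λ q ε s x → q :* (ε :* s :* x) := ε :* s :* (q :* x)) refl _ _ _ _ ⟩
        ε * σ (j ⊖ m) * (Q i * X (E (suc j ⊖ m)))
          ≈⟨ *-congˡ (trans (sym (X-+ _ _)) (trans (reflexive (≡.cong X (exponentⁿ p))) (X-+ _ _))) ⟩
        ε * σ (j ⊖ m) * (X (a ℕ.* n ℕ.+ b) * X (E (j ⊖ m)))
          ≈⟨ solve 4 (λ ε s x y → ε :* s :* (x :* y) := ε :* x :* (s :* y)) refl _ _ _ _ ⟩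
        α n * e (j ⊖ m) ∎

      stepᵐ : ∀ j m → Q j * e (j ⊖ suc m) ≈ β m * e (j ⊖ m)
      stepᵐ j m = begin
        Q j * (σ (j ⊖ suc m) * X (E (j ⊖ suc m)))
          ≈⟨ *-congˡ (*-congʳ sign) ⟩
        Q j * (ε * σ (j ⊖ m) * X (E (j ⊖ suc m)))
          ≈⟨ solve 4 (λ q ε s x → q :* (ε :* s :* x) := ε :* s :* (q :* x)) refl _ _ _ _ ⟩
        ε * σ (j ⊖ m) * (Q j * X (E (j ⊖ suc m)))
          ≈⟨ *-congˡ (trans (sym (X-+ _ _)) (trans (reflexive (≡.cong X (exponentᵐ j m))) (X-+ _ _))) ⟩
        ε * σ (j ⊖ m) * (X (a ℕ.* m ℕ.+ c) * X (E (j ⊖ m)))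
          ≈⟨ solve 4 (λ ε s x y → ε :* s :* (x :* y) := ε :* x :* (s :* y)) refl _ _ _ _ ⟩
        β m * e (j ⊖ m) ∎
        where
        sign : σ (j ⊖ suc m) ≈ ε * σ (j ⊖ m)
        sign = begin
          σ (j ⊖ suc m)                ≈⟨ *-identityˡ _ ⟨
          1# * σ (j ⊖ suc m)           ≈⟨ *-congʳ ε² ⟨
          ε * ε * σ (j ⊖ suc m)        ≈⟨ *-assoc ε ε _ ⟩
          ε * (ε * σ (j ⊖ suc m))      ≈⟨ *-congˡ (σ-suc (j ⊖ suc m)) ⟨
          ε * σ ((j ⊖ suc m) ℤ.+ 1ℤ)
            ≈⟨ *-congˡ (reflexive (≡.cong σ (≡.trans (≡.sym (suc-⊖ j (suc m))) (ℤ.[1+m]⊖[1+n]≡m⊖n j m)))) ⟩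
          ε * σ (j ⊖ m)                ∎

    -- Cauchy's finite form. On the antidiagonal i + j = n + m, multiplication of `e k` by `α n`
    -- gives `Q i` times `e (k + 1)`, and the new factor 1 + α n becomes exactly a Pascal rule;
    -- `β m` shifts k downwards with weight `Q j`.
    finite-triple-product : ∀ n m → prod (λ i → 1# + α i) n * prod (λ i → 1# + β i) m
                                  ≈ antidiagonal (λ i j → binomial i j * e (j ⊖ m)) (n ℕ.+ m)
    finite-triple-product zero zero = begin
      1# * 1#               ≈⟨ *-congˡ (*-identityˡ 1#) ⟨
      1# * (1# * 1#)        ≈⟨ *-congˡ (*-cong σ-0 (trans (reflexive (≡.cong X E-0)) X-0)) ⟨
      1# * e 0ℤ             ∎
    -- The second product is built up first, at n = 0; the general case then only has to add factors
    -- of the first product.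
    finite-triple-product zero (suc m) = begin
      1# * (prod (λ i → 1# + β i) m * (1# + β m))
        ≈⟨ solve 3 (λ x y z → x :* (y :* z) := z :* (x :* y)) refl _ _ _ ⟩
      (1# + β m) * (1# * prod (λ i → 1# + β i) m)
        ≈⟨ *-congˡ (finite-triple-product zero m) ⟩
      (1# + β m) * antidiagonal t m
        ≈⟨ trans (distribʳ _ _ _) (+-comm _ _) ⟩
      β m * antidiagonal t m + 1# * antidiagonal t m
        ≈⟨ +-cong (sym (antidiagonal-*ˡ m (β m) t)) (*-identityˡ _) ⟩
      antidiagonal (λ i j → β m * (binomial i j * e (j ⊖ m))) m + antidiagonal t m
        ≈⟨ +-cong (antidiagonal-cong m (λ i j _ → trans
                     (solve 3 (λ x y z → x :* (y :* z) := y :* (x :* z)) refl _ _ _)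
                     (trans (*-congˡ (sym (stepᵐ j m)))
                            (solve 3 (λ x y z → y :* (x :* z) := x :* (y :* z)) refl _ _ _))))
                  (antidiagonal-cong m (λ i j _ → *-congˡ (reflexive (≡.cong e (≡.sym (ℤ.[1+m]⊖[1+n]≡m⊖n j m)))))) ⟩
      antidiagonal (λ i j → Q j * (binomial i j * e (j ⊖ suc m))) m +
      antidiagonal (λ i j → binomial i j * e (suc j ⊖ suc m)) m
        ≈⟨ antidiagonal-split m
             (λ i j → Q j * (binomial i j * e (j ⊖ suc m)))
             (λ i j → binomial i j * e (suc j ⊖ suc m))
             (λ i j → binomial i j * e (j ⊖ suc m))
             (λ i j → solve 4 (λ x q y z → (x :+ q :* y) :* z := q :* (y :* z) :+ x :* z) refl _ _ _ _)
             (λ i → sym (trans (*-congʳ Q-0) (trans (*-identityˡ _) (*-congʳ (binomial-0ʳ i)))))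
             (λ j → refl) ⟨
      antidiagonal (λ i j → binomial i j * e (j ⊖ suc m)) (suc m) ∎
      where
      t = λ i j → binomial i j * e (j ⊖ m)
    finite-triple-product (suc n) m = begin
      prod (λ i → 1# + α i) n * (1# + α n) * prod (λ i → 1# + β i) m
        ≈⟨ solve 3 (λ x y z → x :* y :* z := y :* (x :* z)) refl _ _ _ ⟩
      (1# + α n) * (prod (λ i → 1# + α i) n * prod (λ i → 1# + β i) m)
        ≈⟨ *-congˡ (finite-triple-product n m) ⟩
      (1# + α n) * antidiagonal t (n ℕ.+ m)
        ≈⟨ distribʳ _ _ _ ⟩
      1# * antidiagonal t (n ℕ.+ m) + α n * antidiagonal t (n ℕ.+ m)
        ≈⟨ +-cong (*-identityˡ _) (sym (antidiagonal-*ˡ (n ℕ.+ m) (α n) t)) ⟩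
      antidiagonal t (n ℕ.+ m) + antidiagonal (λ i j → α n * (binomial i j * e (j ⊖ m))) (n ℕ.+ m)
        ≈⟨ +-congˡ (antidiagonal-cong (n ℕ.+ m) (λ i j p → trans
                     (solve 3 (λ x y z → x :* (y :* z) := y :* (x :* z)) refl _ _ _)
                     (trans (*-congˡ (sym (stepⁿ p)))
                            (solve 3 (λ x y z → y :* (x :* z) := x :* (y :* z)) refl _ _ _)))) ⟩
      antidiagonal t (n ℕ.+ m) + antidiagonal (λ i j → Q i * (binomial i j * e (suc j ⊖ m))) (n ℕ.+ m)
        ≈⟨ antidiagonal-split (n ℕ.+ m) t
             (λ i j → Q i * (binomial i j * e (suc j ⊖ m)))
             (λ i j → binomial i j * e (j ⊖ m))
             (λ i j → trans (*-congʳ (binomial-pascal i j))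
                 (solve 4 (λ q x y z → (q :* x :+ y) :* z := y :* z :+ q :* (x :* z)) refl _ _ _ _))
             (λ i → *-congʳ (sym (binomial-0ʳ i)))
             (λ j → sym (trans (*-congʳ Q-0) (*-identityˡ _))) ⟨
      antidiagonal (λ i j → binomial i j * e (j ⊖ m)) (suc (n ℕ.+ m)) ∎
      where
      t = λ i j → binomial i j * e (j ⊖ m)

    -- The finite form at n = m = D: terms whose exponent exceeds `order` vanish, and for the
    -- remaining ones factorial times binomial is already 1.
    triple-product : factorial D * (prod (λ i → 1# + α i) D * prod (λ i → 1# + β i) D) ≈ sum (box D) e
    triple-product = begin
      factorial D * (prod (λ i → 1# + α i) D * prod (λ i → 1# + β i) D)
        ≈⟨ *-congˡ (finite-triple-product D D) ⟩
      factorial D * antidiagonal (λ i j → binomial i j * e (j ⊖ D)) (D ℕ.+ D)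
        ≈⟨ antidiagonal-*ˡ (D ℕ.+ D) (factorial D) (λ i j → binomial i j * e (j ⊖ D)) ⟨
      antidiagonal (λ i j → factorial D * (binomial i j * e (j ⊖ D))) (D ℕ.+ D)
        ≈⟨ antidiagonal-cong (D ℕ.+ D) limit ⟩
      antidiagonal (λ i j → e (j ⊖ D)) (D ℕ.+ D)
        ≈⟨ antidiagonal-box D e ⟩
      sum (box D) e ∎
      where
      limit : ∀ i j → i ℕ.+ j ≡ D ℕ.+ D → factorial D * (binomial i j * e (j ⊖ D)) ≈ e (j ⊖ D)
      limit i j p with E (j ⊖ D) ℕ.≤? order
      ... | no E≰N = trans (*-congˡ (trans (*-congˡ vanish) (zeroʳ _))) (trans (zeroʳ _) (sym vanish))
        where
        vanish : e (j ⊖ D) ≈ 0#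
        vanish = trans (*-congˡ (X-> _ (ℕ.≰⇒> E≰N))) (zeroʳ _)
      ... | yes E≤N = begin
        factorial D * (binomial i j * e (j ⊖ D))  ≈⟨ *-assoc _ _ _ ⟨
        factorial D * binomial i j * e (j ⊖ D)
          -- Both factorials have reached their stable value, so the one of D may be traded for the
          -- one of j.
          ≈⟨ *-congʳ (*-congʳ (trans (factorial-stable 0<a N≤D) (sym (factorial-stable 0<a N≤j)))) ⟩
        factorial j * binomial i j * e (j ⊖ D)    ≈⟨ *-congʳ (factorial*binomial 0<a i j N<i) ⟩
        1# * e (j ⊖ D)                            ≈⟨ *-identityˡ _ ⟩
        e (j ⊖ D)                                 ∎
        where
        -- Here |j - D| ≤ order + 1, so i and j are at least D - (order + 1) = order + 2.
        middle = near-middle D p (ℕ.≤-trans (E-coercive (j ⊖ D)) (s≤s E≤N))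
        bound : ∀ {x} → D ≤ x ℕ.+ suc order → suc order ≤ x
        bound {x} q = ℕ.≤-trans (ℕ.n≤1+n (suc order)) (ℕ.+-cancelʳ-≤ (suc order) (2 ℕ.+ order) x
          (ℕ.≤-trans (ℕ.≤-reflexive (ℕ.+-comm (2 ℕ.+ order) (suc order))) q))
        N<i : order < i
        N<i = bound (proj₁ middle)
        N≤j : order ≤ j
        N≤j = ℕ.<⇒≤ (bound (proj₂ middle))
        N≤D : order ≤ D
        N≤D = ℕ.≤-trans (ℕ.n≤1+n order) (ℕ.m≤m+n (suc order) (2 ℕ.+ order))

-- Theta functions and their product formulas

module ThetaFunctions (S : TruncatedSeriesRing) where
  open Data.Nat using (_≤_; _<_)
  open TruncatedSeriesRing S
  open Sums S
  open JacobiTripleProduct S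
  open import Algebra.Properties.Ring ring using (-0#≈0#; -‿involutive; -1*x≈-x; -‿distribˡ-*)
  open import Relation.Binary.Reasoning.Setoid setoid

  f : ℕ → Carrier
  f s = prod (λ i → 1# - X (s ℕ.* suc i)) D

  sgn : ℤ → Carrier
  sgn k = alternate ∣ k ∣
    where
    alternate : ℕ → Carrier
    alternate zero    = 1#
    alternate (suc n) = - alternate n

  φ φ₋ Ψ pentagonal : ℕ → Carrier
  φ s          = sum (box D) (λ k → X (s ℕ.* sq k))
  φ₋ s         = sum (box D) (λ k → sgn k * X (s ℕ.* sq k))
  Ψ s          = sum (box D) (λ k → X (s ℕ.* tri k))
  pentagonal s = sum (box D) (λ k → sgn k * X (s ℕ.* pent k))

  sgn-suc : ∀ k → sgn (k ℤ.+ 1ℤ) ≈ - sgn k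
  sgn-suc (+ n)          = reflexive (≡.cong (λ m → sgn (+ m)) (ℕ.+-comm n 1))
  sgn-suc -[1+ zero ]    = sym (-‿involutive 1#)
  sgn-suc -[1+ (suc n) ] = sym (-‿involutive _)

  sgn-suc′ : ∀ k → sgn (k ℤ.+ 1ℤ) ≈ - 1# * sgn k
  sgn-suc′ k = trans (sgn-suc k) (sym (-1*x≈-x (sgn k)))

  sgn-neg : ∀ k → sgn (ℤ.- k) ≈ sgn k
  sgn-neg (+ zero)  = refl
  sgn-neg (+ suc n) = refl
  sgn-neg -[1+ n ]  = refl

  sgn-+ : ∀ x y → sgn (x ℤ.+ y) ≈ sgn x * sgn y
  sgn-+ (+ n) y = nonneg n y
    where
    rearrange : ∀ n y → 1ℤ ℤ.+ n ℤ.+ y ≡ n ℤ.+ y ℤ.+ 1ℤ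
    rearrange = solve-∀
    nonneg : ∀ n y → sgn (+ n ℤ.+ y) ≈ sgn (+ n) * sgn y
    nonneg zero    y = trans (reflexive (≡.cong sgn (ℤ.+-identityˡ y))) (sym (*-identityˡ _))
    nonneg (suc n) y = begin
      sgn (+ suc n ℤ.+ y)          ≡⟨ ≡.cong sgn (rearrange (+ n) y) ⟩
      sgn (+ n ℤ.+ y ℤ.+ 1ℤ)       ≈⟨ sgn-suc (+ n ℤ.+ y) ⟩
      - sgn (+ n ℤ.+ y)            ≈⟨ -‿cong (nonneg n y) ⟩
      - (sgn (+ n) * sgn y)        ≈⟨ -‿distribˡ-* _ _ ⟩
      sgn (+ suc n) * sgn y        ∎
  sgn-+ x@(-[1+ n ]) y = begin
    sgn (x ℤ.+ y)                  ≈⟨ sgn-neg (x ℤ.+ y) ⟨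
    sgn (ℤ.- (x ℤ.+ y))            ≡⟨ ≡.cong sgn (ℤ.neg-distrib-+ x y) ⟩
    sgn (+ suc n ℤ.+ ℤ.- y)        ≈⟨ sgn-+ (+ suc n) (ℤ.- y) ⟩
    sgn (+ suc n) * sgn (ℤ.- y)    ≈⟨ *-congˡ (sgn-neg y) ⟩
    sgn x * sgn y                  ∎

  sgn-sub : ∀ x y → sgn (x ℤ.- y) ≈ sgn x * sgn y
  sgn-sub x y = trans (sgn-+ x (ℤ.- y)) (*-congˡ (sgn-neg y))

  -1*-1≈1 : - 1# * - 1# ≈ 1#
  -1*-1≈1 = trans (-1*x≈-x (- 1#)) (-‿involutive 1#)

  sgn-square : ∀ k → sgn k * sgn k ≈ 1#
  sgn-square k = trans (*-congˡ (sym (sgn-neg k))) (trans (sym (sgn-+ k (ℤ.- k)))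
    (reflexive (≡.cong sgn (ℤ.+-inverseʳ k))))

  sgn-even : ∀ n → sgn (n ℤ.+ n) ≈ 1#
  sgn-even n = trans (sgn-+ n n) (sgn-square n)

  sgn-odd : ∀ n → sgn (n ℤ.+ n ℤ.+ 1ℤ) ≈ - 1#
  sgn-odd n = trans (sgn-suc (n ℤ.+ n)) (-‿cong (sgn-even n))

  order≤D : order ≤ D
  order≤D = ℕ.≤-trans (ℕ.n≤1+n order) (ℕ.m≤m+n (suc order) (2 ℕ.+ order))

  X-≡ : ∀ {m n} → m ≡ n → X m ≈ X n
  X-≡ e = reflexive (≡.cong X e)

  1-X : ∀ {m n} → m ≡ n → 1# - X m ≈ 1# - X n
  1-X e = reflexive (≡.cong (λ k → 1# - X k) e)

  -- Sorting the factors into two or three residue classes of D factors each requires a product of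
  -- length 2 D or 3 D; the factors added are 1 in the truncation.
  f-extend : ∀ s {n} → 0 < s → D ≤ n → f s ≈ prod (λ i → 1# - X (s ℕ.* suc i)) n
  f-extend s 0<s D≤n = trans (prod-stable trivial order≤D) (sym (prod-stable trivial (ℕ.≤-trans order≤D D≤n)))
    where
    trivial : ∀ i → order ≤ i → 1# - X (s ℕ.* suc i) ≈ 1#
    trivial i N≤i = trans (+-congˡ (trans (-‿cong (X-> _ N<s*[1+i])) -0#≈0#)) (+-identityʳ 1#)
      where
      N<s*[1+i] : order < s ℕ.* suc i
      N<s*[1+i] = ℕ.≤-trans (s≤s N≤i) (ℕ.m≤n*m (suc i) s {{ℕ.>-nonZero 0<s}})

  prod-pairs : ∀ g n → prod g (n ℕ.* 2) ≈ prod (λ i → g (i ℕ.* 2)) n * prod (λ i → g (suc (i ℕ.* 2))) n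
  prod-pairs g zero    = sym (*-identityˡ 1#)
  prod-pairs g (suc n) = trans (*-congʳ (*-congʳ (prod-pairs g n)))
    (solve 4 (λ a b c d → a :* b :* c :* d := a :* c :* (b :* d)) refl _ _ _ _)

  prod-triples : ∀ g n → prod g (n ℕ.* 3) ≈
    prod (λ i → g (suc (suc (i ℕ.* 3)))) n * (prod (λ i → g (i ℕ.* 3)) n * prod (λ i → g (suc (i ℕ.* 3))) n)
  prod-triples g zero    = sym (trans (*-identityˡ _) (*-identityˡ 1#))
  prod-triples g (suc n) = trans (*-congʳ (*-congʳ (*-congʳ (prod-triples g n))))
    (solve 6 (λ a b c d e f → a :* (b :* c) :* d :* e :* f := a :* f :* (b :* d :* (c :* e))) refl _ _ _ _ _ _)

  prod-sucˡ : ∀ g n → prod g (suc n) ≈ g 0 * prod (g ∘ suc) n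
  prod-sucˡ g zero    = *-comm 1# (g 0)
  prod-sucˡ g (suc n) = trans (*-congʳ (prod-sucˡ g n)) (*-assoc _ _ _)

  module _ (s : ℕ) (0<s : 0 < s) where

    0<s* : ∀ k → 0 < s ℕ.* suc k
    0<s* k = ℕ.≤-trans 0<s (ℕ.m≤m*n s (suc k))

    -- Sorted by index modulo 3, the factors of f_s form the triple product with step 3 s and
    -- residues s and 2 s.
    f-pentagonal : f s ≈ pentagonal s
    f-pentagonal = begin
      f s                                                ≈⟨ f-extend s 0<s (ℕ.m≤m*n D 3) ⟩
      prod g (D ℕ.* 3)                                   ≈⟨ prod-triples g D ⟩
      prod (λ i → g (suc (suc (i ℕ.* 3)))) D * (prod (λ i → g (i ℕ.* 3)) D * prod (λ i → g (suc (i ℕ.* 3))) D)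
        ≈⟨ *-cong (prod-cong (λ i → 1-X (e₃ s i)) D)
                  (*-cong (prod-cong (λ i → +-congˡ (trans (-‿cong (X-≡ (e₁ s i))) (sym (-1*x≈-x _)))) D)
                          (prod-cong (λ i → +-congˡ (trans (-‿cong (X-≡ (e₂ s i))) (sym (-1*x≈-x _)))) D)) ⟩
      _ ≈⟨ TripleProduct.triple-product (s ℕ.* 3) s (s ℕ.* 2) (e₀ s) (0<s* 2) (- 1#) -1*-1≈1
             (λ k → s ℕ.* pent k) (ℕ.*-zeroʳ s) (scale-suc s 3 pent pent-suc)
             (scale-coercive s {pent} 0<s pent-coercive) sgn refl sgn-suc′ ⟩
      pentagonal s ∎
      where
      g = λ i → 1# - X (s ℕ.* suc i)
      e₀ : ∀ s → s ℕ.+ s ℕ.* 2 ≡ s ℕ.* 3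
      e₀ = ℕ-Solver.solve-∀
      e₁ : ∀ s i → s ℕ.* suc (i ℕ.* 3) ≡ s ℕ.* 3 ℕ.* i ℕ.+ s
      e₁ = ℕ-Solver.solve-∀
      e₂ : ∀ s i → s ℕ.* suc (suc (i ℕ.* 3)) ≡ s ℕ.* 3 ℕ.* i ℕ.+ s ℕ.* 2
      e₂ = ℕ-Solver.solve-∀
      e₃ : ∀ s i → s ℕ.* suc (suc (suc (i ℕ.* 3))) ≡ s ℕ.* 3 ℕ.* suc i
      e₃ = ℕ-Solver.solve-∀

    -- Sorting by parity gives f_s = o e with e = f_{2s}, and e o² is the triple product with both
    -- residues equal to s.
    f² : f s * f s ≈ f (s ℕ.* 2) * φ₋ s
    f² = begin
      f s * f s
        ≈⟨ *-cong factor factor ⟩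
      o * e * (o * e)
        ≈⟨ solve 2 (λ o e → o :* e :* (o :* e) := e :* (e :* (o :* o))) refl _ _ ⟩
      e * (e * (o * o))
        ≈⟨ *-congˡ (TripleProduct.triple-product (s ℕ.* 2) s s (e₀ s) (0<s* 1) (- 1#) -1*-1≈1
             (λ k → s ℕ.* sq k) (ℕ.*-zeroʳ s) (scale-suc s 2 sq sq-suc)
             (scale-coercive s {sq} 0<s sq-coercive) sgn refl sgn-suc′) ⟩
      f (s ℕ.* 2) * φ₋ s ∎
      where
      g = λ i → 1# - X (s ℕ.* suc i)
      o = prod (λ i → 1# + - 1# * X (s ℕ.* 2 ℕ.* i ℕ.+ s)) D
      e = f (s ℕ.* 2)
      e₀ : ∀ s → s ℕ.+ s ≡ s ℕ.* 2
      e₀ = ℕ-Solver.solve-∀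
      e₁ : ∀ s i → s ℕ.* suc (i ℕ.* 2) ≡ s ℕ.* 2 ℕ.* i ℕ.+ s
      e₁ = ℕ-Solver.solve-∀
      e₂ : ∀ s i → s ℕ.* suc (suc (i ℕ.* 2)) ≡ s ℕ.* 2 ℕ.* suc i
      e₂ = ℕ-Solver.solve-∀
      factor : f s ≈ o * e
      factor = trans (f-extend s 0<s (ℕ.m≤m*n D 2)) (trans (prod-pairs g D)
        (*-cong (prod-cong (λ i → +-congˡ (trans (-‿cong (X-≡ (e₁ s i))) (sym (-1*x≈-x _)))) D)
                (prod-cong (λ i → 1-X (e₂ s i)) D)))

    -- With residues s and 0 the second product starts with 1 + q^0, the source of the factor two.
    -- What remains is f_s times the product of the 1 + q^(s i) over i ≥ 1, which is f_{2s},
    -- squared.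
    f*Ψ : f s * Ψ s ≈ f (s ℕ.* 2) * f (s ℕ.* 2) + f (s ℕ.* 2) * f (s ℕ.* 2)
    f*Ψ = begin
      f s * Ψ s
        ≈⟨ *-congˡ (sum-cong (box D) (λ k _ → *-identityˡ (X (s ℕ.* tri k)))) ⟨
      f s * sum (box D) (λ k → 1# * X (s ℕ.* tri k))
        ≈⟨ *-congˡ (TripleProduct.triple-product s s 0 (ℕ.+-identityʳ s) 0<s 1# (*-identityˡ 1#)
             (λ k → s ℕ.* tri k) (ℕ.*-zeroʳ s) E-suc
             (scale-coercive s {tri} 0<s tri-coercive) (λ _ → 1#) refl (λ _ → sym (*-identityˡ 1#))) ⟨
      f s * (f s * (prod (λ i → 1# + 1# * X (s ℕ.* i ℕ.+ s)) D * prod (λ i → 1# + 1# * X (s ℕ.* i ℕ.+ 0)) D))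
        ≈⟨ *-congˡ (*-congˡ (*-cong
             (prod-cong (λ i → +-congˡ (trans (*-identityˡ _) (X-≡ (≡.trans (ℕ.+-comm (s ℕ.* i) s) (≡.sym (ℕ.*-suc s i)))))) D)
             (trans (prod-cong (λ i → +-congˡ (trans (*-identityˡ _) (X-≡ (ℕ.+-identityʳ (s ℕ.* i))))) D) shift))) ⟩
      f s * (f s * (p * ((1# + 1#) * p)))
        ≈⟨ solve 3 (λ f p o → f :* (f :* (p :* ((o :+ o) :* p)))
                              := o :* (f :* p :* (f :* p) :+ f :* p :* (f :* p))) refl _ _ _ ⟩
      1# * (f s * p * (f s * p) + f s * p * (f s * p))
        ≈⟨ *-identityˡ _ ⟩
      f s * p * (f s * p) + f s * p * (f s * p)
        ≈⟨ +-cong (*-cong double double) (*-cong double double) ⟩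
      f (s ℕ.* 2) * f (s ℕ.* 2) + f (s ℕ.* 2) * f (s ℕ.* 2) ∎
      where
      p = prod (λ i → 1# + X (s ℕ.* suc i)) D
      E-suc : ∀ k → + (s ℕ.* tri (k ℤ.+ 1ℤ)) ≡ + (s ℕ.* tri k) ℤ.+ (+ s ℤ.* k ℤ.+ + s)
      E-suc k = ≡.trans
        (scale-suc s 1 tri (λ k → ≡.trans (tri-suc k)
          (≡.cong (λ z → + tri k ℤ.+ (z ℤ.+ 1ℤ)) (≡.sym (ℤ.*-identityˡ k)))) k)
        (≡.cong (λ z → + (s ℕ.* tri k) ℤ.+ (+ z ℤ.* k ℤ.+ + s)) (ℕ.*-identityʳ s))
      h = λ i → 1# + X (s ℕ.* i)
      shift : prod h D ≈ (1# + 1#) * p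
      shift = begin
        -- A trivial factor of index D is appended, so that removing the factor of index 0 leaves D
        -- factors again.
        prod h D                 ≈⟨ *-identityʳ _ ⟨
        prod h D * 1#            ≈⟨ *-congˡ (trans (+-congˡ (X-> _ (ℕ.<-≤-trans (ℕ.m≤m+n (suc order) (2 ℕ.+ order))
                                      (ℕ.m≤n*m D s {{ℕ.>-nonZero 0<s}})))) (+-identityʳ 1#)) ⟨
        prod h (suc D)           ≈⟨ prod-sucˡ h D ⟩
        h 0 * p                  ≈⟨ *-congʳ (+-congˡ (trans (X-≡ (ℕ.*-zeroʳ s)) X-0)) ⟩
        (1# + 1#) * p            ∎
      double : f s * p ≈ f (s ℕ.* 2)
      double = trans (sym (prod-* _ _ D)) (prod-cong (λ i → begin
        (1# - X (s ℕ.* suc i)) * (1# + X (s ℕ.* suc i))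
          ≈⟨ solve 2 (λ o x → (o :- x) :* (o :+ x) := o :* o :- x :* x) refl _ _ ⟩
        1# * 1# - X (s ℕ.* suc i) * X (s ℕ.* suc i)
          ≈⟨ +-cong (*-identityˡ 1#) (-‿cong (trans (sym (X-+ _ _)) (X-≡ (e s i)))) ⟩
        1# - X (s ℕ.* 2 ℕ.* suc i) ∎) D)
        where
        e : ∀ s i → s ℕ.* suc i ℕ.+ s ℕ.* suc i ≡ s ℕ.* 2 ℕ.* suc i
        e = ℕ-Solver.solve-∀

-- Cosets of index two and the identities for φ₋² and Ψ²

booleans : List Bool
booleans = false ∷ true ∷ []

booleans-unique : Unique booleans
booleans-unique = ((λ ()) All.∷ All.[]) ∷ All.[] ∷ []

∈-booleans : ∀ b → b ∈ booleans
∈-booleans false = here ≡.refl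
∈-booleans true  = there (here ≡.refl)

-- The two cosets of the sublattice of points whose coordinates have even sum.
diagonals : Bool × ℤ × ℤ → ℤ × ℤ
diagonals (false , a , b) = a ℤ.+ b , a ℤ.- b
diagonals (true  , m , n) = m ℤ.+ n ℤ.+ 1ℤ , m ℤ.- n

sums-≡ : ∀ {w x y z : ℤ} → (w , x) ≡ (y , z) → w ℤ.+ x ≡ y ℤ.+ z
sums-≡ = ≡.cong (uncurry ℤ._+_)

diffs-≡ : ∀ {w x y z : ℤ} → (w , x) ≡ (y , z) → w ℤ.- x ≡ y ℤ.- z
diffs-≡ = ≡.cong (uncurry ℤ._-_)

×-≡ : ∀ {A B : Set} {a a′ : A} {b b′ : B} → a ≡ a′ → b ≡ b′ → (a , b) ≡ (a′ , b′)
×-≡ = ≡.cong₂ _,_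

2≢1 : 2 ≢ 1
2≢1 ()

3≢1 : 3 ≢ 1
3≢1 ()

diagonals-injective : Injective _≡_ _≡_ diagonals
diagonals-injective {false , a , b} {false , c , d} e = ×-≡ ≡.refl (×-≡
  (linear-cancel (+ 2) a c (sums-≡ e) (ring-ℤ (a ∷ b ∷ c ∷ d ∷ [])))
  (linear-cancel (+ 2) b d (diffs-≡ e) (ring-ℤ (a ∷ b ∷ c ∷ d ∷ []))))
diagonals-injective {true , a , b} {true , c , d} e = ×-≡ ≡.refl (×-≡
  (linear-cancel (+ 2) a c (sums-≡ e) (ring-ℤ (a ∷ b ∷ c ∷ d ∷ [])))
  (linear-cancel (+ 2) b d (diffs-≡ e) (ring-ℤ (a ∷ b ∷ c ∷ d ∷ []))))
diagonals-injective {true , a , b} {false , c , d} e = ⊥-elim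
  (linear-absurd (+ 2) (a ℤ.- c) 2≢1 (sums-≡ e) (ring-ℤ (a ∷ b ∷ c ∷ d ∷ [])))
diagonals-injective {false , a , b} {true , c , d} e = ⊥-elim
  (linear-absurd (+ 2) (c ℤ.- a) 2≢1 (≡.sym (sums-≡ e)) (ring-ℤ (a ∷ b ∷ c ∷ d ∷ [])))

diagonals-surjective : ∀ y → ∃[ a ] diagonals a ≡ y
diagonals-surjective (x , y) with parity (x ℤ.+ y)
... | a , inj₁ e = (false , a , x ℤ.- a) , ×-≡
  (ring-ℤ (a ∷ x ∷ []))
  (≡.trans (lemma a x) (≡.trans (≡.cong (ℤ._- x) (≡.sym e)) (lemma′ x y)))
  where
  lemma : ∀ a x → a ℤ.- (x ℤ.- a) ≡ a ℤ.+ a ℤ.- x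
  lemma = solve-∀
  lemma′ : ∀ x y → x ℤ.+ y ℤ.- x ≡ y
  lemma′ = solve-∀
... | m , inj₂ e = (true , m , x ℤ.- m ℤ.- 1ℤ) , ×-≡
  (lemma″ m x)
  (≡.trans (lemma m x) (≡.trans (≡.cong (ℤ._- x) (≡.sym e)) (lemma′ x y)))
  where
  lemma″ : ∀ m x → m ℤ.+ (x ℤ.- m ℤ.- 1ℤ) ℤ.+ 1ℤ ≡ x
  lemma″ = solve-∀
  lemma : ∀ m x → m ℤ.- (x ℤ.- m ℤ.- 1ℤ) ≡ m ℤ.+ m ℤ.+ 1ℤ ℤ.- x
  lemma = solve-∀
  lemma′ : ∀ x y → x ℤ.+ y ℤ.- x ≡ y
  lemma′ = solve-∀

-- The odd coset is the even one followed by y ↦ -1 - y, which preserves triangular numbers. Both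
-- cosets then contribute the same sum, whence the factor two in Ψ².
antidiagonals : Bool × ℤ × ℤ → ℤ × ℤ
antidiagonals (false , u , v) = v ℤ.+ u , v ℤ.- u
antidiagonals (true  , u , v) = v ℤ.+ u , u ℤ.- v ℤ.- 1ℤ

antidiagonals-injective : Injective _≡_ _≡_ antidiagonals
antidiagonals-injective {false , a , b} {false , c , d} e = ×-≡ ≡.refl (×-≡
  (linear-cancel (+ 2) a c (diffs-≡ e) (ring-ℤ (a ∷ b ∷ c ∷ d ∷ [])))
  (linear-cancel (+ 2) b d (sums-≡ e) (ring-ℤ (a ∷ b ∷ c ∷ d ∷ []))))
antidiagonals-injective {true , a , b} {true , c , d} e = ×-≡ ≡.refl (×-≡
  (linear-cancel (+ 2) a c (sums-≡ e) (lemma a b c d))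
  (linear-cancel (+ 2) b d (diffs-≡ e) (lemma′ a b c d)))
  where
  lemma : ∀ a b c d → b ℤ.+ a ℤ.+ (a ℤ.- b ℤ.- 1ℤ) ℤ.- (d ℤ.+ c ℤ.+ (c ℤ.- d ℤ.- 1ℤ)) ≡ + 2 ℤ.* (a ℤ.- c)
  lemma = solve-∀
  lemma′ : ∀ a b c d → b ℤ.+ a ℤ.- (a ℤ.- b ℤ.- 1ℤ) ℤ.- (d ℤ.+ c ℤ.- (c ℤ.- d ℤ.- 1ℤ)) ≡ + 2 ℤ.* (b ℤ.- d)
  lemma′ = solve-∀
antidiagonals-injective {true , a , b} {false , c , d} e = ⊥-elim
  (linear-absurd (+ 2) (d ℤ.- a) 2≢1 (≡.sym (sums-≡ e)) (lemma a b c d))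
  where
  lemma : ∀ a b c d → d ℤ.+ c ℤ.+ (d ℤ.- c) ℤ.- (b ℤ.+ a ℤ.+ (a ℤ.- b ℤ.- 1ℤ)) ≡ + 2 ℤ.* (d ℤ.- a) ℤ.+ 1ℤ
  lemma = solve-∀
antidiagonals-injective {false , a , b} {true , c , d} e = ⊥-elim
  (linear-absurd (+ 2) (b ℤ.- c) 2≢1 (sums-≡ e) (lemma a b c d))
  where
  lemma : ∀ a b c d → b ℤ.+ a ℤ.+ (b ℤ.- a) ℤ.- (d ℤ.+ c ℤ.+ (c ℤ.- d ℤ.- 1ℤ)) ≡ + 2 ℤ.* (b ℤ.- c) ℤ.+ 1ℤ
  lemma = solve-∀

antidiagonals-surjective : ∀ y → ∃[ a ] antidiagonals a ≡ y
antidiagonals-surjective (x , y) with parity (x ℤ.+ y)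
... | v , inj₁ e = (false , x ℤ.- v , v) , ×-≡
  (ring-ℤ (v ∷ x ∷ []))
  (≡.trans (lemma v x) (≡.trans (≡.cong (ℤ._- x) (≡.sym e)) (lemma′ x y)))
  where
  lemma : ∀ a x → a ℤ.- (x ℤ.- a) ≡ a ℤ.+ a ℤ.- x
  lemma = solve-∀
  lemma′ : ∀ x y → x ℤ.+ y ℤ.- x ≡ y
  lemma′ = solve-∀
-- On this coset the coordinates add up to 2 u - 1, so the sum 2 c + 1 gives u = c + 1.
... | c , inj₂ e = (true , c ℤ.+ 1ℤ , x ℤ.- c ℤ.- 1ℤ) , ×-≡
  (lemma″ c x)
  (≡.trans (lemma c x) (≡.trans (≡.cong (ℤ._- x) (≡.sym e)) (lemma′ x y)))
  where
  lemma″ : ∀ m x → x ℤ.- m ℤ.- 1ℤ ℤ.+ (m ℤ.+ 1ℤ) ≡ x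
  lemma″ = solve-∀
  lemma : ∀ m x → m ℤ.+ 1ℤ ℤ.- (x ℤ.- m ℤ.- 1ℤ) ℤ.- 1ℤ ≡ m ℤ.+ m ℤ.+ 1ℤ ℤ.- x
  lemma = solve-∀
  lemma′ : ∀ x y → x ℤ.+ y ℤ.- x ≡ y
  lemma′ = solve-∀

module QuadraticIdentities (S : TruncatedSeriesRing) where
  open Data.Nat using (_≤_; _<_)
  open TruncatedSeriesRing S
  open Sums S
  open ThetaFunctions S
  open import Algebra.Properties.Ring ring using (-1*x≈-x; -‿distribˡ-*)
  open import Relation.Binary.Reasoning.Setoid setoid

  Coercive : (ℤ → ℕ) → Set
  Coercive E = ∀ k → ∣ k ∣ ≤ suc (E k)

  suc-order≤D : suc order ≤ D
  suc-order≤D = ℕ.m≤m+n (suc order) (2 ℕ.+ order)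

  -- The bound is order + 1 and not D: the quintic identity applies it to coordinates that are still
  -- to be doubled.
  near-origin : ∀ {E E′} → Coercive E → Coercive E′ → ∀ c x y {r} → r ≈ c * (X (E x) * X (E′ y)) →
                r ≈ 0# ⊎ (∣ x ∣ ≤ suc order × ∣ y ∣ ≤ suc order)
  near-origin {E} {E′} coercive coercive′ c x y r≈ with E x ℕ.≤? order | E′ y ℕ.≤? order
  ... | yes p | yes q = inj₂ (ℕ.≤-trans (coercive x) (s≤s p) , ℕ.≤-trans (coercive′ y) (s≤s q))
  ... | no ¬p | _     = inj₁ (trans r≈ (trans (*-congˡ (trans (*-congʳ (X-> _ (ℕ.≰⇒> ¬p))) (zeroˡ _))) (zeroʳ c)))
  ... | yes _ | no ¬q = inj₁ (trans r≈ (trans (*-congˡ (trans (*-congˡ (X-> _ (ℕ.≰⇒> ¬q))) (zeroʳ _))) (zeroʳ c)))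

  supported : ∀ {E E′ t} (c : ℤ → ℤ → Carrier) → Coercive E → Coercive E′ →
              (∀ x y → t (x , y) ≈ c x y * (X (E x) * X (E′ y))) → Supported t
  supported {E} {E′} c coercive coercive′ t≈ (x , y) with near-origin {E} {E′} coercive coercive′ (c x y) x y (t≈ x y)
  ... | inj₁ z       = inj₁ z
  ... | inj₂ (p , q) = inj₂ (∈-plane (ℕ.≤-trans p suc-order≤D) (ℕ.≤-trans q suc-order≤D))

  sum-booleans : (F : Bool → Carrier) → sum booleans F ≈ F false + F true
  sum-booleans F = +-congˡ (+-identityʳ _)

  sum-scaled : ∀ {t : ℤ × ℤ → Carrier} c (E E′ : ℤ → ℕ) → (∀ x y → t (x , y) ≈ c * (X (E x) * X (E′ y))) →
               sum plane t ≈ c * (sum (box D) (X ∘ E) * sum (box D) (X ∘ E′))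
  sum-scaled c E E′ t≈ = trans (sum-cong plane (λ (x , y) _ → t≈ x y))
    (trans (sum-*ˡ plane c (λ (x , y) → X (E x) * X (E′ y))) (*-congˡ (sym (sum-*-sum (box D) (box D) _ _))))

  X-* : ∀ {m n k l} → m ℕ.+ n ≡ k ℕ.+ l → X m * X n ≈ X k * X l
  X-* e = trans (sym (X-+ _ _)) (trans (X-≡ e) (X-+ _ _))

  X-*₃ : ∀ {m n j k l} → m ℕ.+ n ≡ j ℕ.+ (k ℕ.+ l) → X m * X n ≈ X j * (X k * X l)
  X-*₃ {j = j} {k} {l} e = trans (X-* e) (*-congˡ (X-+ k l))

  module _ (s : ℕ) (0<s : 0 < s) where

    coercive : ∀ k {E} → Coercive E → Coercive (λ x → s ℕ.* suc k ℕ.* E x)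
    coercive k {E} = scale-coercive (s ℕ.* suc k) {E} (0<s* s 0<s k)

    -- The sign (-1)^(x + y) is constant on each coset of the lattice of even coordinate sum, so it
    -- disappears from the theta series of the parts and survives only as the minus sign of the odd
    -- coset.
    φ₋² : φ₋ s * φ₋ s ≈ φ (s ℕ.* 2) * φ (s ℕ.* 2) - X s * (Ψ (s ℕ.* 4) * Ψ (s ℕ.* 4))
    φ₋² = begin
      φ₋ s * φ₋ s
        ≈⟨ sum-*-sum (box D) (box D) _ _ ⟩
      sum plane t
        ≈⟨ sum-partition booleans booleans-unique ∈-booleans diagonals diagonals-injective diagonals-surjective t
             (supported {s*sq} {s*sq} (λ x y → sgn x * sgn y) (scale-coercive s {sq} 0<s sq-coercive)
               (scale-coercive s {sq} 0<s sq-coercive)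
               (λ x y → *-interchange _ _ _ _))
             (λ { false → supported {λ a → s ℕ.* 2 ℕ.* sq a} {λ a → s ℕ.* 2 ℕ.* sq a} (λ _ _ → 1#)
                            (coercive 1 {sq} sq-coercive) (coercive 1 {sq} sq-coercive) even
                ; true  → supported {λ a → s ℕ.* 4 ℕ.* tri a} {λ a → s ℕ.* 4 ℕ.* tri a} (λ _ _ → - X s)
                            (coercive 3 {tri} tri-coercive) (coercive 3 {tri} tri-coercive) odd }) ⟨
      sum booleans (λ b → sum plane (λ p → t (diagonals (b , p))))
        ≈⟨ sum-booleans (λ b → sum plane (λ p → t (diagonals (b , p)))) ⟩
      sum plane (λ p → t (diagonals (false , p))) + sum plane (λ p → t (diagonals (true , p)))
        ≈⟨ +-cong (sum-scaled 1# (λ a → s ℕ.* 2 ℕ.* sq a) (λ a → s ℕ.* 2 ℕ.* sq a) even)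
                  (sum-scaled (- X s) (λ a → s ℕ.* 4 ℕ.* tri a) (λ a → s ℕ.* 4 ℕ.* tri a) odd) ⟩
      1# * (φ (s ℕ.* 2) * φ (s ℕ.* 2)) + - X s * (Ψ (s ℕ.* 4) * Ψ (s ℕ.* 4))
        ≈⟨ +-cong (*-identityˡ _) (sym (-‿distribˡ-* _ _)) ⟩
      φ (s ℕ.* 2) * φ (s ℕ.* 2) - X s * (Ψ (s ℕ.* 4) * Ψ (s ℕ.* 4)) ∎
      where
      s*sq : ℤ → ℕ
      s*sq a = s ℕ.* sq a
      t : ℤ × ℤ → Carrier
      t (x , y) = sgn x * X (s*sq x) * (sgn y * X (s*sq y))
      factor : ∀ s x y a b → x ℕ.+ y ≡ 2 ℕ.* a ℕ.+ 2 ℕ.* b → s ℕ.* x ℕ.+ s ℕ.* y ≡ s ℕ.* 2 ℕ.* a ℕ.+ s ℕ.* 2 ℕ.* b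
      factor s x y a b e = ≡.trans (≡.sym (ℕ.*-distribˡ-+ s x y)) (≡.trans (≡.cong (s ℕ.*_) e) (lemma s a b))
        where
        lemma : ∀ s a b → s ℕ.* (2 ℕ.* a ℕ.+ 2 ℕ.* b) ≡ s ℕ.* 2 ℕ.* a ℕ.+ s ℕ.* 2 ℕ.* b
        lemma = ℕ-Solver.solve-∀
      factor′ : ∀ s x y a b → x ℕ.+ y ≡ 1 ℕ.+ (4 ℕ.* a ℕ.+ 4 ℕ.* b) →
                s ℕ.* x ℕ.+ s ℕ.* y ≡ s ℕ.+ (s ℕ.* 4 ℕ.* a ℕ.+ s ℕ.* 4 ℕ.* b)
      factor′ s x y a b e = ≡.trans (≡.sym (ℕ.*-distribˡ-+ s x y)) (≡.trans (≡.cong (s ℕ.*_) e) (lemma s a b))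
        where
        lemma : ∀ s a b → s ℕ.* (1 ℕ.+ (4 ℕ.* a ℕ.+ 4 ℕ.* b)) ≡ s ℕ.+ (s ℕ.* 4 ℕ.* a ℕ.+ s ℕ.* 4 ℕ.* b)
        lemma = ℕ-Solver.solve-∀
      regroup : ∀ x y → t (x , y) ≈ sgn (x ℤ.+ y) * (X (s*sq x) * X (s*sq y))
      regroup x y = trans (*-interchange _ _ _ _)
        (*-congʳ (sym (sgn-+ x y)))
      even : ∀ a b → t (a ℤ.+ b , a ℤ.- b) ≈ 1# * (X (s ℕ.* 2 ℕ.* sq a) * X (s ℕ.* 2 ℕ.* sq b))
      even a b = trans (regroup (a ℤ.+ b) (a ℤ.- b)) (*-cong
        (trans (reflexive (≡.cong sgn (lemma a b))) (sgn-even a))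
        (X-* (factor s (sq (a ℤ.+ b)) (sq (a ℤ.- b)) (sq a) (sq b) (sq-diagonals a b))))
        where
        lemma : ∀ a b → a ℤ.+ b ℤ.+ (a ℤ.- b) ≡ a ℤ.+ a
        lemma = solve-∀
      odd : ∀ m n → t (m ℤ.+ n ℤ.+ 1ℤ , m ℤ.- n) ≈ - X s * (X (s ℕ.* 4 ℕ.* tri m) * X (s ℕ.* 4 ℕ.* tri n))
      odd m n = trans (regroup (m ℤ.+ n ℤ.+ 1ℤ) (m ℤ.- n)) (trans (*-cong
        (trans (reflexive (≡.cong sgn (lemma m n))) (sgn-odd m))
        (X-*₃ (factor′ s (sq (m ℤ.+ n ℤ.+ 1ℤ)) (sq (m ℤ.- n)) (tri m) (tri n) (sq-diagonals-odd m n))))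
        (trans (sym (*-assoc _ _ _)) (*-congʳ (-1*x≈-x (X s)))))
        where
        lemma : ∀ m n → m ℤ.+ n ℤ.+ 1ℤ ℤ.+ (m ℤ.- n) ≡ m ℤ.+ m ℤ.+ 1ℤ
        lemma = solve-∀

    Ψ² : Ψ s * Ψ s ≈ φ s * Ψ (s ℕ.* 2) + φ s * Ψ (s ℕ.* 2)
    Ψ² = begin
      Ψ s * Ψ s
        ≈⟨ sum-*-sum (box D) (box D) _ _ ⟩
      sum plane t
        ≈⟨ sum-partition booleans booleans-unique ∈-booleans antidiagonals antidiagonals-injective antidiagonals-surjective t
             (supported {s*tri} {s*tri} (λ x y → 1#) (scale-coercive s {tri} 0<s tri-coercive)
               (scale-coercive s {tri} 0<s tri-coercive)
               (λ x y → sym (*-identityˡ _)))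
             (λ { false → supported {s*sq} {2s*tri} (λ _ _ → 1#)
                            (scale-coercive s {sq} 0<s sq-coercive) (coercive 1 {tri} tri-coercive) even
                ; true  → supported {s*sq} {2s*tri} (λ _ _ → 1#)
                            (scale-coercive s {sq} 0<s sq-coercive) (coercive 1 {tri} tri-coercive) odd }) ⟨
      sum booleans (λ b → sum plane (λ p → t (antidiagonals (b , p))))
        ≈⟨ sum-booleans (λ b → sum plane (λ p → t (antidiagonals (b , p)))) ⟩
      sum plane (λ p → t (antidiagonals (false , p))) + sum plane (λ p → t (antidiagonals (true , p)))
        ≈⟨ +-cong (trans (sum-scaled 1# s*sq 2s*tri even) (*-identityˡ _))
                  (trans (sum-scaled 1# s*sq 2s*tri odd) (*-identityˡ _)) ⟩
      φ s * Ψ (s ℕ.* 2) + φ s * Ψ (s ℕ.* 2) ∎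
      where
      s*sq s*tri 2s*tri : ℤ → ℕ
      s*sq a = s ℕ.* sq a
      s*tri a = s ℕ.* tri a
      2s*tri a = s ℕ.* 2 ℕ.* tri a
      t : ℤ × ℤ → Carrier
      t (x , y) = X (s*tri x) * X (s*tri y)
      factor : ∀ s x y a b → x ℕ.+ y ≡ a ℕ.+ 2 ℕ.* b → s ℕ.* x ℕ.+ s ℕ.* y ≡ s ℕ.* a ℕ.+ s ℕ.* 2 ℕ.* b
      factor s x y a b e = ≡.trans (≡.sym (ℕ.*-distribˡ-+ s x y)) (≡.trans (≡.cong (s ℕ.*_) e) (lemma s a b))
        where
        lemma : ∀ s a b → s ℕ.* (a ℕ.+ 2 ℕ.* b) ≡ s ℕ.* a ℕ.+ s ℕ.* 2 ℕ.* b
        lemma = ℕ-Solver.solve-∀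
      even : ∀ u v → t (v ℤ.+ u , v ℤ.- u) ≈ 1# * (X (s*sq u) * X (2s*tri v))
      even u v = trans (X-* (factor s (tri (v ℤ.+ u)) (tri (v ℤ.- u)) (sq u) (tri v)
        (tri-diagonals (v ℤ.+ u) (v ℤ.- u) u v (lemma u v)))) (sym (*-identityˡ _))
        where
        lemma : ∀ u v → (v ℤ.+ u) ℤ.* (v ℤ.+ u ℤ.+ 1ℤ) ℤ.+ (v ℤ.- u) ℤ.* (v ℤ.- u ℤ.+ 1ℤ)
                        ≡ + 2 ℤ.* (u ℤ.* u) ℤ.+ + 2 ℤ.* (v ℤ.* (v ℤ.+ 1ℤ))
        lemma = solve-∀
      odd : ∀ u v → t (v ℤ.+ u , u ℤ.- v ℤ.- 1ℤ) ≈ 1# * (X (s*sq u) * X (2s*tri v))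
      odd u v = trans (X-* (factor s (tri (v ℤ.+ u)) (tri (u ℤ.- v ℤ.- 1ℤ)) (sq u) (tri v)
        (tri-diagonals (v ℤ.+ u) (u ℤ.- v ℤ.- 1ℤ) u v (lemma u v)))) (sym (*-identityˡ _))
        where
        lemma : ∀ u v → (v ℤ.+ u) ℤ.* (v ℤ.+ u ℤ.+ 1ℤ) ℤ.+ (u ℤ.- v ℤ.- 1ℤ) ℤ.* (u ℤ.- v ℤ.- 1ℤ ℤ.+ 1ℤ)
                        ≡ + 2 ℤ.* (u ℤ.* u) ℤ.+ + 2 ℤ.* (v ℤ.* (v ℤ.+ 1ℤ))
        lemma = solve-∀

-- The identity for f_s f_{5s}

firsts-≡ : ∀ {w x y z : ℤ} → (w , x) ≡ (y , z) → w ≡ y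
firsts-≡ = ≡.cong proj₁

seconds-≡ : ∀ {w x y z : ℤ} → (w , x) ≡ (y , z) → x ≡ z
seconds-≡ = ≡.cong proj₂

combine-≡ : ∀ k l {w x y z : ℤ} → (w , x) ≡ (y , z) → k ℤ.* w ℤ.- l ℤ.* x ≡ k ℤ.* y ℤ.- l ℤ.* z
combine-≡ k l = ≡.cong (λ (x , y) → k ℤ.* x ℤ.- l ℤ.* y)

-- Through u = 2 c + 1 - v, pairs (c, v) correspond to pairs (u, v) of opposite parity. The two
-- cases are (2 m + 1, 2 n) and (2 u, 2 m + 1), where the form u² + 5 v² is diagonal in the new
-- coordinates.
parities : Bool × ℤ × ℤ → ℤ × ℤ
parities (false , m , n) = m ℤ.+ n , n ℤ.+ n
parities (true  , u , m) = u ℤ.+ m , m ℤ.+ m ℤ.+ 1ℤ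

parities-injective : Injective _≡_ _≡_ parities
parities-injective {false , a , b} {false , c , d} e = ×-≡ ≡.refl (×-≡
  (linear-cancel (+ 2) a c (combine-≡ (+ 2) 1ℤ e) (ring-ℤ (a ∷ b ∷ c ∷ d ∷ [])))
  (linear-cancel (+ 2) b d (seconds-≡ e) (ring-ℤ (b ∷ d ∷ []))))
parities-injective {true , a , b} {true , c , d} e = ×-≡ ≡.refl (×-≡
  (linear-cancel (+ 2) a c (combine-≡ (+ 2) 1ℤ e) (ring-ℤ (a ∷ b ∷ c ∷ d ∷ [])))
  (linear-cancel (+ 2) b d (seconds-≡ e) (ring-ℤ (b ∷ d ∷ []))))
parities-injective {true , a , b} {false , c , d} e = ⊥-elim
  (linear-absurd (+ 2) (b ℤ.- d) 2≢1 (seconds-≡ e) (ring-ℤ (b ∷ d ∷ [])))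
parities-injective {false , a , b} {true , c , d} e = ⊥-elim
  (linear-absurd (+ 2) (d ℤ.- b) 2≢1 (seconds-≡ (≡.sym e)) (ring-ℤ (b ∷ d ∷ [])))

parities-surjective : ∀ y → ∃[ a ] parities a ≡ y
parities-surjective (c , v) with parity v
... | n , inj₁ ≡.refl = (false , c ℤ.- n , n) , ×-≡ (lemma c n) ≡.refl
  where
  lemma : ∀ c n → c ℤ.- n ℤ.+ n ≡ c
  lemma = solve-∀
... | n , inj₂ ≡.refl = (true , c ℤ.- n , n) , ×-≡ (lemma c n) ≡.refl
  where
  lemma : ∀ c n → c ℤ.- n ℤ.+ n ≡ c
  lemma = solve-∀

-- With x = 6 a − 1 and y = 6 b − 1, the first two maps send x + y √−5 to ±(x + y √−5) / (1 + √−5) = u + v √−5;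
-- the terms in the third one cancel in pairs under reflection.
thirds : Fin 3 × ℤ × ℤ → ℤ × ℤ
thirds (0F , a , b) = + 3 ℤ.* b ℤ.- 1ℤ , b ℤ.- a
thirds (1F , a , b) = + 3 ℤ.* ℤ.- b , a ℤ.- b
thirds (2F , d , v) = + 3 ℤ.* d ℤ.+ 1ℤ , v

residues : List (Fin 3)
residues = 0F ∷ 1F ∷ 2F ∷ []

residues-unique : Unique residues
residues-unique = ((λ ()) All.∷ (λ ()) All.∷ All.[]) ∷ ((λ ()) All.∷ All.[]) ∷ All.[] ∷ []

∈-residues : ∀ i → i ∈ residues
∈-residues 0F = here ≡.refl
∈-residues 1F = there (here ≡.refl)
∈-residues 2F = there (there (here ≡.refl))

thirds-injective : Injective _≡_ _≡_ thirds
thirds-injective {0F , a , b} {0F , c , d} e = ×-≡ ≡.refl (×-≡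
  (linear-cancel (+ 3) a c (combine-≡ 1ℤ (+ 3) e) (ring-ℤ (a ∷ b ∷ c ∷ d ∷ [])))
  (linear-cancel (+ 3) b d (firsts-≡ e) (ring-ℤ (b ∷ d ∷ []))))
thirds-injective {1F , a , b} {1F , c , d} e = ×-≡ ≡.refl (×-≡
  (linear-cancel -[1+ 2 ] a c (combine-≡ 1ℤ (+ 3) e) (ring-ℤ (a ∷ b ∷ c ∷ d ∷ [])))
  (linear-cancel -[1+ 2 ] b d (firsts-≡ e) (ring-ℤ (b ∷ d ∷ []))))
thirds-injective {2F , a , b} {2F , c , d} e = ×-≡ ≡.refl (×-≡
  (linear-cancel (+ 3) a c (firsts-≡ e) (ring-ℤ (a ∷ c ∷ [])))
  (seconds-≡ e))
thirds-injective {0F , a , b} {1F , c , d} e = ⊥-elim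
  (linear-absurd (+ 3) (ℤ.- d ℤ.- b) 3≢1 (firsts-≡ (≡.sym e)) (ring-ℤ (b ∷ d ∷ [])))
thirds-injective {1F , a , b} {0F , c , d} e = ⊥-elim
  (linear-absurd (+ 3) (ℤ.- b ℤ.- d) 3≢1 (firsts-≡ e) (ring-ℤ (b ∷ d ∷ [])))
thirds-injective {0F , a , b} {2F , c , d} e = ⊥-elim
  (linear-absurd (+ 3) (b ℤ.- c ℤ.- 1ℤ) 3≢1 (firsts-≡ e) (lemma b c))
  where
  lemma : ∀ b c → + 3 ℤ.* b ℤ.- 1ℤ ℤ.- (+ 3 ℤ.* c ℤ.+ 1ℤ) ≡ + 3 ℤ.* (b ℤ.- c ℤ.- 1ℤ) ℤ.+ 1ℤ
  lemma = solve-∀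
thirds-injective {2F , a , b} {0F , c , d} e = ⊥-elim
  (linear-absurd (+ 3) (d ℤ.- a ℤ.- 1ℤ) 3≢1 (firsts-≡ (≡.sym e)) (lemma d a))
  where
  lemma : ∀ b c → + 3 ℤ.* b ℤ.- 1ℤ ℤ.- (+ 3 ℤ.* c ℤ.+ 1ℤ) ≡ + 3 ℤ.* (b ℤ.- c ℤ.- 1ℤ) ℤ.+ 1ℤ
  lemma = solve-∀
thirds-injective {1F , a , b} {2F , c , d} e = ⊥-elim
  (linear-absurd (+ 3) (c ℤ.+ b) 3≢1 (firsts-≡ (≡.sym e)) (ring-ℤ (b ∷ c ∷ [])))
thirds-injective {2F , a , b} {1F , c , d} e = ⊥-elim
  (linear-absurd (+ 3) (a ℤ.+ d) 3≢1 (firsts-≡ e) (ring-ℤ (a ∷ d ∷ [])))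

thirds-surjective : ∀ y → ∃[ a ] thirds a ≡ y
thirds-surjective (c , v) with residue₃ c
... | n , inj₁ ≡.refl = (1F , v ℤ.- n , ℤ.- n) , ×-≡ (lemma n) (lemma′ v n)
  where
  lemma : ∀ n → + 3 ℤ.* ℤ.- (ℤ.- n) ≡ + 3 ℤ.* n
  lemma = solve-∀
  lemma′ : ∀ v n → v ℤ.- n ℤ.- (ℤ.- n) ≡ v
  lemma′ = solve-∀
... | n , inj₂ (inj₁ ≡.refl) = (2F , n , v) , ≡.refl
... | n , inj₂ (inj₂ ≡.refl) = (0F , n ℤ.- v , n) , ×-≡ ≡.refl (lemma n v)
  where
  lemma : ∀ n v → n ℤ.- (n ℤ.- v) ≡ v
  lemma = solve-∀

reflection : ℤ × ℤ → ℤ × ℤ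
reflection (d , v) = d , d ℤ.+ d ℤ.+ 1ℤ ℤ.- v

reflection-involutive : ∀ p → reflection (reflection p) ≡ p
reflection-involutive (d , v) = ×-≡ ≡.refl (lemma d v)
  where
  lemma : ∀ d v → d ℤ.+ d ℤ.+ 1ℤ ℤ.- (d ℤ.+ d ℤ.+ 1ℤ ℤ.- v) ≡ v
  lemma = solve-∀

∣d∣≤∣3d+1∣ : ∀ d → ∣ d ∣ ℕ.≤ ∣ + 3 ℤ.* d ℤ.+ 1ℤ ∣
∣d∣≤∣3d+1∣ (+ n) = ℕ.≤-trans (ℕ.m≤n*m n 3) (ℕ.≤-trans (ℕ.m≤m+n (3 ℕ.* n) 1)
  (ℕ.≤-reflexive (≡.cong (λ z → ∣ z ℤ.+ 1ℤ ∣) (ℤ.pos-* 3 n))))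
∣d∣≤∣3d+1∣ -[1+ n ] = ℕ.≤-trans (s≤s (ℕ.m≤n⇒m≤1+n (ℕ.m≤n*m n 3)))
  (ℕ.≤-reflexive (≡.sym (≡.cong ∣_∣ (≡.trans (lemma (+ n))
    (≡.cong (λ z → ℤ.- (+ 2 ℤ.+ z)) (≡.sym (ℤ.pos-* 3 n)))))))
  where
  lemma : ∀ n → + 3 ℤ.* (ℤ.- (1ℤ ℤ.+ n)) ℤ.+ 1ℤ ≡ ℤ.- (+ 2 ℤ.+ + 3 ℤ.* n)
  lemma = solve-∀

module QuinticIdentity (S : TruncatedSeriesRing) where
  open Data.Nat using (_≤_; _<_)
  open TruncatedSeriesRing S
  open Sums S
  open ThetaFunctions S
  open QuadraticIdentities S
  open import Algebra.Properties.Ring ring using (-1*x≈-x; -‿distribˡ-*)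
  open import Relation.Binary.Reasoning.Setoid setoid

  -- `form` is defined as an integer, and its nonnegativity becomes visible only in the coset
  -- coordinates; the value at negative integers is a default that no value of `form` reaches.
  Xℤ : ℤ → Carrier
  Xℤ (+ n)    = X n
  Xℤ -[1+ _ ] = 0#

  module _ (s : ℕ) (0<s : 0 < s) where

    -- The double sum of this term is evaluated twice: by the parity of v it gives the theta side,
    -- by the residue of c modulo 3 the eta side.
    w : ℤ × ℤ → Carrier
    w (c , v) = sgn v * Xℤ (+ s ℤ.* form c v)

    Xℤ-form : ∀ c v {n} → form c v ≡ + n → Xℤ (+ s ℤ.* form c v) ≈ X (s ℕ.* n)
    Xℤ-form c v {n} e = reflexive (≡.cong Xℤ (≡.trans (≡.cong (+ s ℤ.*_) e) (≡.sym (ℤ.pos-* s n))))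

    w-even : ∀ m n → w (m ℤ.+ n , n ℤ.+ n) ≈ 1# * (X (s ℕ.* 2 ℕ.* tri m) * X (s ℕ.* 5 ℕ.* sq n))
    w-even m n = *-cong (sgn-even n) (trans (Xℤ-form (m ℤ.+ n) (n ℤ.+ n) (form-even m n))
      (trans (X-≡ (lemma s (tri m) (sq n))) (X-+ _ _)))
      where
      lemma : ∀ s x y → s ℕ.* (2 ℕ.* x ℕ.+ 5 ℕ.* y) ≡ s ℕ.* 2 ℕ.* x ℕ.+ s ℕ.* 5 ℕ.* y
      lemma = ℕ-Solver.solve-∀

    w-odd : ∀ u m → w (u ℤ.+ m , m ℤ.+ m ℤ.+ 1ℤ) ≈ - X s * (X (s ℕ.* sq u) * X (s ℕ.* 10 ℕ.* tri m))
    w-odd u m = trans (*-cong (sgn-odd m) (trans (Xℤ-form (u ℤ.+ m) (m ℤ.+ m ℤ.+ 1ℤ) (form-odd u m))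
      (trans (X-≡ (lemma s (sq u) (tri m))) (trans (X-+ _ _) (*-congˡ (X-+ _ _))))))
      (trans (sym (*-assoc _ _ _)) (*-congʳ (-1*x≈-x (X s))))
      where
      lemma : ∀ s x y → s ℕ.* (1 ℕ.+ (x ℕ.+ 10 ℕ.* y)) ≡ s ℕ.+ (s ℕ.* x ℕ.+ s ℕ.* 10 ℕ.* y)
      lemma = ℕ-Solver.solve-∀

    -- The mixed term c v in `form` hides its growth, so the bound is taken in the diagonal
    -- coordinates of `parities` and carried back. The worst case is v = 2 m + 1, of size at most 2
    -- (order + 1) + 1, which is exactly D.
    w-near : ∀ c v → w (c , v) ≈ 0# ⊎ (∣ c ∣ ≤ D × ∣ v ∣ ≤ D)
    w-near c v with parities-surjective (c , v)
    ... | (false , m , n) , ≡.refl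
          with near-origin {λ m → s ℕ.* 2 ℕ.* tri m} {λ n → s ℕ.* 5 ℕ.* sq n}
                 (coercive s 0<s 1 {tri} tri-coercive) (coercive s 0<s 4 {sq} sq-coercive) 1# m n (w-even m n)
    ...   | inj₁ z       = inj₁ z
    ...   | inj₂ (p , q) = inj₂ (double≤D m n p q , double≤D n n q q)
      where
      double≤D : ∀ x y → ∣ x ∣ ≤ suc order → ∣ y ∣ ≤ suc order → ∣ x ℤ.+ y ∣ ≤ D
      double≤D x y p q = ℕ.≤-trans (ℤ.∣i+j∣≤∣i∣+∣j∣ x y) (ℕ.+-mono-≤ p (ℕ.m≤n⇒m≤1+n q))
    w-near c v | (true , u , m) , ≡.refl
          with near-origin {λ u → s ℕ.* sq u} {λ m → s ℕ.* 10 ℕ.* tri m}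
                 (scale-coercive s {sq} 0<s sq-coercive) (coercive s 0<s 9 {tri} tri-coercive) (- X s) u m (w-odd u m)
    ...   | inj₁ z       = inj₁ z
    ...   | inj₂ (p , q) = inj₂
      ( ℕ.≤-trans (ℤ.∣i+j∣≤∣i∣+∣j∣ u m) (ℕ.+-mono-≤ p (ℕ.m≤n⇒m≤1+n q))
      , ℕ.≤-trans (ℤ.∣i+j∣≤∣i∣+∣j∣ (m ℤ.+ m) 1ℤ) (ℕ.≤-trans (ℕ.+-monoˡ-≤ 1 (ℤ.∣i+j∣≤∣i∣+∣j∣ m m))
          (ℕ.≤-trans (ℕ.+-monoˡ-≤ 1 (ℕ.+-mono-≤ q q)) (ℕ.≤-reflexive (lemma order)))))
      where
      lemma : ∀ n → suc n ℕ.+ suc n ℕ.+ 1 ≡ suc n ℕ.+ (2 ℕ.+ n)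
      lemma = ℕ-Solver.solve-∀

    w-supported : Supported w
    w-supported (c , v) with w-near c v
    ... | inj₁ z       = inj₁ z
    ... | inj₂ (p , q) = inj₂ (∈-plane p q)

    sum-w-parities : sum plane w ≈ Ψ (s ℕ.* 2) * φ (s ℕ.* 5) - X s * (φ s * Ψ (s ℕ.* 10))
    sum-w-parities = begin
      sum plane w
        ≈⟨ sum-partition booleans booleans-unique ∈-booleans parities parities-injective parities-surjective w w-supported
             (λ { false → supported {λ m → s ℕ.* 2 ℕ.* tri m} {λ n → s ℕ.* 5 ℕ.* sq n} (λ _ _ → 1#)
                            (coercive s 0<s 1 {tri} tri-coercive) (coercive s 0<s 4 {sq} sq-coercive) w-even
                ; true  → supported {λ u → s ℕ.* sq u} {λ m → s ℕ.* 10 ℕ.* tri m} (λ _ _ → - X s)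
                            (scale-coercive s {sq} 0<s sq-coercive) (coercive s 0<s 9 {tri} tri-coercive) w-odd }) ⟨
      sum booleans (λ b → sum plane (λ p → w (parities (b , p))))
        ≈⟨ sum-booleans (λ b → sum plane (λ p → w (parities (b , p)))) ⟩
      sum plane (λ p → w (parities (false , p))) + sum plane (λ p → w (parities (true , p)))
        ≈⟨ +-cong (trans (sum-scaled 1# (λ m → s ℕ.* 2 ℕ.* tri m) (λ n → s ℕ.* 5 ℕ.* sq n) w-even) (*-identityˡ _))
                  (trans (sum-scaled (- X s) (λ u → s ℕ.* sq u) (λ m → s ℕ.* 10 ℕ.* tri m) w-odd) (sym (-‿distribˡ-* _ _))) ⟩
      Ψ (s ℕ.* 2) * φ (s ℕ.* 5) - X s * (φ s * Ψ (s ℕ.* 10)) ∎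

    signed-pentagonal : ℤ × ℤ → Carrier
    signed-pentagonal (a , b) = sgn a * X (s ℕ.* pent a) * (sgn b * X (s ℕ.* 5 ℕ.* pent b))

    w-pentagonal : ∀ c v a b → sgn v ≈ sgn a * sgn b → form c v ≡ + (pent a ℕ.+ 5 ℕ.* pent b) →
                   w (c , v) ≈ signed-pentagonal (a , b)
    w-pentagonal c v a b sign e = trans
      (*-cong sign (trans (Xℤ-form c v e) (trans (X-≡ (lemma s (pent a) (pent b))) (X-+ _ _))))
      (*-interchange _ _ _ _)
      where
      lemma : ∀ s x y → s ℕ.* (x ℕ.+ 5 ℕ.* y) ≡ s ℕ.* x ℕ.+ s ℕ.* 5 ℕ.* y
      lemma = ℕ-Solver.solve-∀

    w-third₀ : ∀ a b → w (thirds (0F , a , b)) ≈ signed-pentagonal (a , b)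
    w-third₀ a b = w-pentagonal (+ 3 ℤ.* b ℤ.- 1ℤ) (b ℤ.- a) a b
      (trans (sgn-sub b a) (*-comm _ _)) (form-pent₁ a b)

    w-third₁ : ∀ a b → w (thirds (1F , a , b)) ≈ signed-pentagonal (a , b)
    w-third₁ a b = w-pentagonal (+ 3 ℤ.* ℤ.- b) (a ℤ.- b) a b (sgn-sub a b) (form-pent₂ a b)

    pentagonal-supported : ∀ {t : ℤ × ℤ → Carrier} → (∀ a b → t (a , b) ≈ signed-pentagonal (a , b)) → Supported t
    pentagonal-supported t≈ = supported {λ a → s ℕ.* pent a} {λ b → s ℕ.* 5 ℕ.* pent b} (λ a b → sgn a * sgn b)
      (scale-coercive s {pent} 0<s pent-coercive) (coercive s 0<s 4 {pent} pent-coercive)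
      (λ a b → trans (t≈ a b) (*-interchange _ _ _ _))

    sum-pentagonal : ∀ {t : ℤ × ℤ → Carrier} → (∀ a b → t (a , b) ≈ signed-pentagonal (a , b)) →
                     sum plane t ≈ f s * f (s ℕ.* 5)
    sum-pentagonal t≈ = trans (sum-cong plane (λ (a , b) _ → t≈ a b)) (trans (sym (sum-*-sum (box D) (box D) _ _))
      (sym (*-cong (f-pentagonal s 0<s) (f-pentagonal (s ℕ.* 5) (0<s* s 0<s 4)))))

    w₂ : ℤ × ℤ → Carrier
    w₂ p = w (thirds (2F , p))

    w₂-supported : Supported w₂
    w₂-supported (d , v) with w-near (+ 3 ℤ.* d ℤ.+ 1ℤ) v
    ... | inj₁ z       = inj₁ z
    ... | inj₂ (p , q) = inj₂ (∈-plane (ℕ.≤-trans (∣d∣≤∣3d+1∣ d) p) q)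

    w₂-reflection : ∀ p → w₂ (reflection p) ≈ - 1# * w₂ p
    w₂-reflection (d , v) = trans (*-cong (trans (sgn-sub (d ℤ.+ d ℤ.+ 1ℤ) v) (*-congʳ (sgn-odd d)))
      (reflexive (≡.cong (λ z → Xℤ (+ s ℤ.* z)) (form-reflect d v)))) (*-assoc _ _ _)

    -- The reflection preserves the exponent and changes v by an odd number up to sign, so it
    -- reverses the sign of each term. The sum equals its own negative, and there is no 2-torsion.
    sum-w₂ : sum plane w₂ ≈ 0#
    sum-w₂ = x+x≈0⇒x≈0 _ (begin
      sum plane w₂ + sum plane w₂
        ≈⟨ +-congʳ (sum-reindex (≡-dec ℤ._≟_ ℤ._≟_) plane-unique plane-unique reflection
             (λ {p} {q} e → ≡.trans (≡.sym (reflection-involutive p))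
               (≡.trans (≡.cong reflection e) (reflection-involutive q)))
             w₂ (λ p → w₂-supported (reflection p)) onto) ⟨
      sum plane (w₂ ∘ reflection) + sum plane w₂
        ≈⟨ +-congʳ (trans (sum-cong plane (λ p _ → w₂-reflection p)) (sum-*ˡ plane (- 1#) w₂)) ⟩
      - 1# * sum plane w₂ + sum plane w₂
        ≈⟨ +-congʳ (-1*x≈-x _) ⟩
      - sum plane w₂ + sum plane w₂
        ≈⟨ -‿inverseˡ _ ⟩
      0# ∎)
      where
      onto : ∀ p → w₂ p ≈ 0# ⊎ (∃[ q ] q ∈ plane × reflection q ≡ p)
      -- The reflection may leave the box. A point whose mirror image lies outside has a vanishing
      -- term, because the mirror term vanishes and the two are opposite.
      onto p with w₂-supported (reflection p)
      ... | inj₂ m = inj₂ (reflection p , m , reflection-involutive p)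
      ... | inj₁ z = inj₁ (begin
        w₂ p                          ≡⟨ ≡.cong w₂ (reflection-involutive p) ⟨
        w₂ (reflection (reflection p)) ≈⟨ w₂-reflection (reflection p) ⟩
        - 1# * w₂ (reflection p)      ≈⟨ *-congˡ z ⟩
        - 1# * 0#                     ≈⟨ zeroʳ _ ⟩
        0#                            ∎)

    sum-w-thirds : sum plane w ≈ f s * f (s ℕ.* 5) + f s * f (s ℕ.* 5)
    sum-w-thirds = begin
      sum plane w
        ≈⟨ sum-partition residues residues-unique ∈-residues thirds thirds-injective thirds-surjective w w-supported
             (λ { 0F → pentagonal-supported w-third₀ ; 1F → pentagonal-supported w-third₁ ; 2F → w₂-supported }) ⟨
      sum residues (λ i → sum plane (λ p → w (thirds (i , p))))
        ≈⟨ +-cong (sum-pentagonal w-third₀) (+-cong (sum-pentagonal w-third₁) (trans (+-identityʳ _) sum-w₂)) ⟩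
      f s * f (s ℕ.* 5) + (f s * f (s ℕ.* 5) + 0#)
        ≈⟨ +-congˡ (+-identityʳ _) ⟩
      f s * f (s ℕ.* 5) + f s * f (s ℕ.* 5) ∎

    f*f₅ : f s * f (s ℕ.* 5) + f s * f (s ℕ.* 5) ≈ Ψ (s ℕ.* 2) * φ (s ℕ.* 5) - X s * (φ s * Ψ (s ℕ.* 10))
    f*f₅ = trans (sym sum-w-thirds) sum-w-parities

-- The 2-dissection of F_1

module EtaQuotient (S : TruncatedSeriesRing) where
  open Data.Nat using (_≤_; _<_)
  open TruncatedSeriesRing S
  open Sums S
  open ThetaFunctions S
  open QuadraticIdentities S
  open QuinticIdentity S
  open import Relation.Binary.Reasoning.Setoid setoid

  ⟦_⟧ : ℤ → Carrier
  ⟦_⟧ = _-Raw-AlmostCommutative⟶_.⟦_⟧ scalars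

  infix 10 _⁴
  _⁴ : Carrier → Carrier
  x ⁴ = x * x * (x * x)

  F : ℕ → Carrier
  F s = f s ⁴ * f (s ℕ.* 5) ⁴

  -- The factor q⁶ is the product of q and q⁵, the coefficients of the Ψ terms in φ₋_1² and φ₋_5².
  evenPart : Carrier
  evenPart = f 2 * f 2 * (f 10 * f 10) * (φ 2 * φ 2 * (φ 10 * φ 10) + X 6 * (Ψ 4 * Ψ 4 * (Ψ 20 * Ψ 20)))

  -- Doubled because the cross term of the completed square enters F_1 with half of Ψ_2² Ψ_10².
  F-dissection : F 1 + F 1 ≈ evenPart + evenPart - X 1 * (⟦ + 8 ⟧ * F 2 + ⟦ + 16 ⟧ * (X 2 * F 4))
  F-dissection = begin
    F 1 + F 1
      ≈⟨ +-cong F-1 F-1 ⟩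
    b * (u₁ - X 1 * v₁) * (u₂ - X 5 * v₂) + b * (u₁ - X 1 * v₁) * (u₂ - X 5 * v₂)
      ≈⟨ solve 7 (λ b u₁ v₁ u₂ v₂ x y → b :* (u₁ :- x :* v₁) :* (u₂ :- y :* v₂) :+ b :* (u₁ :- x :* v₁) :* (u₂ :- y :* v₂)
           := b :* (u₁ :* u₂ :+ x :* y :* (v₁ :* v₂)) :+ b :* (u₁ :* u₂ :+ x :* y :* (v₁ :* v₂))
              :- b :* (con (+ 2) :* (x :* (v₁ :* u₂) :+ y :* (u₁ :* v₂)))) refl b u₁ v₁ u₂ v₂ (X 1) (X 5) ⟩
    b * (u₁ * u₂ + X 1 * X 5 * (v₁ * v₂)) + b * (u₁ * u₂ + X 1 * X 5 * (v₁ * v₂))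
      - b * (⟦ + 2 ⟧ * (X 1 * (v₁ * u₂) + X 5 * (u₁ * v₂)))
      ≈⟨ +-cong (+-cong Y Y) (-‿cong (*-congˡ (*-congˡ (+-congˡ (*-congʳ X-5))))) ⟩
    evenPart + evenPart - b * (⟦ + 2 ⟧ * (X 1 * (v₁ * u₂) + X 1 * (X 2 * X 2) * (u₁ * v₂)))
      ≈⟨ +-congˡ (-‿cong odd) ⟩
    evenPart + evenPart - X 1 * (⟦ + 8 ⟧ * F 2 + ⟦ + 16 ⟧ * (X 2 * F 4)) ∎
    where
    0<1+ : ∀ n → 0 < suc n
    0<1+ n = s≤s z≤n
    b = f 2 * f 2 * (f 10 * f 10)
    u₁ = φ 2 * φ 2
    v₁ = Ψ 4 * Ψ 4
    u₂ = φ 10 * φ 10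
    v₂ = Ψ 20 * Ψ 20
    X-5 : X 5 ≈ X 1 * (X 2 * X 2)
    X-5 = trans (X-+ 1 4) (*-congˡ (X-+ 2 2))
    Y : b * (u₁ * u₂ + X 1 * X 5 * (v₁ * v₂)) ≈ evenPart
    Y = *-congˡ (+-congˡ (*-congʳ (sym (X-+ 1 5))))
    F-1 : F 1 ≈ b * (u₁ - X 1 * v₁) * (u₂ - X 5 * v₂)
    F-1 = begin
      F 1
        ≈⟨ *-cong (*-cong (f² 1 (0<1+ 0)) (f² 1 (0<1+ 0))) (*-cong (f² 5 (0<1+ 4)) (f² 5 (0<1+ 4))) ⟩
      f 2 * φ₋ 1 * (f 2 * φ₋ 1) * (f 10 * φ₋ 5 * (f 10 * φ₋ 5))
        ≈⟨ solve 4 (λ a b c d → a :* b :* (a :* b) :* (c :* d :* (c :* d)) := a :* a :* (c :* c) :* (b :* b) :* (d :* d))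
             refl (f 2) (φ₋ 1) (f 10) (φ₋ 5) ⟩
      b * (φ₋ 1 * φ₋ 1) * (φ₋ 5 * φ₋ 5)
        ≈⟨ *-cong (*-congˡ (φ₋² 1 (0<1+ 0))) (φ₋² 5 (0<1+ 4)) ⟩
      b * (u₁ - X 1 * v₁) * (u₂ - X 5 * v₂) ∎
    g = f 2 * f 10 + f 2 * f 10
    h₁ = φ 2 * Ψ 4 + φ 2 * Ψ 4
    h₂ = φ 10 * Ψ 20 + φ 10 * Ψ 20
    k₁ = f 4 * f 4 + f 4 * f 4
    k₂ = f 20 * f 20 + f 20 * f 20
    odd : b * (⟦ + 2 ⟧ * (X 1 * (v₁ * u₂) + X 1 * (X 2 * X 2) * (u₁ * v₂))) ≈ X 1 * (⟦ + 8 ⟧ * F 2 + ⟦ + 16 ⟧ * (X 2 * F 4))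
    odd = begin
      b * (⟦ + 2 ⟧ * (X 1 * (v₁ * u₂) + X 1 * (X 2 * X 2) * (u₁ * v₂)))
        -- Completes the square: ψ² φ′² + y² φ² ψ′² = (ψ φ′ - y φ ψ′)² + 2 y φ ψ φ′ ψ′. The cross
        -- term, doubled by the leading 2, is written with the doubled products that `Ψ²` supplies.
        ≈⟨ solve 7 (λ b x y φ φ′ ψ ψ′ →
             b :* (con (+ 2) :* (x :* (ψ :* ψ :* (φ′ :* φ′)) :+ x :* (y :* y) :* (φ :* φ :* (ψ′ :* ψ′))))
             := x :* (con (+ 2) :* b :* ((ψ :* φ′ :- y :* (φ :* ψ′)) :* (ψ :* φ′ :- y :* (φ :* ψ′)))
                      :+ y :* (b :* ((φ :* ψ :+ φ :* ψ) :* (φ′ :* ψ′ :+ φ′ :* ψ′)))))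
             refl b (X 1) (X 2) (φ 2) (φ 10) (Ψ 4) (Ψ 20) ⟩
      X 1 * (⟦ + 2 ⟧ * b * ((Ψ 4 * φ 10 - X 2 * (φ 2 * Ψ 20)) * (Ψ 4 * φ 10 - X 2 * (φ 2 * Ψ 20))) + X 2 * (b * (h₁ * h₂)))
        ≈⟨ *-congˡ (+-cong (*-congˡ (*-cong (f*f₅ 2 (0<1+ 1)) (f*f₅ 2 (0<1+ 1))))
                           (*-congˡ (*-congˡ (*-cong (Ψ² 2 (0<1+ 1)) (Ψ² 10 (0<1+ 9)))))) ⟨
      X 1 * (⟦ + 2 ⟧ * b * (g * g) + X 2 * (b * (Ψ 2 * Ψ 2 * (Ψ 10 * Ψ 10))))
        ≈⟨ *-congˡ (+-cong
             (solve 2 (λ a c → con (+ 2) :* (a :* a :* (c :* c)) :* ((a :* c :+ a :* c) :* (a :* c :+ a :* c))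
                               := con (+ 8) :* (a :* a :* (a :* a) :* (c :* c :* (c :* c)))) refl (f 2) (f 10))
             (*-congˡ (solve 4 (λ a c p q → a :* a :* (c :* c) :* (p :* p :* (q :* q))
                                            := a :* p :* (a :* p) :* (c :* q :* (c :* q)))
                         refl (f 2) (f 10) (Ψ 2) (Ψ 10)))) ⟩
      X 1 * (⟦ + 8 ⟧ * F 2 + X 2 * (f 2 * Ψ 2 * (f 2 * Ψ 2) * (f 10 * Ψ 10 * (f 10 * Ψ 10))))
        ≈⟨ *-congˡ (+-congˡ (*-congˡ (*-cong (*-cong (f*Ψ 2 (0<1+ 1)) (f*Ψ 2 (0<1+ 1)))
                                             (*-cong (f*Ψ 10 (0<1+ 9)) (f*Ψ 10 (0<1+ 9)))))) ⟩
      X 1 * (⟦ + 8 ⟧ * F 2 + X 2 * (k₁ * k₁ * (k₂ * k₂)))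
        ≈⟨ *-congˡ (+-congˡ (solve 3 (λ y a c →
             y :* ((a :* a :+ a :* a) :* (a :* a :+ a :* a) :* ((c :* c :+ c :* c) :* (c :* c :+ c :* c)))
             := con (+ 16) :* (y :* (a :* a :* (a :* a) :* (c :* c :* (c :* c))))) refl (X 2) (f 4) (f 20))) ⟩
      X 1 * (⟦ + 8 ⟧ * F 2 + ⟦ + 16 ⟧ * (X 2 * F 4)) ∎

-- The substitution q ↦ q² and even series

module Dissection where
  open Data.Nat using (_≤_; _<_)
  open Data.Integer using (_+_; _*_; _-_; -_)
  open ≡ using (refl; sym; trans; cong; cong₂)
  open PowerSeries

  seriesRing : ℕ → TruncatedSeriesRing
  seriesRing N = record
    { order           = N
    ; commutativeRing = truncated N
    ; scalars         = constants N
    ; X               = mono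
    ; X-0             = λ _ _ → refl
    ; X-+             = λ m n i _ → sym (conv-mono m n i)
    ; X->             = λ n N<n i i≤N → mono-< n i (ℕ.≤-<-trans i≤N N<n)
    ; x+x≈0⇒x≈0       = λ f f+f≈0 i i≤N → halve (f+f≈0 i i≤N)
    }

  -- f(q) ↦ f(q²)
  spread : Series → Series
  spread f zero          = f 0
  spread f (suc zero)    = 0ℤ
  spread f (suc (suc i)) = spread (f ∘ suc) i

  spread-cong : ∀ i {f g} → (∀ j → j ≤ i → f j ≡ g j) → spread f i ≡ spread g i
  spread-cong zero          p = p 0 z≤n
  spread-cong (suc zero)    p = refl
  spread-cong (suc (suc i)) p = spread-cong i (λ j j≤i → p (suc j) (s≤s (ℕ.m≤n⇒m≤1+n j≤i)))

  spread-even : ∀ f n → spread f (n ℕ.+ n) ≡ f n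
  spread-even f zero    = refl
  spread-even f (suc n) rewrite ℕ.+-suc n n = spread-even (f ∘ suc) n

  spread-odd : ∀ f n → spread f (suc (n ℕ.+ n)) ≡ 0ℤ
  spread-odd f zero    = refl
  spread-odd f (suc n) rewrite ℕ.+-suc n n = spread-odd (f ∘ suc) n

  spread-+ : ∀ f g i → spread (λ j → f j + g j) i ≡ spread f i + spread g i
  spread-+ f g zero          = refl
  spread-+ f g (suc zero)    = refl
  spread-+ f g (suc (suc i)) = spread-+ (f ∘ suc) (g ∘ suc) i

  spread-neg : ∀ f i → spread (λ j → - f j) i ≡ - spread f i
  spread-neg f zero          = refl
  spread-neg f (suc zero)    = refl
  spread-neg f (suc (suc i)) = spread-neg (f ∘ suc) i

  spread-scale : ∀ c f i → spread (λ j → c * f j) i ≡ c * spread f i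
  spread-scale c f zero          = refl
  spread-scale c f (suc zero)    = sym (ℤ.*-zeroʳ c)
  spread-scale c f (suc (suc i)) = spread-scale c (f ∘ suc) i

  spread-0 : ∀ i → spread (λ _ → 0ℤ) i ≡ 0ℤ
  spread-0 zero          = refl
  spread-0 (suc zero)    = refl
  spread-0 (suc (suc i)) = spread-0 i

  spread-conv : ∀ f g i → spread (conv f g) i ≡ conv (spread f) (spread g) i
  spread-conv f g zero          = refl
  spread-conv f g (suc zero)    = sym (trans (ℤ.+-identityʳ _) (ℤ.*-zeroʳ (f 0)))
  spread-conv f g (suc (suc i)) = trans
    (spread-+ (λ j → f 0 * g (suc j)) (conv (f ∘ suc) g) i)
    (cong₂ _+_ (spread-scale (f 0) (g ∘ suc) i)
               (trans (spread-conv (f ∘ suc) g i) (sym (ℤ.+-identityˡ _))))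

  spread-mono : ∀ m i → spread (mono m) i ≡ mono (m ℕ.+ m) i
  spread-mono zero    zero          = refl
  spread-mono zero    (suc zero)    = refl
  spread-mono zero    (suc (suc i)) = spread-0 i
  spread-mono (suc m) i rewrite ℕ.+-suc m m = shift i
    where
    shift : ∀ i → spread (mono (suc m)) i ≡ mono (suc (suc (m ℕ.+ m))) i
    shift zero          = refl
    shift (suc zero)    = refl
    shift (suc (suc i)) = spread-mono m i

  -- Evenness is carried by a preimage under `spread`, so that closure under products is just the
  -- multiplicativity of `spread`.
  Even : Series → Set
  Even f = ∃[ g ] spread g ≗ f

  even-odd : ∀ {f} → Even f → ∀ n → f (suc (n ℕ.+ n)) ≡ 0ℤ
  even-odd (g , e) n = trans (sym (e _)) (spread-odd g n)

  even-0 : Even (λ _ → 0ℤ)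
  even-0 = (λ _ → 0ℤ) , spread-0

  even-mono : ∀ {m} n → n ℕ.+ n ≡ m → Even (mono m)
  even-mono n refl = mono n , spread-mono n

  even-+ : ∀ {f g} → Even f → Even g → Even (λ i → f i + g i)
  even-+ (f′ , p) (g′ , q) = _ , λ i → trans (spread-+ f′ g′ i) (cong₂ _+_ (p i) (q i))

  even-neg : ∀ {f} → Even f → Even (λ i → - f i)
  even-neg (f′ , p) = _ , λ i → trans (spread-neg f′ i) (cong -_ (p i))

  even-conv : ∀ {f g} → Even f → Even g → Even (conv f g)
  even-conv (f′ , p) (g′ , q) = conv f′ g′ , λ i → trans (spread-conv f′ g′ i)
    (conv-cong i (λ j _ → p j) (λ j _ → q j))

  even-one : Even one
  even-one = even-mono 0 refl

  module _ (N : ℕ) where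
    open Sums (seriesRing N)
    open JacobiTripleProduct (seriesRing N)
    open ThetaFunctions (seriesRing N)
    open EtaQuotient (seriesRing N)

    even-sum : {A : Set} (xs : List A) {t : A → Series} → (∀ x → Even (t x)) → Even (sum xs t)
    even-sum []       p = even-0
    even-sum (x ∷ xs) p = even-+ (p x) (even-sum xs p)

    even-prod : ∀ {g : ℕ → Series} → (∀ i → Even (g i)) → ∀ n → Even (prod g n)
    even-prod p zero    = even-one
    even-prod p (suc n) = even-conv (even-prod p n) (p n)

    even-scaled : ∀ s n → Even (mono ((s ℕ.+ s) ℕ.* n))
    even-scaled s n = even-mono (s ℕ.* n) (sym (ℕ.*-distribʳ-+ n s s))

    even-square : ∀ {f} → Even f → Even (conv f f)
    even-square e = even-conv e e

    even-f : ∀ s → Even (f (s ℕ.+ s))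
    even-f s = even-prod (λ i → even-+ even-one (even-neg (even-scaled s (suc i)))) D

    even-φ : ∀ s → Even (φ (s ℕ.+ s))
    even-φ s = even-sum (box D) (λ k → even-scaled s (sq k))

    even-Ψ : ∀ s → Even (Ψ (s ℕ.+ s))
    even-Ψ s = even-sum (box D) (λ k → even-scaled s (tri k))

    even-evenPart : Even evenPart
    even-evenPart = even-conv
      (even-conv (even-square (even-f 1)) (even-square (even-f 5)))
      (even-+ (even-conv (even-square (even-φ 1)) (even-square (even-φ 5)))
              (even-conv (even-mono 3 refl) (even-conv (even-square (even-Ψ 2)) (even-square (even-Ψ 10)))))

    spread-prod : ∀ {g h : ℕ → Series} → (∀ i → spread (g i) ≗ h i) → ∀ n → spread (prod g n) ≗ prod h n
    spread-prod         p zero    i = spread-mono 0 i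
    spread-prod {g} {h} p (suc n) i = trans (spread-conv (prod g n) (g n) i)
      (conv-cong i (λ j _ → spread-prod p n j) (λ j _ → p n j))

    spread-f : ∀ s → spread (f s) ≗ f (s ℕ.* 2)
    spread-f s = spread-prod (λ i j → trans (spread-+ one _ j) (cong₂ _+_ (spread-mono 0 j)
      (trans (spread-neg (mono (s ℕ.* suc i)) j)
        (cong -_ (trans (spread-mono (s ℕ.* suc i) j) (cong (λ m → mono m j) (lemma s i))))))) D
      where
      lemma : ∀ s i → s ℕ.* suc i ℕ.+ s ℕ.* suc i ≡ s ℕ.* 2 ℕ.* suc i
      lemma = ℕ-Solver.solve-∀

    spread-⁴ : ∀ {f g} → spread f ≗ g → spread (f ⁴) ≗ g ⁴
    spread-⁴ {f} {g} p i = trans (spread-conv (conv f f) (conv f f) i) (conv-cong i (λ j _ → square j) (λ j _ → square j))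
      where
      square : spread (conv f f) ≗ conv g g
      square i = trans (spread-conv f f i) (conv-cong i (λ j _ → p j) (λ j _ → p j))

    -- An equality of all coefficients: both sides are built from products of the same length D, and
    -- `spread` respects products without truncation.
    spread-F : ∀ s → spread (F s) ≗ F (s ℕ.* 2)
    spread-F s i = trans (spread-conv (f s ⁴) (f (s ℕ.* 5) ⁴) i) (conv-cong i
      (λ j _ → spread-⁴ (spread-f s) j)
      (λ j _ → spread-⁴ (λ k → trans (spread-f (s ℕ.* 5) k) (cong (λ t → f t k) (lemma s))) j))
      where
      lemma : ∀ s → s ℕ.* 5 ℕ.* 2 ≡ s ℕ.* 2 ℕ.* 5
      lemma = ℕ-Solver.solve-∀

    mulOneMinusQ-conv : ∀ m g → mulOneMinusQ m g ≗ conv (λ j → one j + - mono m j) g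
    mulOneMinusQ-conv m g i = trans (cases m i) (sym (trans (conv-distribʳ one (λ j → - mono m j) g i)
      (cong₂ _+_ (conv-identityˡ g i) (negate m g i))))
      where
      negate : ∀ m g i → conv (λ j → - mono m j) g i ≡ - conv (mono m) g i
      negate m g zero    = sym (ℤ.neg-distribˡ-* (mono m 0) (g 0))
      negate m g (suc i) = trans (conv-cong (suc i) (λ j _ → sym (ℤ.-1*i≡-i (mono m j))) (λ _ _ → refl))
        (trans (conv-scaleˡ (- 1ℤ) (mono m) g (suc i)) (ℤ.-1*i≡-i _))
      shift : ∀ m g i → m ≤ i → conv (mono m) g i ≡ g (i ℕ.∸ m)
      shift zero    g i       _         = conv-identityˡ g i
      shift (suc m) g (suc i) (s≤s m≤i) = trans (conv-mono-suc m g i) (shift m g i m≤i)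
      vanish : ∀ m g i → i < m → conv (mono m) g i ≡ 0ℤ
      vanish (suc m) g zero    _         = refl
      vanish (suc m) g (suc i) (s≤s i<m) = trans (conv-mono-suc m g i) (vanish m g i i<m)
      cases : ∀ m i → mulOneMinusQ m g i ≡ g i + - conv (mono m) g i
      cases m i with m ℕ.≤? i
      ... | yes m≤i = cong (λ z → g i - z) (sym (shift m g i m≤i))
      ... | no  m≰i = sym (trans (cong (λ z → g i - z) (vanish m g i (ℕ.≰⇒> m≰i))) (ℤ.+-identityʳ (g i)))

-- From products to coefficients: the recurrence

module Coefficients where
  open Data.Nat using (_≤_; _<_)
  open Data.Integer using (_+_; _*_; _-_; -_)
  open ≡ using (refl; sym; trans; cong; cong₂)
  open PowerSeries
  open Dissection

  mulOneMinusQ-< : ∀ {m i} g → i < m → mulOneMinusQ m g i ≡ g i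
  mulOneMinusQ-< {m} {i} g i<m with m ℕ.≤? i
  ... | yes m≤i = ⊥-elim (ℕ.<⇒≱ i<m m≤i)
  ... | no  _   = refl

  mul4-< : ∀ {m i} g → i < m → mul4 m g i ≡ g i
  mul4-< g i<m = trans (mulOneMinusQ-< _ i<m) (trans (mulOneMinusQ-< _ i<m)
    (trans (mulOneMinusQ-< _ i<m) (mulOneMinusQ-< g i<m)))

  partialProd-stable : ∀ {i n} → i ≤ n → partialProd n i ≡ PstarN i
  partialProd-stable p = go (ℕ.≤⇒≤′ p)
    where
    go : ∀ {i n} → i ℕ.≤′ n → partialProd n i ≡ PstarN i
    go (ℕ.≤′-reflexive refl) = refl
    go (ℕ.≤′-step {n} i≤′n)  = trans (mul4-< _ (s≤s i≤n))
      (trans (mul4-< _ (ℕ.≤-trans (s≤s i≤n) (ℕ.m≤n*m (suc n) 5))) (go i≤′n))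
      where i≤n = ℕ.≤′⇒≤ i≤′n

  module _ (N : ℕ) where
    open TruncatedSeriesRing (seriesRing N)
      using (Carrier; _≈_; setoid; *-cong; *-congʳ; *-congˡ; X; 1#; *-comm)
      renaming (_*_ to _·_; _-_ to _⊝_; trans to ≈-trans; sym to ≈-sym; refl to ≈-refl; reflexive to ≈-reflexive)
    open Sums (seriesRing N)
    open JacobiTripleProduct (seriesRing N)
    open ThetaFunctions (seriesRing N)
    open EtaQuotient (seriesRing N)
    open import Relation.Binary.Reasoning.Setoid setoid

    mul4-⁴ : ∀ m g → mul4 m g ≈ (1# ⊝ X m) ⁴ · g
    mul4-⁴ m g = begin
      mul4 m g
        ≈⟨ ≈-trans (step _) (*-congˡ (≈-trans (step _) (*-congˡ (≈-trans (step _) (*-congˡ (step g)))))) ⟩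
      h · (h · (h · (h · g))) ≈⟨ solve 2 (λ h g → h :* (h :* (h :* (h :* g))) := h :* h :* (h :* h) :* g) ≈-refl h g ⟩
      h ⁴ · g             ∎
      where
      h = 1# ⊝ X m
      step : ∀ g → mulOneMinusQ m g ≈ h · g
      step g i _ = mulOneMinusQ-conv N m g i

    prod-⁴ : ∀ g n → prod (λ i → g i ⁴) n ≈ prod g n ⁴
    prod-⁴ g n = ≈-trans (prod-* (λ i → g i · g i) (λ i → g i · g i) n)
      (*-cong (prod-* g g n) (prod-* g g n))

    partialProd-prod : ∀ n → partialProd n ≈ prod (λ i → (1# ⊝ X (1 ℕ.* suc i)) ⁴ · (1# ⊝ X (5 ℕ.* suc i)) ⁴) n
    partialProd-prod zero    = ≈-refl
    partialProd-prod (suc n) = begin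
      mul4 (suc n) (mul4 (5 ℕ.* suc n) (partialProd n))
        ≈⟨ ≈-trans (mul4-⁴ (suc n) _) (*-congˡ (mul4-⁴ (5 ℕ.* suc n) _)) ⟩
      a · (b · partialProd n)
        ≈⟨ *-cong (≈-reflexive (cong (λ m → (1# ⊝ X m) ⁴) (sym (ℕ.*-identityˡ (suc n)))))
                  (*-congˡ (partialProd-prod n)) ⟩
      a′ · (b · p)
        ≈⟨ solve 3 (λ a b p → a :* (b :* p) := p :* (a :* b)) ≈-refl a′ b p ⟩
      p · (a′ · b) ∎
      where
      a = (1# ⊝ X (suc n)) ⁴
      a′ = (1# ⊝ X (1 ℕ.* suc n)) ⁴
      b = (1# ⊝ X (5 ℕ.* suc n)) ⁴
      p = prod (λ i → (1# ⊝ X (1 ℕ.* suc i)) ⁴ · (1# ⊝ X (5 ℕ.* suc i)) ⁴) n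

    PstarN-F : ∀ {i} → i ≤ N → F 1 i ≡ PstarN i
    PstarN-F {i} i≤N = trans (≈-sym product i i≤N) (partialProd-stable (ℕ.≤-trans i≤N order≤D))
      where
      product : partialProd D ≈ F 1
      product = ≈-trans (partialProd-prod D) (≈-trans
        (prod-* (λ i → (1# ⊝ X (1 ℕ.* suc i)) ⁴) (λ i → (1# ⊝ X (5 ℕ.* suc i)) ⁴) D)
        (*-cong (prod-⁴ (λ i → 1# ⊝ X (1 ℕ.* suc i)) D) (prod-⁴ (λ i → 1# ⊝ X (5 ℕ.* suc i)) D)))

  conv-mono-1 : ∀ g i → conv (mono 1) g (suc i) ≡ g i
  conv-mono-1 g i = trans (conv-mono-suc 0 g i) (conv-identityˡ g i)

  conv-mono-2 : ∀ g i → conv (mono 2) g (suc (suc i)) ≡ g i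
  conv-mono-2 g i = trans (conv-mono-suc 1 g (suc i)) (conv-mono-1 g i)

  -- The coefficients of q f(q²).
  shift-spread : Series → Series
  shift-spread f zero    = 0ℤ
  shift-spread f (suc n) = spread f n

  -- The coefficient of q^(2 n + 1) in the dissection. The even part drops out, the factor q moves
  -- the index to 2 n, and F_2 and F_4, as spreads of F_1, lead back to the coefficients of index n
  -- and (n - 1) / 2, the latter only for odd n.
  PstarN-recurrence : ∀ n → PstarN (suc (n ℕ.+ n)) ≡ - + 4 * PstarN n - + 8 * shift-spread PstarN n
  PstarN-recurrence n = halve (begin
    PstarN N + PstarN N
      ≡⟨ cong₂ _+_ (PstarN-F N ℕ.≤-refl) (PstarN-F N ℕ.≤-refl) ⟨
    F N 1 N + F N 1 N
      ≡⟨ F-dissection N N ℕ.≤-refl ⟩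
    evenPart N N + evenPart N N - conv (mono 1) odd N
      ≡⟨ cong₂ (λ x y → x + x - y) (even-odd (even-evenPart N) n) (conv-mono-1 odd (n ℕ.+ n)) ⟩
    0ℤ + 0ℤ - odd (n ℕ.+ n)
      ≡⟨ cong (λ x → 0ℤ + 0ℤ - x) (cong₂ _+_ (trans (conv-constantˡ (+ 8) (F N 2) (n ℕ.+ n)) (cong (+ 8 *_) F₂))
           (trans (conv-constantˡ (+ 16) (conv (mono 2) (F N 4)) (n ℕ.+ n)) (cong (+ 16 *_) (F₄ n n≤N)))) ⟩
    0ℤ + 0ℤ - (+ 8 * PstarN n + + 16 * shift-spread PstarN n)
      ≡⟨ lemma (PstarN n) (shift-spread PstarN n) ⟩
    - + 4 * PstarN n - + 8 * shift-spread PstarN n + (- + 4 * PstarN n - + 8 * shift-spread PstarN n) ∎)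
    where
    open ≡.≡-Reasoning
    -- The truncation order is exactly the index of the coefficient being read.
    N = suc (n ℕ.+ n)
    n≤N : n ≤ N
    n≤N = ℕ.m≤n⇒m≤1+n (ℕ.m≤m+n n n)
    F : ∀ N → ℕ → Series
    F N = EtaQuotient.F (seriesRing N)
    F-dissection : ∀ N → _
    F-dissection N = EtaQuotient.F-dissection (seriesRing N)
    evenPart : ∀ N → Series
    evenPart N = EtaQuotient.evenPart (seriesRing N)
    odd : Series
    odd j = conv (constant (+ 8)) (F N 2) j + conv (constant (+ 16)) (conv (mono 2) (F N 4)) j
    F₂ : F N 2 (n ℕ.+ n) ≡ PstarN n
    F₂ = trans (sym (spread-F N 1 (n ℕ.+ n))) (trans (spread-even (F N 1) n) (PstarN-F N n≤N))
    F₄ : ∀ n → n ≤ N → conv (mono 2) (F N 4) (n ℕ.+ n) ≡ shift-spread PstarN n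
    F₄ zero    _    = refl
    F₄ (suc m) 1+m≤N rewrite ℕ.+-suc m m = begin
      conv (mono 2) (F N 4) (suc (suc (m ℕ.+ m)))  ≡⟨ conv-mono-2 (F N 4) (m ℕ.+ m) ⟩
      F N 4 (m ℕ.+ m)                              ≡⟨ spread-F N 2 (m ℕ.+ m) ⟨
      spread (F N 2) (m ℕ.+ m)                     ≡⟨ spread-even (F N 2) m ⟩
      F N 2 m                                      ≡⟨ spread-F N 1 m ⟨
      spread (F N 1) m
        ≡⟨ spread-cong m (λ j j≤m → PstarN-F N (ℕ.≤-trans j≤m (ℕ.<⇒≤ 1+m≤N))) ⟩
      spread PstarN m                              ∎
    lemma : ∀ x y → 0ℤ + 0ℤ - (+ 8 * x + + 16 * y) ≡ - + 4 * x - + 8 * y + (- + 4 * x - + 8 * y)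
    lemma = solve-∀

  -- The coefficients of q f₁⁴ f₅⁴.
  a : ℕ → ℤ
  a zero    = 0ℤ
  a (suc n) = PstarN n

  Pstar-a : ∀ m → Pstar (+ m - + 1) ≡ a m
  Pstar-a zero    = refl
  Pstar-a (suc m) = refl

  a-4* : ∀ r → a (4 ℕ.* r) ≡ - + 4 * a (2 ℕ.* r) - + 8 * a r
  a-4* zero    = refl
  a-4* (suc r) = begin
    a (4 ℕ.* suc r)                                          ≡⟨ cong a (index r) ⟩
    PstarN (suc (n ℕ.+ n))                                   ≡⟨ PstarN-recurrence n ⟩
    - + 4 * PstarN n - + 8 * spread PstarN (r ℕ.+ r)
      ≡⟨ cong₂ (λ x y → - + 4 * x - + 8 * y) (cong a (sym (index′ r))) (spread-even PstarN r) ⟩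
    - + 4 * a (2 ℕ.* suc r) - + 8 * a (suc r)                ∎
    where
    open ≡.≡-Reasoning
    n = suc (r ℕ.+ r)
    index : ∀ r → 4 ℕ.* suc r ≡ suc (suc (suc (r ℕ.+ r) ℕ.+ suc (r ℕ.+ r)))
    index = ℕ-Solver.solve-∀
    index′ : ∀ r → 2 ℕ.* suc r ≡ suc (suc (r ℕ.+ r))
    index′ = ℕ-Solver.solve-∀

  a-2*odd : ∀ r → a (2 ℕ.* suc (2 ℕ.* r)) ≡ - + 4 * a (suc (2 ℕ.* r))
  a-2*odd r = begin
    a (2 ℕ.* suc (2 ℕ.* r))                                        ≡⟨ cong a (index r) ⟩
    PstarN (suc (2 ℕ.* r ℕ.+ 2 ℕ.* r))                             ≡⟨ PstarN-recurrence (2 ℕ.* r) ⟩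
    - + 4 * PstarN (2 ℕ.* r) - + 8 * shift-spread PstarN (2 ℕ.* r)
      ≡⟨ cong (λ x → - + 4 * PstarN (2 ℕ.* r) - + 8 * x) (vanish r) ⟩
    - + 4 * PstarN (2 ℕ.* r) - + 8 * 0ℤ                            ≡⟨ ℤ.+-identityʳ _ ⟩
    - + 4 * a (suc (2 ℕ.* r))                                      ∎
    where
    open ≡.≡-Reasoning
    index : ∀ r → 2 ℕ.* suc (2 ℕ.* r) ≡ suc (suc (2 ℕ.* r ℕ.+ 2 ℕ.* r))
    index = ℕ-Solver.solve-∀
    vanish : ∀ r → shift-spread PstarN (2 ℕ.* r) ≡ 0ℤ
    vanish zero    = refl
    vanish (suc r) = trans (cong (spread PstarN) (lemma r)) (spread-odd PstarN r)
      where
      lemma : ∀ r → r ℕ.+ suc (r ℕ.+ 0) ≡ suc (r ℕ.+ r)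
      lemma = ℕ-Solver.solve-∀

-- Powers of two and the congruences

open Coefficients
open import Data.Integer using (_+_; _-_; _*_; -_; _^_; _≤_; -1ℤ; -≤-)
open ≡ using (refl; sym; trans; cong; cong₂)

-- For odd o the sequence a(2^j o) starts like a(o), -4 a(o), as if preceded by 0. Hence it is
-- proportional to ρ^(j + 1) - ρ̄^(j + 1) with ρ = -2 + 2 i, a root of x² + 4 x + 8, and it vanishes
-- at j = 3 because ρ⁴ is real.
a-8*odd : ∀ r → a (8 ℕ.* suc (2 ℕ.* r)) ≡ 0ℤ
a-8*odd r = begin
  a (8 ℕ.* o)                                                                ≡⟨ cong a (regroup o) ⟩
  a (4 ℕ.* (2 ℕ.* o))                                                        ≡⟨ a-4* (2 ℕ.* o) ⟩
  - + 4 * a (2 ℕ.* (2 ℕ.* o)) - + 8 * a (2 ℕ.* o)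
    ≡⟨ cong (λ z → - + 4 * z - + 8 * a (2 ℕ.* o)) (trans (cong a (regroup′ o)) (a-4* o)) ⟩
  - + 4 * (- + 4 * a (2 ℕ.* o) - + 8 * a o) - + 8 * a (2 ℕ.* o)
    ≡⟨ cong (λ z → - + 4 * (- + 4 * z - + 8 * a o) - + 8 * z) (a-2*odd r) ⟩
  - + 4 * (- + 4 * (- + 4 * a o) - + 8 * a o) - + 8 * (- + 4 * a o)          ≡⟨ lemma (a o) ⟩
  0ℤ                                                                         ∎
  where
  open ≡.≡-Reasoning
  o = suc (2 ℕ.* r)
  regroup : ∀ o → 8 ℕ.* o ≡ 4 ℕ.* (2 ℕ.* o)
  regroup = ℕ-Solver.solve-∀
  regroup′ : ∀ o → 2 ℕ.* (2 ℕ.* o) ≡ 4 ℕ.* o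
  regroup′ = ℕ-Solver.solve-∀
  lemma : ∀ x → - + 4 * (- + 4 * (- + 4 * x) - + 8 * x) - + 8 * (- + 4 * x) ≡ 0ℤ
  lemma = solve-∀

-- The recurrence along powers of two has characteristic roots -2 ± 2 i, and both have fourth power
-- -64.
a-16* : ∀ m → a (16 ℕ.* m) ≡ - + 64 * a m
a-16* m = begin
  a (16 ℕ.* m)                                                     ≡⟨ cong a (regroup m) ⟩
  a (4 ℕ.* (4 ℕ.* m))                                              ≡⟨ a-4* (4 ℕ.* m) ⟩
  - + 4 * a (2 ℕ.* (4 ℕ.* m)) - + 8 * a (4 ℕ.* m)
    ≡⟨ cong (λ z → - + 4 * z - + 8 * a (4 ℕ.* m)) (trans (cong a (regroup′ m)) (a-4* (2 ℕ.* m))) ⟩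
  - + 4 * (- + 4 * a (2 ℕ.* (2 ℕ.* m)) - + 8 * a (2 ℕ.* m)) - + 8 * a (4 ℕ.* m)
    ≡⟨ cong₂ (λ x y → - + 4 * (- + 4 * x - + 8 * a (2 ℕ.* m)) - + 8 * y) (trans (cong a (regroup″ m)) (a-4* m)) (a-4* m) ⟩
  - + 4 * (- + 4 * (- + 4 * a (2 ℕ.* m) - + 8 * a m) - + 8 * a (2 ℕ.* m)) - + 8 * (- + 4 * a (2 ℕ.* m) - + 8 * a m)
    ≡⟨ lemma (a (2 ℕ.* m)) (a m) ⟩
  - + 64 * a m                                                     ∎
  where
  open ≡.≡-Reasoning
  regroup : ∀ m → 16 ℕ.* m ≡ 4 ℕ.* (4 ℕ.* m)
  regroup = ℕ-Solver.solve-∀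
  regroup′ : ∀ m → 2 ℕ.* (4 ℕ.* m) ≡ 4 ℕ.* (2 ℕ.* m)
  regroup′ = ℕ-Solver.solve-∀
  regroup″ : ∀ m → 2 ℕ.* (2 ℕ.* m) ≡ 4 ℕ.* m
  regroup″ = ℕ-Solver.solve-∀
  lemma : ∀ x y → - + 4 * (- + 4 * (- + 4 * x - + 8 * y) - + 8 * x) - + 8 * (- + 4 * x - + 8 * y) ≡ - + 64 * y
  lemma = solve-∀

a-16^k* : ∀ k m → a (16 ℕ.^ k ℕ.* m) ≡ (- + 64) ^ k * a m
a-16^k* zero    m = trans (cong a (ℕ.*-identityˡ m)) (sym (ℤ.*-identityˡ (a m)))
a-16^k* (suc k) m = begin
  a (16 ℕ.* 16 ℕ.^ k ℕ.* m)        ≡⟨ cong a (ℕ.*-assoc 16 (16 ℕ.^ k) m) ⟩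
  a (16 ℕ.* (16 ℕ.^ k ℕ.* m))      ≡⟨ a-16* (16 ℕ.^ k ℕ.* m) ⟩
  - + 64 * a (16 ℕ.^ k ℕ.* m)      ≡⟨ cong (- + 64 *_) (a-16^k* k m) ⟩
  - + 64 * ((- + 64) ^ k * a m)    ≡⟨ ℤ.*-assoc (- + 64) ((- + 64) ^ k) (a m) ⟨
  (- + 64) ^ suc k * a m           ∎
  where open ≡.≡-Reasoning

parity-ℕ : ∀ m → ∃[ r ] (m ≡ 2 ℕ.* r ⊎ m ≡ suc (2 ℕ.* r))
parity-ℕ zero    = 0 , inj₁ refl
parity-ℕ (suc m) with parity-ℕ m
... | r , inj₁ refl = r , inj₂ refl
... | r , inj₂ refl = suc r , inj₁ (cong suc (sym (ℕ.+-suc r (r ℕ.+ 0))))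

4∣a-2* : ∀ m → + 4 Signed.∣ a (2 ℕ.* m)
4∣a-2* m with parity-ℕ m
... | r , inj₁ refl = Signed.divides (- a (2 ℕ.* r) - + 2 * a r)
  (trans (cong a (regroup r)) (trans (a-4* r) (lemma (a (2 ℕ.* r)) (a r))))
  where
  regroup : ∀ r → 2 ℕ.* (2 ℕ.* r) ≡ 4 ℕ.* r
  regroup = ℕ-Solver.solve-∀
  lemma : ∀ x y → - + 4 * x - + 8 * y ≡ (- x - + 2 * y) * + 4
  lemma = solve-∀
... | r , inj₂ refl = Signed.divides (- a (suc (2 ℕ.* r))) (trans (a-2*odd r) (lemma (a (suc (2 ℕ.* r)))))
  where
  lemma : ∀ x → - + 4 * x ≡ - x * + 4
  lemma = solve-∀

8∣a-4* : ∀ m → + 8 Signed.∣ a (4 ℕ.* m)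
8∣a-4* m with 4∣a-2* m
... | Signed.divides q e = Signed.divides (- + 2 * q - a m)
  (trans (a-4* m) (trans (cong (λ z → - + 4 * z - + 8 * a m) e) (lemma q (a m))))
  where
  lemma : ∀ q y → - + 4 * (q * + 4) - + 8 * y ≡ (- + 2 * q - y) * + 8
  lemma = solve-∀

-- The jump from 8 to 64 has two causes: odd m gives the value 0, and even m gives a multiple of 16,
-- where the factor -64 appears.
64∣a-8* : ∀ m → + 64 Signed.∣ a (8 ℕ.* m)
64∣a-8* m with parity-ℕ m
... | r , inj₁ refl = Signed.divides (- a r) (trans (cong a (regroup r)) (trans (a-16* r) (lemma (a r))))
  where
  regroup : ∀ r → 8 ℕ.* (2 ℕ.* r) ≡ 16 ℕ.* r
  regroup = ℕ-Solver.solve-∀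
  lemma : ∀ x → - + 64 * x ≡ - x * + 64
  lemma = solve-∀
... | r , inj₂ refl = Signed.divides 0ℤ (a-8*odd r)

64^k∣-64^k : ∀ k → (+ 64) ^ k Signed.∣ (- + 64) ^ k
64^k∣-64^k zero    = Signed.divides 1ℤ refl
64^k∣-64^k (suc k) with 64^k∣-64^k k
... | Signed.divides q e = Signed.divides (- q) (trans (cong (- + 64 *_) e) (lemma q ((+ 64) ^ k)))
  where
  lemma : ∀ q x → - + 64 * (q * x) ≡ - q * (+ 64 * x)
  lemma = solve-∀

2^4k : ∀ k → (+ 2) ^ (4 ℕ.* k) ≡ + (16 ℕ.^ k)
2^4k k = trans (sym (ℤ.^-*-assoc (+ 2) 4 k)) (power k)
  where
  power : ∀ k → (+ 16) ^ k ≡ + (16 ℕ.^ k)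
  power zero    = refl
  power (suc k) = trans (cong (+ 16 *_) (power k)) (sym (ℤ.pos-* 16 (16 ℕ.^ k)))

2^[4k+j] : ∀ k j → (+ 2) ^ (4 ℕ.* k ℕ.+ j) ≡ + (16 ℕ.^ k) * (+ 2) ^ j
2^[4k+j] k j = trans (ℤ.^-distribˡ-+-* (+ 2) (4 ℕ.* k) j) (cong (_* (+ 2) ^ j) (2^4k k))

-- The first four indices are 2^j (n + 2) - 1; the lower bound on n makes n + 2 a positive natural
-- number.
shift-2 : ∀ n → -1ℤ ≤ n → ∃[ t ] n ≡ + suc t - + 2
shift-2 (+ m)         _        = suc m , refl
shift-2 -[1+ zero ]   _        = 0 , refl
shift-2 -[1+ suc _ ]  (-≤- ())

-- Used with w = 16^k and c = 1, 2, 4, 8. The two powers of two enter as variables P and Q, so that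
-- the polynomial identity is proved once.
position : ∀ c w M {n P Q : ℤ} → n ≡ + M - + 2 → P ≡ + w * + c → Q ≡ + w * (+ c * + 2) →
           P * n + Q - + 1 ≡ + (w ℕ.* (c ℕ.* M)) - + 1
position c w M refl refl refl = cong (λ z → z - + 1)
  (trans (lemma (+ w) (+ c) (+ M)) (trans (cong (+ w *_) (sym (ℤ.pos-* c M))) (sym (ℤ.pos-* w (c ℕ.* M)))))
  where
  lemma : ∀ w c m → w * c * (m - + 2) + w * (c * + 2) ≡ w * (c * m)
  lemma = solve-∀

divisibility : ∀ k m {z i d U} → z ≡ + (16 ℕ.^ k ℕ.* m) - + 1 → i ≡ U * d → U ≡ (+ 64) ^ k →
               d Signed.∣ a m → i ∣ Pstar z
divisibility k m {d = d} refl refl refl (Signed.divides q e) with 64^k∣-64^k k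
... | Signed.divides p e′ = Signed.∣⇒∣ᵤ (Signed.divides (p * q) (trans (Pstar-a (16 ℕ.^ k ℕ.* m))
  (trans (a-16^k* k m) (trans (cong₂ _*_ e′ e) (lemma p ((+ 64) ^ k) q d)))))
  where
  lemma : ∀ p x q d → p * x * (q * d) ≡ p * q * (x * d)
  lemma = solve-∀

theorem1p2 : (k : ℕ) (n : ℤ) → -1ℤ ≤ n →
    ((+ 2) ^ (6 Data.Nat.* k) ∣ Pstar ((+ 2) ^ (4 Data.Nat.* k) * n + (+ 2) ^ (4 Data.Nat.* k Data.Nat.+ 1) - + 1))
    × ((+ 2) ^ (6 Data.Nat.* k Data.Nat.+ 2) ∣ Pstar ((+ 2) ^ (4 Data.Nat.* k Data.Nat.+ 1) * n + (+ 2) ^ (4 Data.Nat.* k Data.Nat.+ 2) - + 1))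
    × ((+ 2) ^ (6 Data.Nat.* k Data.Nat.+ 3) ∣ Pstar ((+ 2) ^ (4 Data.Nat.* k Data.Nat.+ 2) * n + (+ 2) ^ (4 Data.Nat.* k Data.Nat.+ 3) - + 1))
    × ((+ 2) ^ (6 Data.Nat.* k Data.Nat.+ 6) ∣ Pstar ((+ 2) ^ (4 Data.Nat.* k Data.Nat.+ 3) * n + (+ 2) ^ (4 Data.Nat.* k Data.Nat.+ 4) - + 1))
    × (Pstar ((+ 2) ^ (4 Data.Nat.* k Data.Nat.+ 4) * n + (+ 3) * (+ 2) ^ (4 Data.Nat.* k Data.Nat.+ 3) - + 1) ≡ + 0)
theorem1p2 k n -1≤n with shift-2 n -1≤n
... | t , n≡ =
    divisibility k (1 ℕ.* suc t) (position 1 (16 ℕ.^ k) (suc t) n≡ (trans (2^4k k) (sym (ℤ.*-identityʳ _))) (2^[4k+j] k 1))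
      (sym (ℤ.*-identityʳ ((+ 2) ^ (6 ℕ.* k)))) 2^6k (Signed.divides (a (1 ℕ.* suc t)) (sym (ℤ.*-identityʳ _)))
  , divisibility k (2 ℕ.* suc t) (position 2 (16 ℕ.^ k) (suc t) n≡ (2^[4k+j] k 1) (2^[4k+j] k 2))
      (ℤ.^-distribˡ-+-* (+ 2) (6 ℕ.* k) 2) 2^6k (4∣a-2* (suc t))
  , divisibility k (4 ℕ.* suc t) (position 4 (16 ℕ.^ k) (suc t) n≡ (2^[4k+j] k 2) (2^[4k+j] k 3))
      (ℤ.^-distribˡ-+-* (+ 2) (6 ℕ.* k) 3) 2^6k (8∣a-4* (suc t))
  , divisibility k (8 ℕ.* suc t) (position 8 (16 ℕ.^ k) (suc t) n≡ (2^[4k+j] k 3) (2^[4k+j] k 4))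
      (ℤ.^-distribˡ-+-* (+ 2) (6 ℕ.* k) 6) 2^6k (64∣a-8* (suc t))
  , (begin
      Pstar ((+ 2) ^ (4 ℕ.* k ℕ.+ 4) * n + (+ 3) * (+ 2) ^ (4 ℕ.* k ℕ.+ 3) - + 1)  ≡⟨ cong Pstar position-8*odd ⟩
      Pstar (+ (16 ℕ.^ k ℕ.* (8 ℕ.* suc (2 ℕ.* t))) - + 1)
        ≡⟨ Pstar-a (16 ℕ.^ k ℕ.* (8 ℕ.* suc (2 ℕ.* t))) ⟩
      a (16 ℕ.^ k ℕ.* (8 ℕ.* suc (2 ℕ.* t)))                                      ≡⟨ a-16^k* k (8 ℕ.* suc (2 ℕ.* t)) ⟩
      (- + 64) ^ k * a (8 ℕ.* suc (2 ℕ.* t))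
        ≡⟨ cong ((- + 64) ^ k *_) (a-8*odd t) ⟩
      (- + 64) ^ k * 0ℤ                                                           ≡⟨ ℤ.*-zeroʳ ((- + 64) ^ k) ⟩
      + 0                                                                         ∎)
  where
  open ≡.≡-Reasoning
  2^6k : (+ 2) ^ (6 ℕ.* k) ≡ (+ 64) ^ k
  2^6k = sym (ℤ.^-*-assoc (+ 2) 6 k)
  -- Here 16 n + 24 = 8 (2 n + 3), and n = t - 1 turns 2 n + 3 into the odd number 2 t + 1.
  position-8*odd : (+ 2) ^ (4 ℕ.* k ℕ.+ 4) * n + (+ 3) * (+ 2) ^ (4 ℕ.* k ℕ.+ 3) - + 1
                   ≡ + (16 ℕ.^ k ℕ.* (8 ℕ.* suc (2 ℕ.* t))) - + 1
  position-8*odd = cong (λ z → z - + 1) (begin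
    (+ 2) ^ (4 ℕ.* k ℕ.+ 4) * n + (+ 3) * (+ 2) ^ (4 ℕ.* k ℕ.+ 3)
      ≡⟨ cong₂ (λ x y → x * n + (+ 3) * y) (2^[4k+j] k 4) (2^[4k+j] k 3) ⟩
    + w * + 16 * n + + 3 * (+ w * + 8)
      ≡⟨ cong (λ z → + w * + 16 * z + + 3 * (+ w * + 8)) n≡ ⟩
    + w * + 16 * (1ℤ + + t - + 2) + + 3 * (+ w * + 8)
      ≡⟨ lemma (+ w) (+ t) ⟩
    + w * (+ 8 * (1ℤ + + 2 * + t))
      ≡⟨ cong (λ z → + w * (+ 8 * (1ℤ + z))) (ℤ.pos-* 2 t) ⟨
    + w * (+ 8 * + suc (2 ℕ.* t))
      ≡⟨ cong (+ w *_) (ℤ.pos-* 8 (suc (2 ℕ.* t))) ⟨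
    + w * + (8 ℕ.* suc (2 ℕ.* t))
      ≡⟨ ℤ.pos-* w (8 ℕ.* suc (2 ℕ.* t)) ⟨
    + (w ℕ.* (8 ℕ.* suc (2 ℕ.* t))) ∎)
    where
    w = 16 ℕ.^ k
    lemma : ∀ w t → w * + 16 * (1ℤ + t - + 2) + + 3 * (w * + 8) ≡ w * (+ 8 * (1ℤ + + 2 * t))
    lemma = solve-∀
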